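{- Let $d\ge 3$, let $V$ be a $2d$-dimensional vector space over $\mathbb{F}_q$ provided with a nondegenerate symplectic form, and let $\mathbf{P}$ be the associated polar space $\mathrm{Sp}_{2d}(q)$. Let $U$ be (the set of points of) a totally isotropic $d$-space, let $\mathcal{H}$ be the set of hyperplanes of $U$, let $\mathbf{D}$ be a symmetric design on the point set $U$ with the parameters $2$-$\big(\frac{q^{d}-1}{q-1}, \frac{q^{d-1}-1}{q-1}, \frac{q^{d-2}-1}{q-1}\big)$, and let $\phi$ be a bijection from $\mathcal{H}$ to the set of blocks of $\mathbf{D}$. Then the graph $\Gamma_\phi$ satisfies the $4$-vertex condition.
   Context: The points of the symplectic polar space $\mathbf{P}$ are all $1$-dimensional subspaces of $V$; its lines are the totally isotropic $2$-dimensional subspaces. Let $P$ be its point set. For a point $x$, $x^\perp$ is the set of points collinear with (i.e. orthogonal to) $x$, including $x$ itself. Subspaces are identified with their sets of projective points, and "hyperplane of $U$" means $(d-1)$-dimensional subspace of $U$. For $y \in P\setminus U$ the set $y^\perp\cap U$ is a hyperplane of $U$. The image of $H$ under $\phi$ is written $H^\phi$, a block of $\mathbf{D}$, viewed as a subset of $U$. The graph $\Gamma_\phi$ has vertex set $P$, with adjacency as follows: (1) distinct vertices in $U$ are adjacent; (2) distinct vertices $x,y \notin U$ are adjacent if and only if $x \in y^\perp$; (3) vertices $x \in U$, $y \notin U$ are adjacent if and only if $x \in (y^\perp \cap U)^\phi$. A graph $\Gamma$ satisfies the $t$-vertex condition if, for all triples $(T,x_0,y_0)$ consisting of a $t$-vertex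 graph $T$ together with two distinct distinguished vertices $x_0,y_0$ of $T$, and all pairs of distinct vertices $x,y$ of $\Gamma$, the number of isomorphic copies of $T$ in $\Gamma$ (as induced subgraphs), where the isomorphism maps $x_0$ to $x$ and $y_0$ to $y$, does not depend on the choice of the pair $x,y$ but only on whether $x,y$ are adjacent or nonadjacent. -}

module Defs where

open import Algebra.Apartness.Bundles using (HeytingField; HeytingCommutativeRing)
open import Algebra.Bundles using (CommutativeRing)
open import Algebra.Module.Bundles using (Module)
import Algebra.Apartness.Properties.HeytingCommutativeRing as HeytingProperties
import Algebra.Properties.Monoid.Sum as Sum
open import Data.Fin.Base using (Fin; zero; suc)
open import Data.Nat.Base using (ℕ; zero; suc; _∸_; _^_; _/_; NonZero)
open import Data.Product.Base using (Σ; Σ-syntax; ∃-syntax; _×_; _,_; proj₁; proj₂)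
open import Data.Vec.Functional using (Vector)
open import Function.Bundles using (Inverse; Bijection; _⇔_; mk⇔)
open import Function.Definitions using (Injective)
open import Level using (Level; _⊔_; 0ℓ) renaming (suc to lsuc)
open import Relation.Binary.Bundles using (Setoid)
open import Relation.Binary.Core using (Rel)
open import Relation.Binary.Definitions
  using (Symmetric; Irreflexive; Decidable; _Respects₂_)
import Relation.Binary.Construct.On as On
open import Relation.Binary.PropositionalEquality.Core as ≡ using (_≡_; _≢_)
import Relation.Binary.PropositionalEquality.Properties as ≡
import Relation.Binary.Reasoning.Setoid as ≈-Reasoning
open import Relation.Nullary.Negation using (¬_; contradiction)
open import Relation.Unary using (Pred; _∈_; _⊆′_; _∩_; _≐′_)
open import Relation.Unary.Relation.Binary.Equality using (≐′-setoid)

private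
  variable
    a b c e ℓ ℓ₁ ℓ₂ m ℓm v : Level

HasSize : Setoid a ℓ → ℕ → Set (a ⊔ ℓ)
HasSize S n = Inverse S (≡.setoid (Fin n))

record Graph (V : Setoid v ℓ) e : Set (v ⊔ ℓ ⊔ lsuc e) where
  open Setoid V
  infix 4 _~_
  field
    _~_      : Rel Carrier e
    ~-resp-≈ : _~_ Respects₂ _≈_
    ~-sym    : Symmetric _~_
    ~-irrefl : Irreflexive _≈_ _~_

module _ {V : Setoid v ℓ} (Γ : Graph V e) where
  open Setoid V using (Carrier; _≈_; _≉_)
  open Graph Γ using (_~_)

  -- An isomorphism from T, with x₀ and y₀ distinguished, onto an induced
  -- subgraph of Γ, mapping x₀ to x and y₀ to y.
  record Embedding {t} (T : Graph (≡.setoid (Fin t)) 0ℓ) (x₀ y₀ : Fin t)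
                   (x y : Carrier) : Set (v ⊔ ℓ ⊔ e) where
    field
      to        : Fin t → Carrier
      injective : Injective _≡_ _≈_ to
      induced   : ∀ i j → Graph._~_ T i j ⇔ to i ~ to j
      x₀↦x      : to x₀ ≈ x
      y₀↦y      : to y₀ ≈ y

    vertexSet : Pred Carrier ℓ
    vertexSet z = ∃[ i ] to i ≈ z

  -- A copy of T is the induced subgraph, not the isomorphism onto it:
  -- embeddings with the same vertex set are the same copy.
  Copies : ∀ {t} → Graph (≡.setoid (Fin t)) 0ℓ → (x₀ y₀ : Fin t) →
           (x y : Carrier) → Setoid _ _
  Copies T x₀ y₀ x y =
    On.setoid (≐′-setoid Carrier ℓ) (Embedding.vertexSet {T = T} {x₀} {y₀} {x} {y})

  VertexCondition : ℕ → Set _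
  VertexCondition t =
    (T : Graph (≡.setoid (Fin t)) 0ℓ) → Decidable (Graph._~_ T) →
    (x₀ y₀ : Fin t) → x₀ ≢ y₀ →
    ∃[ n₁ ] ∃[ n₀ ] (∀ x y → x ≉ y →
      (x ~ y → HasSize (Copies T x₀ y₀ x y) n₁) ×
      (¬ (x ~ y) → HasSize (Copies T x₀ y₀ x y) n₀))

-- The blocks are given as a family of subsets of X; indices naming the
-- same subset are identified.
record SymmetricDesign (X : Setoid a ℓ) (v k lam : ℕ) b e
                       : Set (a ⊔ ℓ ⊔ lsuc (b ⊔ e)) where
  open Setoid X
  field
    Block      : Set b
    block      : Block → Pred Carrier e
    block-resp : ∀ B {x y} → x ≈ y → x ∈ block B → y ∈ block B

  Blocks : Setoid b (a ⊔ e)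
  Blocks = On.setoid (≐′-setoid Carrier e) block

  pointsOf : Block → Setoid (a ⊔ e) ℓ
  pointsOf B = On.setoid X (proj₁ {B = λ x → x ∈ block B})

  blocksThrough : Carrier → Carrier → Setoid (b ⊔ e) (a ⊔ e)
  blocksThrough x y =
    On.setoid Blocks (proj₁ {B = λ B → x ∈ block B × y ∈ block B})

  field
    points-size        : HasSize X v
    block-size         : ∀ B → HasSize (pointsOf B) k
    blocksThrough-size : ∀ x y → x ≉ y → HasSize (blocksThrough x y) lam
    blocks-size        : HasSize Blocks v

-- On a finite carrier _≈_ is decidable and _#_ is its negation, so a
-- finite Heyting field is a finite field in the usual sense.
record FiniteField c ℓ₁ ℓ₂ (q : ℕ) : Set (lsuc (c ⊔ ℓ₁ ⊔ ℓ₂)) where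
  field
    heytingField : HeytingField c ℓ₁ ℓ₂

  open HeytingField heytingField public
    using (heytingCommutativeRing)
  open HeytingCommutativeRing heytingCommutativeRing public
    using (commutativeRing; #-irrefl)
  open CommutativeRing commutativeRing public
  open HeytingProperties heytingCommutativeRing using (1#0)

  field
    order : HasSize setoid q

  0≉1 : 0# ≉ 1#
  0≉1 0≈1 = #-irrefl (sym 0≈1) 1#0

  instance
    q∸1-nonZero : NonZero (q ∸ 1)
    q∸1-nonZero = go q order
      where
      go : ∀ n → HasSize setoid n → NonZero (n ∸ 1)
      go zero          s with () ← Inverse.to s 0#
      go (suc (suc n)) s = _
      go (suc zero)    s = contradiction
        (trans (sym (Inverse.strictlyInverseʳ s 0#))
          (trans (Inverse.from-cong s (single _ _)) (Inverse.strictlyInverseʳ s 1#)))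
        0≉1
        where
        single : (i j : Fin 1) → i ≡ j
        single zero zero = ≡.refl

  -- The number of points of an n-dimensional space.
  θ : ℕ → ℕ
  θ n = (q ^ n ∸ 1) / (q ∸ 1)

module Geometry {q} (F : FiniteField c ℓ₁ ℓ₂ q)
                (V : Module (FiniteField.commutativeRing F) m ℓm) where

  open FiniteField F
  open Module V
  open Sum +ᴹ-monoid using (sum)

  record Basis (W : Pred Carrierᴹ ℓ) (k : ℕ) : Set (c ⊔ ℓ₁ ⊔ m ⊔ ℓm ⊔ ℓ) where
    field
      basis       : Vector Carrierᴹ k
      basis∈W     : ∀ i → basis i ∈ W
      spanning    : ∀ {x} → x ∈ W →
                    Σ[ a ∈ Vector Carrier k ] x ≈ᴹ sum (λ i → a i *ₗ basis i)
      independent : ∀ (a : Vector Carrier k) →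
                    sum (λ i → a i *ₗ basis i) ≈ᴹ 0ᴹ → ∀ i → a i ≈ 0#

  subspaceLevel : Level
  subspaceLevel = c ⊔ ℓ₁ ⊔ m ⊔ ℓm

  record Subspace (k : ℕ) : Set (lsuc subspaceLevel) where
    field
      ⟦_⟧       : Pred Carrierᴹ subspaceLevel
      resp      : ∀ {x y} → x ≈ᴹ y → x ∈ ⟦_⟧ → y ∈ ⟦_⟧
      0-closed  : 0ᴹ ∈ ⟦_⟧
      +-closed  : ∀ {x y} → x ∈ ⟦_⟧ → y ∈ ⟦_⟧ → x +ᴹ y ∈ ⟦_⟧
      *-closed  : ∀ a {x} → x ∈ ⟦_⟧ → a *ₗ x ∈ ⟦_⟧
      dimension : Basis ⟦_⟧ k

  open Subspace public using (⟦_⟧)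

  Subspaces : ℕ → Setoid _ _
  Subspaces k = On.setoid (≐′-setoid Carrierᴹ subspaceLevel) (⟦_⟧ {k})

  Point : Set _
  Point = Subspace 1

  Points : Setoid _ _
  Points = Subspaces 1

  PointsIn : ∀ {k} → Subspace k → Setoid _ _
  PointsIn W = On.setoid Points (proj₁ {B = λ x → ⟦ x ⟧ ⊆′ ⟦ W ⟧})

  Hyperplanes : ∀ {k} → Subspace k → Setoid _ _
  Hyperplanes {k} W =
    On.setoid (Subspaces (k ∸ 1)) (proj₁ {B = λ H → ⟦ H ⟧ ⊆′ ⟦ W ⟧})

  record SymplecticForm : Set (c ⊔ ℓ₁ ⊔ m ⊔ ℓm) where
    field
      ⟨_,_⟩         : Carrierᴹ → Carrierᴹ → Carrier
      ⟨⟩-cong       : ∀ {x x′ y y′} → x ≈ᴹ x′ → y ≈ᴹ y′ → ⟨ x , y ⟩ ≈ ⟨ x′ , y′ ⟩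
      ⟨⟩-+ˡ         : ∀ x y z → ⟨ x +ᴹ y , z ⟩ ≈ ⟨ x , z ⟩ + ⟨ y , z ⟩
      ⟨⟩-*ˡ         : ∀ a x y → ⟨ a *ₗ x , y ⟩ ≈ a * ⟨ x , y ⟩
      ⟨⟩-+ʳ         : ∀ x y z → ⟨ x , y +ᴹ z ⟩ ≈ ⟨ x , y ⟩ + ⟨ x , z ⟩
      ⟨⟩-*ʳ         : ∀ a x y → ⟨ x , a *ₗ y ⟩ ≈ a * ⟨ x , y ⟩
      alternating   : ∀ x → ⟨ x , x ⟩ ≈ 0#
      nondegenerate : ∀ x → (∀ y → ⟨ x , y ⟩ ≈ 0#) → x ≈ᴹ 0ᴹ

    infix 8 _⊥
    _⊥ : Pred Carrierᴹ ℓ → Pred Carrierᴹ (ℓ₁ ⊔ m ⊔ ℓ)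
    (W ⊥) x = ∀ y → y ∈ W → ⟨ x , y ⟩ ≈ 0#

    TotallyIsotropic : ∀ {k} → Subspace k → Set _
    TotallyIsotropic W = ⟦ W ⟧ ⊆′ ⟦ W ⟧ ⊥

    ⟨⟩-reflexive : ∀ {x y} → ⟨ x , y ⟩ ≈ 0# → ⟨ y , x ⟩ ≈ 0#
    ⟨⟩-reflexive {x} {y} xy≈0 = begin
      ⟨ y , x ⟩                                         ≈⟨ +-identityˡ _ ⟨
      0# + ⟨ y , x ⟩                                    ≈⟨ +-cong 0≈xx+xy yx≈yx+yy ⟩
      (⟨ x , x ⟩ + ⟨ x , y ⟩) + (⟨ y , x ⟩ + ⟨ y , y ⟩) ≈⟨ +-cong (⟨⟩-+ʳ x x y) (⟨⟩-+ʳ y x y) ⟨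
      ⟨ x , x +ᴹ y ⟩ + ⟨ y , x +ᴹ y ⟩                   ≈⟨ ⟨⟩-+ˡ x y (x +ᴹ y) ⟨
      ⟨ x +ᴹ y , x +ᴹ y ⟩                               ≈⟨ alternating (x +ᴹ y) ⟩
      0#                                                ∎
      where
      open ≈-Reasoning setoid
      0≈xx+xy : 0# ≈ ⟨ x , x ⟩ + ⟨ x , y ⟩
      0≈xx+xy = sym (trans (+-cong (alternating x) xy≈0) (+-identityˡ 0#))
      yx≈yx+yy : ⟨ y , x ⟩ ≈ ⟨ y , x ⟩ + ⟨ y , y ⟩
      yx≈yx+yy = trans (sym (+-identityʳ _)) (+-congˡ (sym (alternating y)))

  module _ (ω : SymplecticForm) {d} (U : Subspace d) {v k lam}
           (𝐃 : SymmetricDesign (PointsIn U) v k lam b e)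
           (φ : Bijection (Hyperplanes U) (SymmetricDesign.Blocks 𝐃)) where

    open SymplecticForm ω
    open SymmetricDesign 𝐃 using (block; block-resp)
    open Setoid Points using () renaming (_≈_ to _≈ₚ_; _≉_ to _≉ₚ_)

    infix 4 _∈⟨_^⊥∩U⟩^φ
    -- x ∈ (y^⊥ ∩ U)^φ: the hyperplane H = y^⊥ ∩ U is supplied together with
    -- the proof that it is one.
    record _∈⟨_^⊥∩U⟩^φ (x y : Point) : Set (lsuc subspaceLevel ⊔ e) where
      constructor mk
      field
        x⊆U   : ⟦ x ⟧ ⊆′ ⟦ U ⟧
        H     : Setoid.Carrier (Hyperplanes U)
        H≐    : ⟦ proj₁ H ⟧ ≐′ ⟦ y ⟧ ⊥ ∩ ⟦ U ⟧
        x∈Hᵠ  : (x , x⊆U) ∈ block (Bijection.to φ H)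

    data Adjacent (x y : Point) : Set (lsuc subspaceLevel ⊔ e) where
      both-in  : x ≉ₚ y → ⟦ x ⟧ ⊆′ ⟦ U ⟧ → ⟦ y ⟧ ⊆′ ⟦ U ⟧ → Adjacent x y
      both-out : x ≉ₚ y → ¬ ⟦ x ⟧ ⊆′ ⟦ U ⟧ → ¬ ⟦ y ⟧ ⊆′ ⟦ U ⟧ →
                 ⟦ x ⟧ ⊆′ ⟦ y ⟧ ⊥ → Adjacent x y
      in-out   : ⟦ x ⟧ ⊆′ ⟦ U ⟧ → ¬ ⟦ y ⟧ ⊆′ ⟦ U ⟧ → x ∈⟨ y ^⊥∩U⟩^φ → Adjacent x y
      out-in   : ¬ ⟦ x ⟧ ⊆′ ⟦ U ⟧ → ⟦ y ⟧ ⊆′ ⟦ U ⟧ → y ∈⟨ x ^⊥∩U⟩^φ → Adjacent x y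

    private
      open Setoid Points using ()
        renaming (refl to ≈ₚ-refl; sym to ≈ₚ-sym; trans to ≈ₚ-trans)

      ≉-resp : ∀ {x y x′ y′} → x ≈ₚ x′ → y ≈ₚ y′ → x ≉ₚ y → x′ ≉ₚ y′
      ≉-resp {x} {y} {x′} {y′} p p′ x≉y q = x≉y
        (≈ₚ-trans {x} {x′} {y} p
          (≈ₚ-trans {x′} {y′} {y} q (≈ₚ-sym {y} {y′} p′)))

      ⊆-resp : ∀ {x x′} → x ≈ₚ x′ → ⟦ x ⟧ ⊆′ ⟦ U ⟧ → ⟦ x′ ⟧ ⊆′ ⟦ U ⟧
      ⊆-resp (_ , x′⊆x) x⊆U u h = x⊆U u (x′⊆x u h)

      ⊈-resp : ∀ {x x′} → x ≈ₚ x′ → ¬ ⟦ x ⟧ ⊆′ ⟦ U ⟧ → ¬ ⟦ x′ ⟧ ⊆′ ⟦ U ⟧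
      ⊈-resp (x⊆x′ , _) x⊈U x′⊆U = x⊈U (λ u h → x′⊆U u (x⊆x′ u h))

      φ-resp : ∀ {x x′ y y′} → x ≈ₚ x′ → y ≈ₚ y′ →
               x ∈⟨ y ^⊥∩U⟩^φ → x′ ∈⟨ y′ ^⊥∩U⟩^φ
      φ-resp {x} {x′} p (y⊆y′ , y′⊆y) (mk x⊆U H (H⊆ , ⊆H) x∈) = mk
        (⊆-resp {x} {x′} p x⊆U) H
        ( (λ z h → (λ w i → proj₁ (H⊆ z h) w (y′⊆y w i)) , proj₂ (H⊆ z h))
        , (λ z (o , u) → ⊆H z ((λ w i → o w (y⊆y′ w i)) , u)))
        (block-resp (Bijection.to φ H) p x∈)

      resp : ∀ {x y x′ y′} → x ≈ₚ x′ → y ≈ₚ y′ → Adjacent x y → Adjacent x′ y′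
      resp {x} {y} {x′} {y′} p p′ (both-in n i j) =
        both-in (≉-resp {x} {y} {x′} {y′} p p′ n)
          (⊆-resp {x} {x′} p i) (⊆-resp {y} {y′} p′ j)
      resp {x} {y} {x′} {y′} p p′ (both-out n i j o) =
        both-out (≉-resp {x} {y} {x′} {y′} p p′ n)
          (⊈-resp {x} {x′} p i) (⊈-resp {y} {y′} p′ j)
          (λ z z∈x′ w w∈y′ → o z (proj₂ p z z∈x′) w (proj₂ p′ w w∈y′))
      resp {x} {y} {x′} {y′} p p′ (in-out i j o) =
        in-out (⊆-resp {x} {x′} p i) (⊈-resp {y} {y′} p′ j)
          (φ-resp {x} {x′} {y} {y′} p p′ o)
      resp {x} {y} {x′} {y′} p p′ (out-in i j o) =
        out-in (⊈-resp {x} {x′} p i) (⊆-resp {y} {y′} p′ j)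
          (φ-resp {y} {y′} {x} {x′} p′ p o)

      ~sym : ∀ {x y} → Adjacent x y → Adjacent y x
      ~sym {x} {y} (both-in n i j)    = both-in (λ q → n (≈ₚ-sym {y} {x} q)) j i
      ~sym {x} {y} (both-out n i j o) =
        both-out (λ q → n (≈ₚ-sym {y} {x} q)) j i (λ z z∈y w w∈x → ⟨⟩-reflexive (o w w∈x z z∈y))
      ~sym (in-out i j o)     = out-in j i o
      ~sym (out-in i j o)     = in-out j i o

      ~irrefl : ∀ {x y} → x ≈ₚ y → ¬ Adjacent x y
      ~irrefl p (both-in n _ _)    = n p
      ~irrefl p (both-out n _ _ _) = n p
      ~irrefl {x} {y} p (in-out i j _)  = j (⊆-resp {x} {y} p i)
      ~irrefl {x} {y} p (out-in i j _)  = ⊈-resp {x} {y} p i j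

    Γ : Graph Points (lsuc subspaceLevel ⊔ e)
    Γ = record
      { _~_      = Adjacent
      ; ~-resp-≈ = (λ {x} {y} {z} p → resp {x} {y} {x} {z} (≈ₚ-refl {x}) p)
                 , (λ {y} {x} {z} p → resp {x} {y} {z} {y} p (≈ₚ-refl {y}))
      ; ~-sym    = ~sym
      ; ~-irrefl = λ {x} {y} → ~irrefl {x} {y}
      }

{-# OPTIONS --safe #-}

-- Let M be the adjacency matrix of Γ_φ with ones added on the diagonal.  A
-- graph satisfies the 4-vertex condition as soon as the row sums of M, the
-- entries of M² off the diagonal, and the numbers
--   E(x, y) = ∑_{z,w} M(x,z) M(y,z) M(x,w) M(y,w) M(z,w)   (x ≠ y)
-- depend only on the relation between x and y: the number of labelled copies
-- of a given T is multilinear in five functions of that relation, and when one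
-- of them is the identity or constant, the sum reduces to entries of products
-- of two matrices in the span of I, J and M.
--
-- The blocks of 𝐃 correspond to the hyperplanes of U.  Choose for each block A
-- a vector y_A with y_A^⊥ ∩ U the hyperplane of A; as U^⊥ = U, the points
-- outside U are the points on y_A + u with u ∈ U, each exactly once.  So a
-- hyperplane and an orthogonality condition on a vector outside U become
-- linear equations for u, and the sums above are evaluated with the design
-- axioms for 𝐃 and its dual.  In E(x, y) the part with x, y, z, w all
-- outside U does not involve φ; it is found by inclusion and exclusion from
-- the number of orthogonal pairs of vectors in {x, y}^⊥.
module Submission where

module Counting where

  open import Level using (0ℓ)
  open import Data.Bool.Base using (true; false)
  open import Data.Fin.Base as Fin using (Fin; zero; suc; _↑ˡ_; _↑ʳ_; combine; remQuot)
  open import Data.Fin.Patterns using (0F; 1F; 2F; 3F)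
  import Data.Fin.Permutation as Perm
  import Data.Fin.Properties as Fin
  open import Data.Nat.Base
  open import Data.Nat.DivMod using (m*n/n≡m)
  open import Data.Nat.Properties
  open import Data.Nat.Tactic.RingSolver using (solve-∀)
  open import Data.Product.Base using (Σ; ∃; ∃-syntax; _×_; _,_; proj₁; proj₂; uncurry)
  open import Data.Sum.Base using (_⊎_; inj₁; inj₂)
  open import Function.Base using (_∘_)
  open import Function.Bundles using (Inverse; Equivalence; mk⇔)
  import Function.Construct.Composition as Comp
  import Function.Construct.Symmetry as Symm
  open import Relation.Binary.Bundles using (Setoid)
  import Relation.Binary.Construct.On as On
  open import Relation.Binary.Definitions using (DecidableEquality; Decidable; tri<; tri≈; tri>)
  open import Relation.Binary.PropositionalEquality
    using (_≡_; _≢_; refl; sym; trans; cong; cong₂; subst; module ≡-Reasoning)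
    renaming (setoid to ≡-setoid)
  open import Relation.Nullary.Decidable
    using (Dec; yes; no; _because_; dec-true; dec-false; map′; _×-dec_; _→-dec_)
  open import Relation.Nullary.Negation using (¬_; contradiction)
  open import Relation.Unary using (Pred)
  import Algebra.Properties.Semiring.Sum +-*-semiring as Sum
  open import Defs

  𝟙 : ∀ {p} {P : Set p} → Dec P → ℕ
  𝟙 (true  because _) = 1
  𝟙 (false because _) = 0

  𝟙-yes : ∀ {p} {P : Set p} (d : Dec P) → P → 𝟙 d ≡ 1
  𝟙-yes (yes _) _ = refl
  𝟙-yes (no ¬p) p = contradiction p ¬p

  𝟙-no : ∀ {p} {P : Set p} (d : Dec P) → ¬ P → 𝟙 d ≡ 0
  𝟙-no (yes p) ¬p = contradiction p ¬p
  𝟙-no (no _)  _  = refl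

  𝟙-cong : ∀ {p q} {P : Set p} {Q : Set q} (d : Dec P) (e : Dec Q) →
           (P → Q) → (Q → P) → 𝟙 d ≡ 𝟙 e
  𝟙-cong (yes p) e f g = sym (𝟙-yes e (f p))
  𝟙-cong (no ¬p) e f g = sym (𝟙-no e (¬p ∘ g))

  𝟙≡1⇒ : ∀ {p} {P : Set p} (d : Dec P) → 𝟙 d ≡ 1 → P
  𝟙≡1⇒ (yes p) _ = p

  𝟙-idem : ∀ {p} {P : Set p} (d : Dec P) → 𝟙 d * 𝟙 d ≡ 𝟙 d
  𝟙-idem (yes _) = refl
  𝟙-idem (no _)  = refl

  𝟙-× : ∀ {p q} {P : Set p} {Q : Set q} (d : Dec P) (e : Dec Q) →
        𝟙 (d ×-dec e) ≡ 𝟙 d * 𝟙 e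
  𝟙-× (yes _) (yes _) = refl
  𝟙-× (yes _) (no _)  = refl
  𝟙-× (no _)  _       = refl

  opaque
    ∑ : ∀ n → (Fin n → ℕ) → ℕ
    ∑ n f = Sum.sum f

  infixl 10 ∑
  syntax ∑ n (λ i → x) = ∑[ i < n ] x

  opaque
    unfolding ∑

    ∑-cong : ∀ {n} {f g : Fin n → ℕ} → (∀ i → f i ≡ g i) → ∑ n f ≡ ∑ n g
    ∑-cong = Sum.sum-cong-≗

    ∑-const : ∀ n c → ∑[ i < n ] c ≡ n * c
    ∑-const zero    c = refl
    ∑-const (suc n) c = cong (c +_) (∑-const n c)

    ∑-zero : ∀ {n} {f : Fin n → ℕ} → (∀ i → f i ≡ 0) → ∑ n f ≡ 0
    ∑-zero {n} f≡0 = trans (∑-cong f≡0) (trans (∑-const n 0) (*-zeroʳ n))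

    ∑-+ : ∀ {n} (f g : Fin n → ℕ) → ∑[ i < n ] (f i + g i) ≡ ∑ n f + ∑ n g
    ∑-+ = Sum.∑-distrib-+

    *-∑ˡ : ∀ {n} c (f : Fin n → ℕ) → c * ∑ n f ≡ ∑[ i < n ] (c * f i)
    *-∑ˡ = Sum.*-distribˡ-sum

    *-∑ʳ : ∀ {n} c (f : Fin n → ℕ) → ∑ n f * c ≡ ∑[ i < n ] (f i * c)
    *-∑ʳ = Sum.*-distribʳ-sum

    ∑-comm : ∀ {m n} (f : Fin m → Fin n → ℕ) →
             ∑[ i < m ] ∑[ j < n ] f i j ≡ ∑[ j < n ] ∑[ i < m ] f i j
    ∑-comm = Sum.∑-comm

    ∑-permute : ∀ {m n} (f : Fin n → ℕ) (π : Perm.Permutation m n) →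
                ∑ n f ≡ ∑[ i < m ] f (π Perm.⟨$⟩ʳ i)
    ∑-permute = Sum.∑-permute

    ∑-single : ∀ {n} {f : Fin n → ℕ} i → (∀ j → j ≢ i → f j ≡ 0) → ∑ n f ≡ f i
    ∑-single {f = f} zero    h = trans (cong (f zero +_) (∑-zero λ j → h (suc j) λ ()))
                                       (+-identityʳ (f zero))
    ∑-single {suc n} {f} (suc i) h = trans (cong (_+ ∑ n (f ∘ suc)) (h zero λ ()))
      (∑-single i λ j j≢i → h (suc j) (j≢i ∘ Fin.suc-injective))

    ∑-mono-≤ : ∀ {n} {f g : Fin n → ℕ} → (∀ i → f i ≤ g i) → ∑ n f ≤ ∑ n g
    ∑-mono-≤ {zero}  f≤g = z≤n
    ∑-mono-≤ {suc n} f≤g = +-mono-≤ (f≤g zero) (∑-mono-≤ (f≤g ∘ suc))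

    ∑-mono-< : ∀ {n} {f g : Fin n → ℕ} → (∀ i → f i ≤ g i) → ∀ i → f i < g i → ∑ n f < ∑ n g
    ∑-mono-< f≤g zero    fi<gi = +-mono-<-≤ fi<gi (∑-mono-≤ (f≤g ∘ suc))
    ∑-mono-< f≤g (suc i) fi<gi = +-mono-≤-< (f≤g zero) (∑-mono-< (f≤g ∘ suc) i fi<gi)

    ∑-++ : ∀ m {n} (f : Fin (m + n) → ℕ) →
           ∑ (m + n) f ≡ ∑[ i < m ] f (i ↑ˡ n) + ∑[ j < n ] f (m ↑ʳ j)
    ∑-++ zero    f = refl
    ∑-++ (suc m) f = trans (cong (f zero +_) (∑-++ m (f ∘ suc))) (sym (+-assoc (f zero) _ _))

    ∑-combine : ∀ m {n} (f : Fin (m * n) → ℕ) →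
                ∑ (m * n) f ≡ ∑[ i < m ] ∑[ j < n ] f (combine i j)
    ∑-combine zero        f = refl
    ∑-combine (suc m) {n} f = trans (∑-++ n f)
      (cong (∑[ j < n ] f (j ↑ˡ (m * n)) +_) (∑-combine m (λ i → f (n ↑ʳ i))))

  ∑-δ : ∀ {n} (i : Fin n) (f : Fin n → ℕ) → ∑[ j < n ] (𝟙 (i Fin.≟ j) * f j) ≡ f i
  ∑-δ i f = trans
    (∑-single i λ j j≢i → cong (_* f j) (𝟙-no (i Fin.≟ j) (j≢i ∘ sym)))
    (trans (cong (_* f i) (𝟙-yes (i Fin.≟ i) refl)) (*-identityˡ (f i)))

  ∑-≤-≡⇒≡ : ∀ {n} {f g : Fin n → ℕ} → (∀ i → f i ≤ g i) → ∑ n f ≡ ∑ n g →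
            ∀ i → f i ≡ g i
  ∑-≤-≡⇒≡ {f = f} {g} f≤g Σf≡Σg i with f i ≟ g i
  ... | yes fi≡gi = fi≡gi
  ... | no  fi≢gi = contradiction Σf≡Σg (<⇒≢ (∑-mono-< f≤g i (≤∧≢⇒< (f≤g i) fi≢gi)))

  module _ {a ℓ} (S : Setoid a ℓ) where
    open Setoid S renaming (refl to ≈-refl; sym to ≈-sym; trans to ≈-trans)

    restrict : ∀ {p} → Pred Carrier p → Setoid _ _
    restrict P = On.setoid S (proj₁ {B = P})

    enumerated : ∀ {n} (from : Fin n → Carrier) →
                 (∀ {i j} → from i ≈ from j → i ≡ j) →
                 (∀ x → ∃[ i ] from i ≈ x) → HasSize S n
    enumerated from inj surj = record
      { to        = proj₁ ∘ surj
      ; from      = from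
      ; to-cong   = λ {x} {y} x≈y → inj
          (≈-trans (proj₂ (surj x)) (≈-trans x≈y (≈-sym (proj₂ (surj y)))))
      ; from-cong = λ { refl → ≈-refl }
      ; inverse   = (λ {i} {x} x≈fi → inj (≈-trans (proj₂ (surj x)) x≈fi))
                  , (λ { {x} {i} refl → proj₂ (surj x) })
      }

  module _ {a ℓ} {S : Setoid a ℓ} {n} (e : HasSize S n) where
    open Setoid S renaming (refl to ≈-refl; sym to ≈-sym; trans to ≈-trans)
    open Inverse e

    Resp : (Carrier → ℕ) → Set _
    Resp f = ∀ {x y} → x ≈ y → f x ≡ f y

    from-injective : ∀ {i j} → from i ≈ from j → i ≡ j
    from-injective {i} {j} fi≈fj =
      trans (sym (strictlyInverseˡ i)) (trans (to-cong fi≈fj) (strictlyInverseˡ j))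

    to-injective : ∀ {x y} → to x ≡ to y → x ≈ y
    to-injective {x} {y} eq =
      ≈-trans (≈-sym (strictlyInverseʳ x)) (≈-trans (from-cong eq) (strictlyInverseʳ y))

    opaque
      dec : ∀ x y → Dec (x ≈ y)
      dec x y = map′ to-injective to-cong (to x Fin.≟ to y)

    search : ∀ {p} {P : Pred Carrier p} → (∀ {x y} → x ≈ y → P x → P y) →
             (∀ x → Dec (P x)) → Dec (∃[ x ] P x)
    search P-resp P? = map′
      (λ (i , p) → from i , p)
      (λ (x , p) → to x , P-resp (≈-sym (strictlyInverseʳ x)) p)
      (Fin.any? (P? ∘ from))

    opaque
      over : (Carrier → ℕ) → ℕ
      over f = ∑[ i < n ] f (from i)

      over-∑ : ∀ f → over f ≡ ∑[ i < n ] f (from i)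
      over-∑ f = refl

      over-cong : ∀ {f g} → (∀ x → f x ≡ g x) → over f ≡ over g
      over-cong f≗g = ∑-cong (f≗g ∘ from)

      over-zero : ∀ {f} → (∀ x → f x ≡ 0) → over f ≡ 0
      over-zero f≡0 = ∑-zero (f≡0 ∘ from)

      over-const : ∀ c → over (λ _ → c) ≡ n * c
      over-const = ∑-const n

      over-+ : ∀ f g → over (λ x → f x + g x) ≡ over f + over g
      over-+ f g = ∑-+ (f ∘ from) (g ∘ from)

      *-overˡ : ∀ c f → c * over f ≡ over (λ x → c * f x)
      *-overˡ c f = *-∑ˡ c (f ∘ from)

      *-overʳ : ∀ c f → over f * c ≡ over (λ x → f x * c)
      *-overʳ c f = *-∑ʳ c (f ∘ from)

      over-mono-≤ : ∀ {f g} → (∀ x → f x ≤ g x) → over f ≤ over g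
      over-mono-≤ f≤g = ∑-mono-≤ (f≤g ∘ from)

      over-≤-≡⇒≡ : ∀ {f g} → Resp f → Resp g → (∀ x → f x ≤ g x) → over f ≡ over g →
                   ∀ x → f x ≡ g x
      over-≤-≡⇒≡ f-resp g-resp f≤g eq x = trans (f-resp (≈-sym (strictlyInverseʳ x)))
        (trans (∑-≤-≡⇒≡ (f≤g ∘ from) eq (to x)) (g-resp (strictlyInverseʳ x)))

      over-single : ∀ {f} → Resp f → ∀ x → (∀ y → ¬ (y ≈ x) → f y ≡ 0) → over f ≡ f x
      over-single f-resp x h = trans
        (∑-single (to x) λ j j≢ → h (from j) λ fj≈x →
          j≢ (trans (sym (strictlyInverseˡ j)) (to-cong fj≈x)))
        (f-resp (strictlyInverseʳ x))

      over-∑-comm : ∀ {k} (f : Fin k → Carrier → ℕ) →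
                    over (λ x → ∑[ i < k ] f i x) ≡ ∑[ i < k ] over (f i)
      over-∑-comm f = ∑-comm (λ i j → f j (from i))

    over-δ : ∀ {f} → Resp f → ∀ x → over (λ y → 𝟙 (dec x y) * f y) ≡ f x
    over-δ {f} f-resp x = trans
      (over-single
        (λ {y} {z} y≈z → cong₂ _*_
          (𝟙-cong (dec x y) (dec x z) (λ p → ≈-trans p y≈z) (λ p → ≈-trans p (≈-sym y≈z)))
          (f-resp y≈z))
        x λ y y≉x → cong (_* f y) (𝟙-no (dec x y) (y≉x ∘ ≈-sym)))
      (trans (cong (_* f x) (𝟙-yes (dec x x) ≈-refl)) (*-identityˡ (f x)))

  opaque
    unfolding over

    over-comm : ∀ {a ℓ b ℓ′} {S : Setoid a ℓ} {T : Setoid b ℓ′} {m n}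
                (e : HasSize S m) (e′ : HasSize T n)
                (f : Setoid.Carrier S → Setoid.Carrier T → ℕ) →
                over e (λ x → over e′ (f x)) ≡ over e′ (λ y → over e (λ x → f x y))
    over-comm {m = m} {n} e e′ f = ∑-comm {m} {n} (λ i j → f (Inverse.from e i) (Inverse.from e′ j))

    over-inverse : ∀ {a ℓ b ℓ′} {S : Setoid a ℓ} {T : Setoid b ℓ′} {m n}
                   (e : HasSize S m) (e′ : HasSize T n) (σ : Inverse S T) →
                   ∀ {f} → Resp e′ f → over e′ f ≡ over e (f ∘ Inverse.to σ)
    over-inverse {S = S} {T} {m} {n} e e′ σ {f} f-resp = trans
      (∑-permute (f ∘ Inverse.from e′) π)
      (∑-cong {m} λ i → f-resp (Inverse.strictlyInverseʳ e′ (Inverse.to σ (Inverse.from e i))))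
      where
      π : Perm.Permutation m n
      π = Comp.inverse (Symm.inverse e) (Comp.inverse σ e′)

  restrict-dec : ∀ {a ℓ p} {S : Setoid a ℓ} {n k} → HasSize S n →
                 {P : Pred (Setoid.Carrier S) p} → HasSize (restrict S P) k →
                 (∀ {x y} → Setoid._≈_ S x y → P x → P y) → ∀ x → Dec (P x)
  restrict-dec {S = S} e e′ P-resp x = map′ (λ ((y , p) , y≈x) → P-resp y≈x p) (λ p → (x , p) , ≈-refl)
    (search e′ {P = λ y → proj₁ y ≈ x} (λ p q → ≈-trans (≈-sym p) q) (λ y → dec e (proj₁ y) x))
    where open Setoid S renaming (refl to ≈-refl; sym to ≈-sym; trans to ≈-trans)

  module _ {a ℓ p} {S : Setoid a ℓ} {n} (e : HasSize S n)
           {P : Pred (Setoid.Carrier S) p} (P? : ∀ x → Dec (P x))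
           (P-resp : ∀ {x y} → Setoid._≈_ S x y → P x → P y) where
    open Setoid S renaming (refl to ≈-refl; sym to ≈-sym; trans to ≈-trans)

    over-restrict : ∀ {k} (e′ : HasSize (restrict S P) k) {f} → Resp e f →
                    over e (λ x → 𝟙 (P? x) * f x) ≡ over e′ (f ∘ proj₁)
    over-restrict {k} e′ {f} f-resp = begin
      over e (λ x → 𝟙 (P? x) * f x)
        ≡⟨ over-cong e (λ x → cong (_* f x) (indicator x)) ⟩
      over e (λ x → over e′ (λ y → 𝟙 (dec e x (proj₁ y))) * f x)
        ≡⟨ over-cong e (λ x → *-overʳ e′ (f x) _) ⟩
      over e (λ x → over e′ (λ y → 𝟙 (dec e x (proj₁ y)) * f x))
        ≡⟨ over-comm e e′ _ ⟩
      over e′ (λ y → over e (λ x → 𝟙 (dec e x (proj₁ y)) * f x))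
        ≡⟨ over-cong e′ (λ y → trans
             (over-cong e λ x → cong (_* f x)
               (𝟙-cong (dec e x (proj₁ y)) (dec e (proj₁ y) x) ≈-sym ≈-sym))
             (over-δ e f-resp (proj₁ y))) ⟩
      over e′ (f ∘ proj₁) ∎
      where
      open ≡-Reasoning
      indicator : ∀ x → 𝟙 (P? x) ≡ over e′ (λ y → 𝟙 (dec e x (proj₁ y)))
      indicator x with P? x
      ... | yes p = sym (trans
        (over-single e′
          (λ {y} {z} y≈z → 𝟙-cong (dec e x (proj₁ y)) (dec e x (proj₁ z))
            (λ q → ≈-trans q y≈z) (λ q → ≈-trans q (≈-sym y≈z)))
          (x , p) λ y y≉x → 𝟙-no (dec e x (proj₁ y)) (y≉x ∘ ≈-sym))
        (𝟙-yes (dec e x x) ≈-refl))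
      ... | no ¬p = sym (over-zero e′ λ y →
        𝟙-no (dec e x (proj₁ y)) λ x≈y → ¬p (P-resp (≈-sym x≈y) (proj₂ y)))

    count-restrict : ∀ {k} → HasSize (restrict S P) k → over e (λ x → 𝟙 (P? x)) ≡ k
    count-restrict {k} e′ = begin
      over e (λ x → 𝟙 (P? x))     ≡⟨ over-cong e (λ x → sym (*-identityʳ _)) ⟩
      over e (λ x → 𝟙 (P? x) * 1) ≡⟨ over-restrict e′ {λ _ → 1} (λ _ → refl) ⟩
      over e′ (λ _ → 1)           ≡⟨ over-const e′ 1 ⟩
      k * 1                       ≡⟨ *-identityʳ k ⟩
      k                           ∎
      where open ≡-Reasoning

  private
    enumerateFin : ∀ {n p} {P : Pred (Fin n) p} → (∀ i → Dec (P i)) →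
                   ∃[ k ] HasSize (restrict (≡-setoid (Fin n)) P) k
    enumerateFin {zero} P? = 0 , enumerated _ {0} (λ ()) (λ {}) λ ()
    enumerateFin {suc n} {P = P} P? with P? zero | enumerateFin (P? ∘ suc)
    ... | yes p | k , e = suc k , enumerated _ g g-inj g-surj
      where
      g : Fin (suc k) → ∃ P
      g zero    = zero , p
      g (suc j) = suc (proj₁ (Inverse.from e j)) , proj₂ (Inverse.from e j)
      g-inj : ∀ {i j} → proj₁ (g i) ≡ proj₁ (g j) → i ≡ j
      g-inj {zero}  {zero}  _  = refl
      g-inj {suc i} {suc j} eq = cong suc (from-injective e (Fin.suc-injective eq))
      g-surj : ∀ x → ∃[ i ] proj₁ (g i) ≡ proj₁ x
      g-surj (zero  , _) = zero , refl
      g-surj (suc i , q) = suc (Inverse.to e (i , q)) , cong suc (Inverse.strictlyInverseʳ e (i , q))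
    ... | no ¬p | k , e = k , enumerated _ g g-inj g-surj
      where
      g : Fin k → ∃ P
      g j = suc (proj₁ (Inverse.from e j)) , proj₂ (Inverse.from e j)
      g-inj : ∀ {i j} → proj₁ (g i) ≡ proj₁ (g j) → i ≡ j
      g-inj eq = from-injective e (Fin.suc-injective eq)
      g-surj : ∀ x → ∃[ i ] proj₁ (g i) ≡ proj₁ x
      g-surj (zero  , q) = contradiction q ¬p
      g-surj (suc i , q) = Inverse.to e (i , q) , cong suc (Inverse.strictlyInverseʳ e (i , q))

  restrict-size : ∀ {a ℓ p} {S : Setoid a ℓ} {n} (e : HasSize S n)
                  {P : Pred (Setoid.Carrier S) p} (P? : ∀ x → Dec (P x))
                  (P-resp : ∀ {x y} → Setoid._≈_ S x y → P x → P y) →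
                  HasSize (restrict S P) (over e (𝟙 ∘ P?))
  restrict-size {S = S} {n} e {P} P? P-resp =
    subst (HasSize (restrict S P)) (sym (count-restrict e P? P-resp e″)) e″
    where
    open Setoid S renaming (refl to ≈-refl; sym to ≈-sym; trans to ≈-trans)
    open Inverse e
    e′ = proj₂ (enumerateFin (P? ∘ from))
    open Inverse e′ using () renaming (to to to′; from to from′; strictlyInverseʳ to inverseʳ′)
    e″ : HasSize (restrict S P) (proj₁ (enumerateFin (P? ∘ from)))
    e″ = enumerated _ (λ j → from (proj₁ (from′ j)) , proj₂ (from′ j))
      (λ eq → from-injective e′ (from-injective e eq))
      (λ (x , p) → let p′ = P-resp (≈-sym (strictlyInverseʳ x)) p in
        to′ (to x , p′) , ≈-trans (from-cong (inverseʳ′ (to x , p′))) (strictlyInverseʳ x))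

  data Relation : Set where
    eq adj non : Relation

  infix 4 _≟ᴿ_
  _≟ᴿ_ : DecidableEquality Relation
  eq  ≟ᴿ eq  = yes refl
  eq  ≟ᴿ adj = no λ ()
  eq  ≟ᴿ non = no λ ()
  adj ≟ᴿ eq  = no λ ()
  adj ≟ᴿ adj = yes refl
  adj ≟ᴿ non = no λ ()
  non ≟ᴿ eq  = no λ ()
  non ≟ᴿ adj = no λ ()
  non ≟ᴿ non = yes refl

  Weight : Set
  Weight = Relation → ℕ

  δ : Relation → Weight
  δ i j = 𝟙 (i ≟ᴿ j)

  one closed : Weight
  one _      = 1
  closed eq  = 1
  closed adj = 1
  closed non = 0

  infixl 7 _·_
  _·_ : Weight → Weight → Weight
  (α · β) i = α i * β i

  Linear : (Weight → ℕ) → Set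
  Linear L = ∀ α → L α ≡ α eq * L (δ eq) + α adj * L (δ adj) + α non * L (δ non)

  linear-eval : ∀ i → Linear (λ α → α i)
  linear-eval eq  α = lemma (α eq) (α adj) (α non)
    where
    lemma : ∀ a b c → a ≡ a * 1 + b * 0 + c * 0
    lemma = solve-∀
  linear-eval adj α = lemma (α eq) (α adj) (α non)
    where
    lemma : ∀ a b c → b ≡ a * 0 + b * 1 + c * 0
    lemma = solve-∀
  linear-eval non α = lemma (α eq) (α adj) (α non)
    where
    lemma : ∀ a b c → c ≡ a * 0 + b * 0 + c * 1
    lemma = solve-∀

  linear-*ˡ : ∀ {L} c → Linear L → Linear (λ α → c * L α)
  linear-*ˡ {L} c lin α = trans (cong (c *_) (lin α))
    (lemma c (α eq) (α adj) (α non) (L (δ eq)) (L (δ adj)) (L (δ non)))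
    where
    lemma : ∀ c a₁ a₂ a₃ x₁ x₂ x₃ → c * (a₁ * x₁ + a₂ * x₂ + a₃ * x₃) ≡
            a₁ * (c * x₁) + a₂ * (c * x₂) + a₃ * (c * x₃)
    lemma = solve-∀

  linear-*ʳ : ∀ {L} c → Linear L → Linear (λ α → L α * c)
  linear-*ʳ {L} c lin α = trans (cong (_* c) (lin α))
    (lemma c (α eq) (α adj) (α non) (L (δ eq)) (L (δ adj)) (L (δ non)))
    where
    lemma : ∀ c a₁ a₂ a₃ x₁ x₂ x₃ → (a₁ * x₁ + a₂ * x₂ + a₃ * x₃) * c ≡
            a₁ * (x₁ * c) + a₂ * (x₂ * c) + a₃ * (x₃ * c)
    lemma = solve-∀

  linear-∑ : ∀ {n} {L : Fin n → Weight → ℕ} → (∀ z → Linear (L z)) →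
             Linear (λ α → ∑[ z < n ] L z α)
  linear-∑ {n} {L} lin α = begin
    ∑[ z < n ] L z α
      ≡⟨ ∑-cong (λ z → lin z α) ⟩
    ∑[ z < n ] (a₁ * L z (δ eq) + a₂ * L z (δ adj) + a₃ * L z (δ non))
      ≡⟨ ∑-+ (λ z → a₁ * L z (δ eq) + a₂ * L z (δ adj)) _ ⟩
    ∑[ z < n ] (a₁ * L z (δ eq) + a₂ * L z (δ adj)) + ∑[ z < n ] (a₃ * L z (δ non))
      ≡⟨ cong (_+ ∑[ z < n ] (a₃ * L z (δ non))) (∑-+ (λ z → a₁ * L z (δ eq)) _) ⟩
    ∑[ z < n ] (a₁ * L z (δ eq)) + ∑[ z < n ] (a₂ * L z (δ adj)) + ∑[ z < n ] (a₃ * L z (δ non))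
      ≡⟨ cong₂ _+_ (cong₂ _+_ (*-∑ˡ a₁ (λ z → L z (δ eq))) (*-∑ˡ a₂ (λ z → L z (δ adj))))
           (*-∑ˡ a₃ (λ z → L z (δ non))) ⟨
    a₁ * (∑[ z < n ] L z (δ eq)) + a₂ * (∑[ z < n ] L z (δ adj)) + a₃ * (∑[ z < n ] L z (δ non)) ∎
    where
    open ≡-Reasoning
    a₁ = α eq
    a₂ = α adj
    a₃ = α non

  linear-agree : ∀ {L L′} → Linear L → Linear L′ → L one ≡ L′ one →
                 L (δ eq) ≡ L′ (δ eq) → L closed ≡ L′ closed → ∀ α → L α ≡ L′ α
  linear-agree {L} {L′} lin lin′ h₁ h₂ h₃ α = begin
    L α                                                                ≡⟨ lin α ⟩
    α eq * L (δ eq) + α adj * L (δ adj) + α non * L (δ non)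
      ≡⟨ cong₂ _+_ (cong₂ (λ u w → α eq * u + α adj * w) h₂ δadj) (cong (α non *_) δnon) ⟩
    α eq * L′ (δ eq) + α adj * L′ (δ adj) + α non * L′ (δ non)         ≡⟨ lin′ α ⟨
    L′ α                                                               ∎
    where
    open ≡-Reasoning
    closed≡ : ∀ {L} → Linear L → L closed ≡ L (δ eq) + L (δ adj)
    closed≡ {L} lin = trans (lin closed) (lemma (L (δ eq)) (L (δ adj)) (L (δ non)))
      where
      lemma : ∀ a b c → 1 * a + 1 * b + 0 * c ≡ a + b
      lemma = solve-∀
    one≡ : ∀ {L} → Linear L → L one ≡ L closed + L (δ non)
    one≡ {L} lin = trans (lin one) (trans (lemma (L (δ eq)) (L (δ adj)) (L (δ non)))
      (cong (_+ L (δ non)) (sym (closed≡ lin))))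
      where
      lemma : ∀ a b c → 1 * a + 1 * b + 1 * c ≡ a + b + c
      lemma = solve-∀
    δadj : L (δ adj) ≡ L′ (δ adj)
    δadj = +-cancelˡ-≡ (L (δ eq)) _ _
      (trans (sym (closed≡ lin)) (trans h₃ (trans (closed≡ lin′) (cong (_+ L′ (δ adj)) (sym h₂)))))
    δnon : L (δ non) ≡ L′ (δ non)
    δnon = +-cancelˡ-≡ (L closed) _ _
      (trans (sym (one≡ lin)) (trans h₁ (trans (one≡ lin′) (cong (_+ L′ (δ non)) (sym h₃)))))

  module Scheme {N} (r : Fin N → Fin N → Relation)
    (r-refl : ∀ x → r x x ≡ eq) (r-eq : ∀ {x y} → r x y ≡ eq → x ≡ y)
    (r-sym : ∀ x y → r x y ≡ r y x) where

    open ≡-Reasoning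

    Invariant OffDiagonal : (Fin N → Fin N → ℕ) → Set
    Invariant   K = ∀ x y x′ y′ → r x y ≡ r x′ y′ → K x y ≡ K x′ y′
    OffDiagonal K = ∀ x y x′ y′ → x ≢ y → x′ ≢ y′ → r x y ≡ r x′ y′ → K x y ≡ K x′ y′

    fromWeight : ∀ {K} → Invariant K → ∃[ κ ] (∀ x y → K x y ≡ κ (r x y))
    fromWeight {K} inv = κ , λ x y → κ-spec x y
      where
      find : ∀ i → Dec (∃[ x ] ∃[ y ] r x y ≡ i)
      find i = Fin.any? λ x → Fin.any? λ y → r x y ≟ᴿ i
      κ : Weight
      κ i with find i
      ... | yes (x , y , _) = K x y
      ... | no _            = 0
      κ-spec : ∀ x y → K x y ≡ κ (r x y)
      κ-spec x y with find (r x y)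
      ... | yes (x′ , y′ , p) = inv x y x′ y′ (sym p)
      ... | no ¬p             = contradiction (x , y , refl) ¬p

    δ-eq : ∀ x z → δ eq (r x z) ≡ 𝟙 (x Fin.≟ z)
    δ-eq x z = 𝟙-cong (eq ≟ᴿ r x z) (x Fin.≟ z) (λ p → r-eq (sym p)) λ { refl → sym (r-refl x) }

    ∑-δ-eq : ∀ x (f : Fin N → ℕ) → ∑[ z < N ] (δ eq (r x z) * f z) ≡ f x
    ∑-δ-eq x f = trans (∑-cong λ z → cong (_* f z) (δ-eq x z)) (∑-δ x f)

    S : Weight → Weight → Fin N → Fin N → ℕ
    S α β x y = ∑[ z < N ] (α (r x z) * β (r y z))

    S-linearˡ : ∀ β x y → Linear (λ α → S α β x y)
    S-linearˡ β x y = linear-∑ λ z → linear-*ʳ (β (r y z)) (linear-eval (r x z))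

    S-swap : ∀ α β x y → S α β x y ≡ S β α y x
    S-swap α β x y = ∑-cong λ z → *-comm (α (r x z)) (β (r y z))

    T : Weight → Weight → Weight → Weight → Weight → Fin N → Fin N → ℕ
    T α β γ ζ ε x y = ∑[ z < N ] (α (r x z) * β (r y z) *
                        ∑[ w < N ] (γ (r x w) * ζ (r y w) * ε (r z w)))

    module Regular (κ₁ κ₂ : ℕ)
      (degree : ∀ x → ∑[ z < N ] closed (r x z) ≡ κ₁)
      (common : ∀ x y → x ≢ y → S closed closed x y ≡ κ₂) where

      private
        S-closed : Invariant (S closed closed)
        S-closed x y x′ y′ p with x Fin.≟ y | x′ Fin.≟ y′
        ... | yes refl | yes refl = trans (diag x) (sym (diag x′))
          where
          idem : ∀ i → closed i * closed i ≡ closed i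
          idem eq  = refl
          idem adj = refl
          idem non = refl
          diag : ∀ x → S closed closed x x ≡ κ₁
          diag x = trans (∑-cong λ z → idem (r x z)) (degree x)
        ... | yes refl | no x′≢y′ = contradiction (r-eq (trans (sym p) (r-refl x))) x′≢y′
        ... | no x≢y   | yes refl = contradiction (r-eq (trans p (r-refl x′))) x≢y
        ... | no x≢y   | no x′≢y′ = trans (common x y x≢y) (sym (common x′ y′ x′≢y′))

        S-one : ∀ β → (∀ y y′ → ∑[ z < N ] β (r y z) ≡ ∑[ z < N ] β (r y′ z)) →
                Invariant (S one β)
        S-one β h x y x′ y′ _ = begin
          ∑[ z < N ] (1 * β (r y z))  ≡⟨ ∑-cong (λ z → *-identityˡ (β (r y z))) ⟩
          ∑[ z < N ] β (r y z)        ≡⟨ h y y′ ⟩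
          ∑[ z < N ] β (r y′ z)       ≡⟨ ∑-cong (λ z → *-identityˡ (β (r y′ z))) ⟨
          ∑[ z < N ] (1 * β (r y′ z)) ∎

        S-δ : ∀ β → Invariant (S (δ eq) β)
        S-δ β x y x′ y′ p = trans (∑-δ-eq x λ z → β (r y z)) (trans (cong β ryx) (sym (∑-δ-eq x′ λ z → β (r y′ z))))
          where
          ryx : r y x ≡ r y′ x′
          ryx = trans (r-sym y x) (trans p (r-sym x′ y′))

        flip-invariant : ∀ {K K′} → (∀ x y → K x y ≡ K′ y x) → Invariant K′ → Invariant K
        flip-invariant h inv x y x′ y′ p = trans (h x y)
          (trans (inv y x y′ x′ (trans (r-sym y x) (trans p (r-sym x′ y′)))) (sym (h x′ y′)))

        S-stepˡ : ∀ β → Invariant (S one β) → Invariant (S closed β) → ∀ α → Invariant (S α β)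
        S-stepˡ β h₁ h₂ α x y x′ y′ p = linear-agree (S-linearˡ β x y) (S-linearˡ β x′ y′)
          (h₁ x y x′ y′ p) (S-δ β x y x′ y′ p) (h₂ x y x′ y′ p) α

        S-one-inv : ∀ β → Invariant (S one β)
        S-one-inv β = flip-invariant (S-swap one β)
          (S-stepˡ one (S-one one λ _ _ → refl)
                   (flip-invariant (S-swap closed one)
                     (S-one closed λ y y′ → trans (degree y) (sym (degree y′)))) β)

      S-invariant : ∀ α β → Invariant (S α β)
      S-invariant α β = S-stepˡ β (S-one-inv β)
        (flip-invariant (S-swap closed β)
          (S-stepˡ closed (S-one-inv closed) S-closed β)) α

      private
        S-weight : ∀ α β → ∃[ κ ] (∀ x y → S α β x y ≡ κ (r x y))
        S-weight α β = fromWeight (S-invariant α β)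

        inner : Weight → Weight → Weight → Fin N → Fin N → Fin N → ℕ
        inner γ ζ ε x y z = ∑[ w < N ] (γ (r x w) * ζ (r y w) * ε (r z w))

        T-linear-α : ∀ β γ ζ ε x y → Linear (λ α → T α β γ ζ ε x y)
        T-linear-α β γ ζ ε x y = linear-∑ λ z →
          linear-*ʳ (inner γ ζ ε x y z) (linear-*ʳ (β (r y z)) (linear-eval (r x z)))

        T-linear-ε : ∀ α β γ ζ x y → Linear (λ ε → T α β γ ζ ε x y)
        T-linear-ε α β γ ζ x y = linear-∑ λ z → linear-*ˡ (α (r x z) * β (r y z))
          (linear-∑ λ w → linear-*ˡ (γ (r x w) * ζ (r y w)) (linear-eval (r z w)))

        T-δ : ∀ β γ ζ ε x y → T (δ eq) β γ ζ ε x y ≡ β (r y x) * S (γ · ε) ζ x y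
        T-δ β γ ζ ε x y = begin
          ∑[ z < N ] (δ eq (r x z) * β (r y z) * inner γ ζ ε x y z)
            ≡⟨ ∑-cong (λ z → *-assoc (δ eq (r x z)) (β (r y z)) _) ⟩
          ∑[ z < N ] (δ eq (r x z) * (β (r y z) * inner γ ζ ε x y z))
            ≡⟨ ∑-δ-eq x (λ z → β (r y z) * inner γ ζ ε x y z) ⟩
          β (r y x) * inner γ ζ ε x y x
            ≡⟨ cong (β (r y x) *_) (∑-cong λ w → lemma (γ (r x w)) (ζ (r y w)) (ε (r x w))) ⟩
          β (r y x) * S (γ · ε) ζ x y ∎
          where
          lemma : ∀ a b c → a * b * c ≡ a * c * b
          lemma = solve-∀

        T-one : ∀ β γ ζ ε x y → let κ = proj₁ (S-weight β ε) in
                T one β γ ζ ε x y ≡ S γ (ζ · κ) x y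
        T-one β γ ζ ε x y = begin
          ∑[ z < N ] (1 * β (r y z) * inner γ ζ ε x y z)
            ≡⟨ ∑-cong (λ z → *-∑ˡ (1 * β (r y z)) _) ⟩
          ∑[ z < N ] ∑[ w < N ] (1 * β (r y z) * (γ (r x w) * ζ (r y w) * ε (r z w)))
            ≡⟨ ∑-comm (λ z w → 1 * β (r y z) * (γ (r x w) * ζ (r y w) * ε (r z w))) ⟩
          ∑[ w < N ] ∑[ z < N ] (1 * β (r y z) * (γ (r x w) * ζ (r y w) * ε (r z w)))
            ≡⟨ ∑-cong (λ w → ∑-cong λ z → trans
                 (cong (λ i → 1 * β (r y z) * (γ (r x w) * ζ (r y w) * ε i)) (r-sym z w))
                 (lemma (β (r y z)) (γ (r x w)) (ζ (r y w)) (ε (r w z)))) ⟩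
          ∑[ w < N ] ∑[ z < N ] (γ (r x w) * ζ (r y w) * (β (r y z) * ε (r w z)))
            ≡⟨ ∑-cong (λ w → *-∑ˡ (γ (r x w) * ζ (r y w)) (λ z → β (r y z) * ε (r w z))) ⟨
          ∑[ w < N ] (γ (r x w) * ζ (r y w) * S β ε y w)
            ≡⟨ ∑-cong (λ w → trans
                 (cong (γ (r x w) * ζ (r y w) *_) (proj₂ (S-weight β ε) y w))
                 (*-assoc (γ (r x w)) (ζ (r y w)) _)) ⟩
          S γ (ζ · proj₁ (S-weight β ε)) x y ∎
          where
          lemma : ∀ a b c d → 1 * a * (b * c * d) ≡ b * c * (a * d)
          lemma = solve-∀

        T-ε-δ : ∀ α β γ ζ x y → T α β γ ζ (δ eq) x y ≡ S (α · γ) (β · ζ) x y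
        T-ε-δ α β γ ζ x y = ∑-cong λ z → trans
          (cong (α (r x z) * β (r y z) *_) (trans
            (∑-cong λ w → *-comm (γ (r x w) * ζ (r y w)) (δ eq (r z w)))
            (∑-δ-eq z λ w → γ (r x w) * ζ (r y w))))
          (lemma (α (r x z)) (β (r y z)) (γ (r x z)) (ζ (r y z)))
          where
          lemma : ∀ a b c d → a * b * (c * d) ≡ a * c * (b * d)
          lemma = solve-∀

        T-ε-one : ∀ α β γ ζ x y → T α β γ ζ one x y ≡ S α β x y * S γ ζ x y
        T-ε-one α β γ ζ x y = trans
          (∑-cong λ z → cong (α (r x z) * β (r y z) *_)
            (∑-cong λ w → *-identityʳ (γ (r x w) * ζ (r y w))))
          (sym (*-∑ʳ (S γ ζ x y) (λ z → α (r x z) * β (r y z))))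

        T-swap-zw : ∀ α β γ ζ ε x y → T α β γ ζ ε x y ≡ T γ ζ α β ε x y
        T-swap-zw α β γ ζ ε x y = begin
          ∑[ z < N ] (α (r x z) * β (r y z) * inner γ ζ ε x y z)
            ≡⟨ ∑-cong (λ z → *-∑ˡ (α (r x z) * β (r y z)) _) ⟩
          ∑[ z < N ] ∑[ w < N ] (α (r x z) * β (r y z) * (γ (r x w) * ζ (r y w) * ε (r z w)))
            ≡⟨ ∑-comm (λ z w → α (r x z) * β (r y z) * (γ (r x w) * ζ (r y w) * ε (r z w))) ⟩
          ∑[ w < N ] ∑[ z < N ] (α (r x z) * β (r y z) * (γ (r x w) * ζ (r y w) * ε (r z w)))
            ≡⟨ ∑-cong (λ w → ∑-cong λ z → trans
                 (cong (λ i → α (r x z) * β (r y z) * (γ (r x w) * ζ (r y w) * ε i)) (r-sym z w))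
                 (lemma (α (r x z) * β (r y z)) (γ (r x w) * ζ (r y w)) (ε (r w z)))) ⟩
          ∑[ w < N ] ∑[ z < N ] (γ (r x w) * ζ (r y w) * (α (r x z) * β (r y z) * ε (r w z)))
            ≡⟨ ∑-cong (λ w → *-∑ˡ (γ (r x w) * ζ (r y w)) _) ⟨
          ∑[ w < N ] (γ (r x w) * ζ (r y w) * inner α β ε x y w) ∎
          where
          lemma : ∀ a b c → a * (b * c) ≡ b * (a * c)
          lemma = solve-∀

        T-swap-xy : ∀ α β γ ζ ε x y → T α β γ ζ ε x y ≡ T β α ζ γ ε y x
        T-swap-xy α β γ ζ ε x y = ∑-cong λ z →
          cong₂ _*_ (*-comm (α (r x z)) (β (r y z)))
            (∑-cong λ w → cong (_* ε (r z w)) (*-comm (γ (r x w)) (ζ (r y w))))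

        step-α : ∀ {β γ ζ ε} → OffDiagonal (T closed β γ ζ ε) → ∀ α → OffDiagonal (T α β γ ζ ε)
        step-α {β} {γ} {ζ} {ε} h α x y x′ y′ n n′ p =
          linear-agree (T-linear-α β γ ζ ε x y) (T-linear-α β γ ζ ε x′ y′)
            (trans (T-one β γ ζ ε x y)
              (trans (S-invariant γ (ζ · proj₁ (S-weight β ε)) x y x′ y′ p) (sym (T-one β γ ζ ε x′ y′))))
            (trans (T-δ β γ ζ ε x y)
              (trans (cong₂ _*_ (cong β (trans (r-sym y x) (trans p (r-sym x′ y′))))
                                (S-invariant (γ · ε) ζ x y x′ y′ p))
                     (sym (T-δ β γ ζ ε x′ y′))))
            (h x y x′ y′ n n′ p) α

        swap-zw : ∀ {α β γ ζ ε} → OffDiagonal (T α β γ ζ ε) → OffDiagonal (T γ ζ α β ε)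
        swap-zw {α} {β} {γ} {ζ} {ε} h x y x′ y′ n n′ p =
          trans (T-swap-zw γ ζ α β ε x y)
            (trans (h x y x′ y′ n n′ p) (sym (T-swap-zw γ ζ α β ε x′ y′)))

        swap-xy : ∀ {α β γ ζ ε} → OffDiagonal (T α β γ ζ ε) → OffDiagonal (T β α ζ γ ε)
        swap-xy {α} {β} {γ} {ζ} {ε} h x y x′ y′ n n′ p =
          trans (T-swap-xy β α ζ γ ε x y)
            (trans (h y x y′ x′ (n ∘ sym) (n′ ∘ sym) (trans (r-sym y x) (trans p (r-sym x′ y′))))
              (sym (T-swap-xy β α ζ γ ε x′ y′)))

        step-ε : ∀ {α β γ ζ} → OffDiagonal (T α β γ ζ closed) → ∀ ε → OffDiagonal (T α β γ ζ ε)
        step-ε {α} {β} {γ} {ζ} h ε x y x′ y′ n n′ p =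
          linear-agree (T-linear-ε α β γ ζ x y) (T-linear-ε α β γ ζ x′ y′)
            (trans (T-ε-one α β γ ζ x y)
              (trans (cong₂ _*_ (S-invariant α β x y x′ y′ p) (S-invariant γ ζ x y x′ y′ p))
                (sym (T-ε-one α β γ ζ x′ y′))))
            (trans (T-ε-δ α β γ ζ x y)
              (trans (S-invariant (α · γ) (β · ζ) x y x′ y′ p) (sym (T-ε-δ α β γ ζ x′ y′))))
            (h x y x′ y′ n n′ p) ε

      T-invariant : OffDiagonal (T closed closed closed closed closed) →
                    ∀ α β γ ζ ε → OffDiagonal (T α β γ ζ ε)
      T-invariant h α β γ ζ ε =
        step-ε {α} {β} {γ} {ζ}
          (swap-zw {γ} {ζ} {α} {β} {closed}
            (swap-xy {ζ} {γ} {β} {α} {closed} (step-α {γ} {β} {α} {closed}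
              (swap-xy {γ} {closed} {α} {β} {closed} (step-α {closed} {α} {β} {closed}
                (swap-zw {α} {β} {closed} {closed} {closed}
                  (swap-xy {β} {α} {closed} {closed} {closed} (step-α {α} {closed} {closed} {closed}
                    (swap-xy {α} {closed} {closed} {closed} {closed}
                      (step-α {closed} {closed} {closed} {closed} h α)) β))) γ)) ζ))) ε

  pairs : ∀ n → HasSize (≡-setoid (Fin n × Fin n)) (n * n)
  pairs n = enumerated _ (remQuot n)
    (λ {i} {j} p → trans (sym (Fin.combine-remQuot {n} n i))
      (trans (cong (uncurry combine) p) (Fin.combine-remQuot {n} n j)))
    (λ (i , j) → combine i j , Fin.remQuot-combine i j)

  over-pairs : ∀ n (f : Fin n × Fin n → ℕ) → over (pairs n) f ≡ ∑[ i < n ] ∑[ j < n ] f (i , j)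
  over-pairs n f = trans (over-∑ (pairs n) f) (trans (∑-combine n _)
    (∑-cong λ i → ∑-cong λ j → cong f (Fin.remQuot-combine i j)))

  relation : ∀ {p q} {P : Set p} {Q : Set q} → Dec P → Dec Q → Relation
  relation (yes _) _       = eq
  relation (no _)  (yes _) = adj
  relation (no _)  (no _)  = non

  module GraphRelation {n e} (G : Graph (≡-setoid (Fin n)) e)
                       (_~?_ : Decidable (Graph._~_ G)) where
    open Graph G

    rel : Fin n → Fin n → Relation
    rel i j = relation (i Fin.≟ j) (i ~? j)

    rel-refl : ∀ i → rel i i ≡ eq
    rel-refl i with i Fin.≟ i
    ... | yes _  = refl
    ... | no i≢i = contradiction refl i≢i

    rel-eq : ∀ {i j} → rel i j ≡ eq → i ≡ j
    rel-eq {i} {j} p with i Fin.≟ j | i ~? j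
    rel-eq p  | yes i≡j | _     = i≡j
    rel-eq () | no _    | yes _
    rel-eq () | no _    | no _

    rel-adj : ∀ {i j} → rel i j ≡ adj → i ~ j
    rel-adj {i} {j} p with i Fin.≟ j | i ~? j
    rel-adj () | yes _ | _
    rel-adj p  | no _  | yes i~j = i~j
    rel-adj () | no _  | no _

    adj-rel : ∀ {i j} → i ~ j → rel i j ≡ adj
    adj-rel {i} {j} i~j with i Fin.≟ j | i ~? j
    ... | yes i≡j | _      = contradiction i~j (~-irrefl i≡j)
    ... | no _    | yes _  = refl
    ... | no _    | no i≁j = contradiction i~j i≁j

    non-rel : ∀ {i j} → i ≢ j → ¬ i ~ j → rel i j ≡ non
    non-rel {i} {j} i≢j i≁j with i Fin.≟ j | i ~? j
    ... | yes i≡j | _       = contradiction i≡j i≢j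
    ... | no _    | yes i~j = contradiction i~j i≁j
    ... | no _    | no _    = refl

    rel-sym : ∀ i j → rel i j ≡ rel j i
    rel-sym i j with i Fin.≟ j | i ~? j
    ... | yes refl | _       = sym (rel-refl i)
    ... | no _     | yes i~j = sym (adj-rel (~-sym i~j))
    ... | no i≢j   | no i≁j  = sym (non-rel (i≢j ∘ sym) (i≁j ∘ ~-sym))

  transpose-swaps : ∀ {n} (i j : Fin n) → Perm.transpose i j Perm.⟨$⟩ʳ i ≡ j
  transpose-swaps i j rewrite dec-true (i Fin.≟ i) refl = refl

  transpose-fixes : ∀ {n} {i j k : Fin n} → k ≢ i → k ≢ j → Perm.transpose i j Perm.⟨$⟩ʳ k ≡ k
  transpose-fixes {i = i} {j} {k} k≢i k≢j
    rewrite dec-false (k Fin.≟ i) k≢i | dec-false (k Fin.≟ j) k≢j = refl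

  opaque
    twoPointed : ∀ {n} (x₀ y₀ : Fin (suc (suc n))) → x₀ ≢ y₀ →
                 Σ (Perm.Permutation (suc (suc n)) (suc (suc n))) λ σ →
                   (σ Perm.⟨$⟩ʳ 0F ≡ x₀) × (σ Perm.⟨$⟩ʳ 1F ≡ y₀)
    twoPointed {n} x₀ y₀ x₀≢y₀ = Perm._∘ₚ_ (Perm.transpose 1F y₁) ρ
      , trans (cong (ρ Perm.⟨$⟩ʳ_) (transpose-fixes {i = 1F} {y₁} {0F} (λ ()) (y₁≢0 ∘ sym))) (transpose-swaps 0F x₀)
      , trans (cong (ρ Perm.⟨$⟩ʳ_) (transpose-swaps 1F y₁)) (Perm.inverseʳ ρ)
      where
      ρ : Perm.Permutation (suc (suc n)) (suc (suc n))
      ρ = Perm.transpose 0F x₀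
      y₁ : Fin (suc (suc n))
      y₁ = ρ Perm.⟨$⟩ˡ y₀
      y₁≢0 : y₁ ≢ 0F
      y₁≢0 p = x₀≢y₀ (trans (sym (transpose-swaps 0F x₀))
        (trans (cong (ρ Perm.⟨$⟩ʳ_) (sym p)) (Perm.inverseʳ ρ)))

  module FourVertices {v ℓ e} {V : Setoid v ℓ} (Γ : Graph V e) {N} (size : HasSize V N)
    (adjacent? : ∀ i j → Dec (Graph._~_ Γ (Inverse.from size i) (Inverse.from size j))) where

    open Setoid V using (_≈_; _≉_; Carrier)
      renaming (refl to ≈-refl; sym to ≈-sym; trans to ≈-trans)
    open Graph Γ
    open Inverse size

    indexGraph : Graph (≡-setoid (Fin N)) e
    indexGraph = record
      { _~_      = λ i j → from i ~ from j
      ; ~-resp-≈ = (λ { refl h → h }) , (λ { refl h → h })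
      ; ~-sym    = ~-sym
      ; ~-irrefl = λ { refl → ~-irrefl ≈-refl }
      }

    open GraphRelation indexGraph adjacent? public
      renaming (rel to r; rel-refl to r-refl; rel-eq to r-eq; rel-sym to r-sym)

    open Scheme r r-refl r-eq r-sym public

    ~-from-to : ∀ {x y} → x ~ y → from (to x) ~ from (to y)
    ~-from-to {x} {y} x~y = proj₂ ~-resp-≈ (≈-sym (strictlyInverseʳ x))
      (proj₁ ~-resp-≈ (≈-sym (strictlyInverseʳ y)) x~y)

    ~-to-from : ∀ {x y} → from (to x) ~ from (to y) → x ~ y
    ~-to-from {x} {y} h = proj₂ ~-resp-≈ (strictlyInverseʳ x)
      (proj₁ ~-resp-≈ (strictlyInverseʳ y) h)

    module Count (T-inv : ∀ α β γ ζ ε → OffDiagonal (T α β γ ζ ε))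
      (G : Graph (≡-setoid (Fin 4)) 0ℓ) (G? : Decidable (Graph._~_ G))
      (x₀ y₀ : Fin 4) (x₀≢y₀ : x₀ ≢ y₀) where

      open GraphRelation G G? using () renaming (rel to t; rel-refl to t-refl; rel-eq to t-eq;
        rel-adj to t-adj; adj-rel to adj-t; non-rel to non-t; rel-sym to t-sym)

      private
        π = twoPointed x₀ y₀ x₀≢y₀
        σ τ : Fin 4 → Fin 4
        σ a = proj₁ π Perm.⟨$⟩ʳ a
        τ i = proj₁ π Perm.⟨$⟩ˡ i
        στ : ∀ i → σ (τ i) ≡ i
        στ i = Perm.inverseʳ (proj₁ π)
        τσ : ∀ a → τ (σ a) ≡ a
        τσ a = Perm.inverseˡ (proj₁ π)
        σ-injective : ∀ {a b} → σ a ≡ σ b → a ≡ b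
        σ-injective {a} {b} p = trans (sym (τσ a)) (trans (cong τ p) (τσ b))

        s : Fin 4 → Fin 4 → Relation
        s a b = t (σ a) (σ b)

        s-≢ : ∀ {a b} → a ≢ b → s a b ≢ eq
        s-≢ a≢b p = a≢b (σ-injective (t-eq p))

        Ok : Fin N → Fin N → Fin N → Fin N → Set
        Ok x y z w = s 0F 1F ≡ r x y × (s 0F 2F ≡ r x z × s 1F 2F ≡ r y z) ×
                     (s 0F 3F ≡ r x w × s 1F 3F ≡ r y w) × s 2F 3F ≡ r z w

        Ok? : ∀ x y z w → Dec (Ok x y z w)
        Ok? x y z w = (s 0F 1F ≟ᴿ r x y) ×-dec ((s 0F 2F ≟ᴿ r x z) ×-dec (s 1F 2F ≟ᴿ r y z)) ×-dec
                      ((s 0F 3F ≟ᴿ r x w) ×-dec (s 1F 3F ≟ᴿ r y w)) ×-dec (s 2F 3F ≟ᴿ r z w)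

        Ok-distinct : ∀ {x y z w} → Ok x y z w → z ≢ w
        Ok-distinct {z = z} (_ , _ , _ , p) refl = s-≢ (λ ()) (trans p (r-refl z))

        -- If (z, w) and (w, z) both describe embeddings, these have the same
        -- image, and the increasing pair represents it.
        Good : Fin N → Fin N → Fin N × Fin N → Set
        Good x y (z , w) = Ok x y z w × (Ok x y w z → z Fin.< w)

        Good? : ∀ x y zw → Dec (Good x y zw)
        Good? x y (z , w) = Ok? x y z w ×-dec (Ok? x y w z →-dec (z Fin.<? w))

        #ok #ok² count : Fin N → Fin N → ℕ
        #ok x y    = ∑[ z < N ] ∑[ w < N ] 𝟙 (Ok? x y z w)
        #ok² x y   = ∑[ z < N ] ∑[ w < N ] (𝟙 (Ok? x y z w) * 𝟙 (Ok? x y w z))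
        count x y = ∑[ z < N ] ∑[ w < N ] 𝟙 (Good? x y (z , w))

        𝟙-Ok : ∀ x y z w → 𝟙 (Ok? x y z w) ≡ δ (s 0F 1F) (r x y) *
          ((δ (s 0F 2F) (r x z) * δ (s 1F 2F) (r y z)) *
           ((δ (s 0F 3F) (r x w) * δ (s 1F 3F) (r y w)) * δ (s 2F 3F) (r z w)))
        𝟙-Ok x y z w = trans (𝟙-× (s 0F 1F ≟ᴿ r x y) _) (cong (δ (s 0F 1F) (r x y) *_) (trans
          (𝟙-× ((s 0F 2F ≟ᴿ r x z) ×-dec (s 1F 2F ≟ᴿ r y z)) _)
          (cong₂ _*_ (𝟙-× (s 0F 2F ≟ᴿ r x z) (s 1F 2F ≟ᴿ r y z))
            (trans (𝟙-× ((s 0F 3F ≟ᴿ r x w) ×-dec (s 1F 3F ≟ᴿ r y w)) _)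
              (cong (_* δ (s 2F 3F) (r z w)) (𝟙-× (s 0F 3F ≟ᴿ r x w) (s 1F 3F ≟ᴿ r y w)))))))

        factor-T : ∀ α β γ ζ ε (K : Fin N → Fin N → Fin N → Fin N → ℕ) →
          (∀ x y z w → K x y z w ≡ δ (s 0F 1F) (r x y) *
            ((α (r x z) * β (r y z)) * ((γ (r x w) * ζ (r y w)) * ε (r z w)))) →
          OffDiagonal (λ x y → ∑[ z < N ] ∑[ w < N ] K x y z w)
        factor-T α β γ ζ ε K h x y x′ y′ n n′ p = trans (factor x y)
          (trans (cong₂ _*_ (cong (δ (s 0F 1F)) p) (T-inv α β γ ζ ε x y x′ y′ n n′ p))
            (sym (factor x′ y′)))
          where
          factor : ∀ x y → ∑[ z < N ] ∑[ w < N ] K x y z w ≡ δ (s 0F 1F) (r x y) * T α β γ ζ ε x y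
          factor x y = trans
            (∑-cong λ z → trans
              (∑-cong λ w → trans (h x y z w) (sym (*-assoc i (a z) (b z w))))
              (trans (sym (*-∑ˡ (i * a z) (b z))) (*-assoc i (a z) _)))
            (sym (*-∑ˡ i (λ z → a z * ∑[ w < N ] b z w)))
            where
            i = δ (s 0F 1F) (r x y)
            a = λ z → α (r x z) * β (r y z)
            b = λ z w → γ (r x w) * ζ (r y w) * ε (r z w)

        𝟙-Ok² : ∀ x y z w → 𝟙 (Ok? x y z w) * 𝟙 (Ok? x y w z) ≡ δ (s 0F 1F) (r x y) *
          (((δ (s 0F 2F) · δ (s 0F 3F)) (r x z) * (δ (s 1F 2F) · δ (s 1F 3F)) (r y z)) *
           (((δ (s 0F 3F) · δ (s 0F 2F)) (r x w) * (δ (s 1F 3F) · δ (s 1F 2F)) (r y w)) *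
            δ (s 2F 3F) (r z w)))
        𝟙-Ok² x y z w = trans (cong₂ _*_ (𝟙-Ok x y z w) (trans (𝟙-Ok x y w z) (cong
            (λ i → δ (s 0F 1F) (r x y) * ((δ (s 0F 2F) (r x w) * δ (s 1F 2F) (r y w)) *
              ((δ (s 0F 3F) (r x z) * δ (s 1F 3F) (r y z)) * δ (s 2F 3F) i))) (r-sym w z))))
          (trans (regroup (δ (s 0F 1F) (r x y)) (δ (s 2F 3F) (r z w))
            (δ (s 0F 2F) (r x z)) (δ (s 1F 2F) (r y z)) (δ (s 0F 3F) (r x w)) (δ (s 1F 3F) (r y w))
            (δ (s 0F 2F) (r x w)) (δ (s 1F 2F) (r y w)) (δ (s 0F 3F) (r x z)) (δ (s 1F 3F) (r y z)))
            (cong₂ (λ i j → i * (((δ (s 0F 2F) · δ (s 0F 3F)) (r x z) * (δ (s 1F 2F) · δ (s 1F 3F)) (r y z)) *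
              (((δ (s 0F 3F) · δ (s 0F 2F)) (r x w) * (δ (s 1F 3F) · δ (s 1F 2F)) (r y w)) * j)))
              (𝟙-idem (s 0F 1F ≟ᴿ r x y)) (𝟙-idem (s 2F 3F ≟ᴿ r z w))))
          where
          regroup : ∀ i j a₁ a₂ a₃ a₄ b₁ b₂ b₃ b₄ →
            i * ((a₁ * a₂) * ((a₃ * a₄) * j)) * (i * ((b₁ * b₂) * ((b₃ * b₄) * j))) ≡
            i * i * (a₁ * b₃ * (a₂ * b₄) * (a₃ * b₁ * (a₄ * b₂) * (j * j)))
          regroup = solve-∀

        count-ok : ∀ x y → (count x y + count x y) + #ok² x y ≡ #ok x y + #ok x y
        count-ok x y = begin
          (count x y + count x y) + #ok² x y
            ≡⟨ cong (λ c → (count x y + c) + #ok² x y) (∑-comm (λ z w → g z w)) ⟩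
          (∑[ z < N ] ∑[ w < N ] g z w + ∑[ z < N ] ∑[ w < N ] g w z) + #ok² x y
            ≡⟨ cong (_+ #ok² x y) (∑∑-+ g (λ z w → g w z)) ⟨
          ∑[ z < N ] ∑[ w < N ] (g z w + g w z) + #ok² x y
            ≡⟨ ∑∑-+ (λ z w → g z w + g w z) (λ z w → o z w * o w z) ⟨
          ∑[ z < N ] ∑[ w < N ] (g z w + g w z + o z w * o w z)
            ≡⟨ ∑-cong (λ z → ∑-cong λ w → pointwise z w) ⟩
          ∑[ z < N ] ∑[ w < N ] (o z w + o w z)
            ≡⟨ ∑∑-+ o (λ z w → o w z) ⟩
          #ok x y + ∑[ z < N ] ∑[ w < N ] o w z
            ≡⟨ cong (#ok x y +_) (∑-comm (λ z w → o w z)) ⟩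
          #ok x y + #ok x y ∎
          where
          open ≡-Reasoning
          g o : Fin N → Fin N → ℕ
          g z w = 𝟙 (Good? x y (z , w))
          o z w = 𝟙 (Ok? x y z w)
          ∑∑-+ : ∀ (f h : Fin N → Fin N → ℕ) → ∑[ z < N ] ∑[ w < N ] (f z w + h z w) ≡
                 ∑[ z < N ] ∑[ w < N ] f z w + ∑[ z < N ] ∑[ w < N ] h z w
          ∑∑-+ f h = trans (∑-cong λ z → ∑-+ (f z) (h z))
            (∑-+ (λ z → ∑[ w < N ] f z w) (λ z → ∑[ w < N ] h z w))
          pointwise : ∀ z w → g z w + g w z + o z w * o w z ≡ o z w + o w z
          pointwise z w with Ok? x y z w | Ok? x y w z
          ... | no _  | no _  = refl
          ... | no _  | yes _ = refl
          ... | yes _ | no _  = refl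
          ... | yes k | yes l with Fin.<-cmp z w
          ... | tri≈ _ z≡w _ = contradiction z≡w (Ok-distinct k)
          ... | tri< z<w _ w≮z = cong₂ (λ a b → a + b + 1)
            (𝟙-yes (yes k ×-dec (yes l →-dec (z Fin.<? w))) (k , λ _ → z<w))
            (𝟙-no (yes l ×-dec (yes k →-dec (w Fin.<? z))) λ (_ , h) → w≮z (h k))
          ... | tri> z≮w _ w<z = cong₂ (λ a b → a + b + 1)
            (𝟙-no (yes k ×-dec (yes l →-dec (z Fin.<? w))) λ (_ , h) → z≮w (h l))
            (𝟙-yes (yes l ×-dec (yes k →-dec (w Fin.<? z))) (l , λ _ → w<z))

        double-injective : ∀ {m n} → m + m ≡ n + n → m ≡ n
        double-injective {m} {n} p = *-cancelˡ-≡ m n 2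
          (trans (cong (m +_) (+-identityʳ m)) (trans p (cong (n +_) (sym (+-identityʳ n)))))

        count-off : OffDiagonal count
        count-off x y x′ y′ n n′ p = double-injective (+-cancelʳ-≡ (#ok² x y) _ _
          (trans (count-ok x y) (trans (cong₂ _+_ ok≡ ok≡) (trans (sym (count-ok x′ y′))
            (cong ((count x′ y′ + count x′ y′) +_) (sym ok²≡))))))
          where
          ok≡ : #ok x y ≡ #ok x′ y′
          ok≡ = factor-T (δ (s 0F 2F)) (δ (s 1F 2F)) (δ (s 0F 3F)) (δ (s 1F 3F)) (δ (s 2F 3F))
            (λ x y z w → 𝟙 (Ok? x y z w)) 𝟙-Ok x y x′ y′ n n′ p
          ok²≡ : #ok² x y ≡ #ok² x′ y′
          ok²≡ = factor-T (δ (s 0F 2F) · δ (s 0F 3F)) (δ (s 1F 2F) · δ (s 1F 3F))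
            (δ (s 0F 3F) · δ (s 0F 2F)) (δ (s 1F 3F) · δ (s 1F 2F)) (δ (s 2F 3F))
            (λ x y z w → 𝟙 (Ok? x y z w) * 𝟙 (Ok? x y w z)) 𝟙-Ok² x y x′ y′ n n′ p

        quad : Fin N → Fin N → Fin N → Fin N → Fin 4 → Fin N
        quad x y z w 0F = x
        quad x y z w 1F = y
        quad x y z w 2F = z
        quad x y z w 3F = w

        quad-rel : ∀ {x y z w} → Ok x y z w → ∀ a b →
                   s a b ≡ r (quad x y z w a) (quad x y z w b)
        quad-rel {x} {y} {z} {w} (xy , (xz , yz) , (xw , yw) , zw) = go
          where
          diag : ∀ a → s a a ≡ r (quad x y z w a) (quad x y z w a)
          diag a = trans (t-refl (σ a)) (sym (r-refl (quad x y z w a)))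
          flip : ∀ a b → s a b ≡ r (quad x y z w a) (quad x y z w b) →
                 s b a ≡ r (quad x y z w b) (quad x y z w a)
          flip a b p = trans (t-sym (σ b) (σ a)) (trans p (r-sym (quad x y z w a) (quad x y z w b)))
          go : ∀ a b → s a b ≡ r (quad x y z w a) (quad x y z w b)
          go 0F 0F = diag 0F
          go 0F 1F = xy
          go 0F 2F = xz
          go 0F 3F = xw
          go 1F 0F = flip 0F 1F xy
          go 1F 1F = diag 1F
          go 1F 2F = yz
          go 1F 3F = yw
          go 2F 0F = flip 0F 2F xz
          go 2F 1F = flip 1F 2F yz
          go 2F 2F = diag 2F
          go 2F 3F = zw
          go 3F 0F = flip 0F 3F xw
          go 3F 1F = flip 1F 3F yw
          go 3F 2F = flip 2F 3F zw
          go 3F 3F = diag 3F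

      module _ (x y : Carrier) where
        private
          x̂ ŷ : Fin N
          x̂ = to x
          ŷ = to y

          Emb : Set _
          Emb = Embedding Γ G x₀ y₀ x y

          open Embedding using (vertexSet) renaming (to to map)

          embed : ∀ {z w} → Ok x̂ ŷ z w → Emb
          embed {z} {w} ok = record
            { to        = λ i → from (g i)
            ; injective = λ {i} {j} p → t-eq (trans (g-rel i j)
                (trans (cong (r (g i)) (sym (from-injective size p))) (r-refl (g i))))
            ; induced   = λ i j → mk⇔
                (λ i~j → rel-adj (trans (sym (g-rel i j)) (adj-t i~j)))
                (λ h → t-adj (trans (g-rel i j) (adj-rel h)))
            ; x₀↦x      = ≈-trans (from-cong (trans (cong (quad x̂ ŷ z w) τx₀) refl)) (strictlyInverseʳ x)
            ; y₀↦y      = ≈-trans (from-cong (trans (cong (quad x̂ ŷ z w) τy₀) refl)) (strictlyInverseʳ y)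
            }
            where
            g : Fin 4 → Fin N
            g i = quad x̂ ŷ z w (τ i)
            g-rel : ∀ i j → t i j ≡ r (g i) (g j)
            g-rel i j = trans (cong₂ t (sym (στ i)) (sym (στ j))) (quad-rel ok (τ i) (τ j))
            τx₀ : τ x₀ ≡ 0F
            τx₀ = trans (cong τ (sym (proj₁ (proj₂ π)))) (τσ 0F)
            τy₀ : τ y₀ ≡ 1F
            τy₀ = trans (cong τ (sym (proj₂ (proj₂ π)))) (τσ 1F)

          ∈embed : ∀ {z w} (ok : Ok x̂ ŷ z w) a → vertexSet (embed ok) (from (quad x̂ ŷ z w a))
          ∈embed {z} {w} ok a = σ a , from-cong (cong (quad x̂ ŷ z w) (τσ a))

          ∈embed⇒ : ∀ {z w} (ok : Ok x̂ ŷ z w) {k} → vertexSet (embed ok) (from k) →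
                    ∃[ a ] quad x̂ ŷ z w a ≡ k
          ∈embed⇒ ok (i , p) = τ i , from-injective size p

          quad-injective : ∀ {z w} → Ok x̂ ŷ z w → ∀ {a b} →
                           quad x̂ ŷ z w a ≡ quad x̂ ŷ z w b → a ≡ b
          quad-injective {z} {w} ok {a} {b} p = σ-injective (t-eq (trans (quad-rel ok a b)
            (trans (cong (r (quad x̂ ŷ z w a)) (sym p)) (r-refl _))))

          inner : ∀ {z w z′ w′} → Ok x̂ ŷ z w → ∀ {a} → a ≢ 0F → a ≢ 1F →
                  (∃[ b ] quad x̂ ŷ z′ w′ b ≡ quad x̂ ŷ z w a) →
                  quad x̂ ŷ z w a ≡ z′ ⊎ quad x̂ ŷ z w a ≡ w′
          inner ok {a} a≢0 a≢1 (0F , p) = contradiction (sym (quad-injective ok {0F} {a} p)) a≢0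
          inner ok {a} a≢0 a≢1 (1F , p) = contradiction (sym (quad-injective ok {1F} {a} p)) a≢1
          inner ok     a≢0 a≢1 (2F , p) = inj₁ (sym p)
          inner ok     a≢0 a≢1 (3F , p) = inj₂ (sym p)

          embed-injective : ∀ {z w z′ w′} (good : Good x̂ ŷ (z , w)) (good′ : Good x̂ ŷ (z′ , w′)) →
            (∀ v → vertexSet (embed (proj₁ good)) v → vertexSet (embed (proj₁ good′)) v) →
            (z , w) ≡ (z′ , w′)
          embed-injective {z} {w} (ok , good) (ok′ , good′) h
            with inner ok {2F} (λ ()) (λ ()) (∈embed⇒ ok′ (h (from z) (∈embed ok 2F)))
               | inner ok {3F} (λ ()) (λ ()) (∈embed⇒ ok′ (h (from w) (∈embed ok 3F)))
          ... | inj₁ refl | inj₁ p    = contradiction (sym p) (Ok-distinct ok)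
          ... | inj₁ refl | inj₂ refl = refl
          ... | inj₂ refl | inj₁ refl = contradiction (good′ ok) (Fin.<-asym (good ok′))
          ... | inj₂ refl | inj₂ p    = contradiction (sym p) (Ok-distinct ok)

          embedding-rel : ∀ (E : Emb) i j → t i j ≡ r (to (map E i)) (to (map E j))
          embedding-rel E i j with i Fin.≟ j | G? i j
          ... | yes refl | _ = sym (r-refl (to (map E i)))
          ... | no _     | yes i~j = sym (adj-rel (~-from-to (Equivalence.to (Embedding.induced E i j) i~j)))
          ... | no i≢j   | no i≁j  = sym (non-rel (i≢j ∘ Embedding.injective E ∘ to-injective size)
            (i≁j ∘ Equivalence.from (Embedding.induced E i j) ∘ ~-to-from))

          swap : Fin 4 → Fin 4
          swap 0F = 0F
          swap 1F = 1F
          swap 2F = 3F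
          swap 3F = 2F

          quad-swap : ∀ z w a → quad x̂ ŷ w z (swap a) ≡ quad x̂ ŷ z w a
          quad-swap z w 0F = refl
          quad-swap z w 1F = refl
          quad-swap z w 2F = refl
          quad-swap z w 3F = refl

          swap-involutive : ∀ a → swap (swap a) ≡ a
          swap-involutive 0F = refl
          swap-involutive 1F = refl
          swap-involutive 2F = refl
          swap-involutive 3F = refl

          Represents : Fin N × Fin N → Emb → Set _
          Represents (z , w) E = Σ (Good x̂ ŷ (z , w)) λ good →
            (∀ v → vertexSet (embed (proj₁ good)) v → vertexSet E v) ×
            (∀ v → vertexSet E v → vertexSet (embed (proj₁ good)) v)

          represented : ∀ E → ∃[ zw ] Represents zw E
          represented E = decide (Ok? x̂ ŷ w z) (Fin.<-cmp z w)
            where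
            g : Fin 4 → Fin N
            g a = to (map E (σ a))
            z w : Fin N
            z = g 2F
            w = g 3F
            g-quad : ∀ a → g a ≡ quad x̂ ŷ z w a
            g-quad 0F = to-cong (≈-trans (reflexive (cong (map E) (proj₁ (proj₂ π)))) (Embedding.x₀↦x E))
              where open Setoid V using (reflexive)
            g-quad 1F = to-cong (≈-trans (reflexive (cong (map E) (proj₂ (proj₂ π)))) (Embedding.y₀↦y E))
              where open Setoid V using (reflexive)
            g-quad 2F = refl
            g-quad 3F = refl
            rel-quad : ∀ a b → s a b ≡ r (quad x̂ ŷ z w a) (quad x̂ ŷ z w b)
            rel-quad a b = trans (embedding-rel E (σ a) (σ b)) (cong₂ r (g-quad a) (g-quad b))
            ok : Ok x̂ ŷ z w
            ok = rel-quad 0F 1F , (rel-quad 0F 2F , rel-quad 1F 2F) ,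
                 (rel-quad 0F 3F , rel-quad 1F 3F) , rel-quad 2F 3F
            represents : ∀ {z′ w′} (good : Good x̂ ŷ (z′ , w′)) (ρ : Fin 4 → Fin 4) →
              (∀ a → ρ (ρ a) ≡ a) → (∀ a → quad x̂ ŷ z′ w′ (ρ a) ≡ quad x̂ ŷ z w a) →
              ∃[ zw ] Represents zw E
            represents {z′} {w′} good ρ ρρ h = (z′ , w′) , good
              , (λ v (i , p) → σ (ρ (τ i)) , ≈-trans (E≈ (ρ (τ i)))
                  (≈-trans (from-cong (cong (quad x̂ ŷ z′ w′) (ρρ (τ i)))) p))
              , (λ v (i , p) → σ (ρ (τ i)) , ≈-trans
                  (from-cong (trans (cong (quad x̂ ŷ z′ w′) (τσ (ρ (τ i)))) (h (τ i))))
                  (≈-trans (from-cong (trans (sym (g-quad (τ i))) (cong (to ∘ map E) (στ i))))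
                    (≈-trans (strictlyInverseʳ (map E i)) p)))
              where
              E≈ : ∀ a → map E (σ a) ≈ from (quad x̂ ŷ z′ w′ (ρ a))
              E≈ a = ≈-trans (≈-sym (strictlyInverseʳ (map E (σ a))))
                (from-cong (trans (g-quad a) (sym (h a))))
            decide : Dec (Ok x̂ ŷ w z) → _ → ∃[ zw ] Represents zw E
            decide (no ¬ok) _              = represents (ok , λ ok′ → contradiction ok′ ¬ok) (λ a → a) (λ _ → refl) λ _ → refl
            decide (yes _) (tri< z<w _ _)  = represents (ok , λ _ → z<w) (λ a → a) (λ _ → refl) λ _ → refl
            decide (yes _) (tri≈ _ z≡w _)  = contradiction z≡w (Ok-distinct ok)
            decide (yes ok′) (tri> _ _ w<z) = represents (ok′ , λ _ → w<z) swap swap-involutive (quad-swap z w)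

          GoodPairs : Setoid _ _
          GoodPairs = restrict (≡-setoid (Fin N × Fin N)) (Good x̂ ŷ)

          opaque
            goodPairs : HasSize GoodPairs (count x̂ ŷ)
            goodPairs = subst (HasSize GoodPairs) (over-pairs N (𝟙 ∘ Good? x̂ ŷ))
              (restrict-size (pairs N) (Good? x̂ ŷ) λ { refl good → good })

          copy : Fin (count x̂ ŷ) → Emb
          copy i = embed (proj₁ (proj₂ (Inverse.from goodPairs i)))

          infix 4 _≈ᶜ_
          _≈ᶜ_ : Emb → Emb → Set _
          _≈ᶜ_ = Setoid._≈_ (Copies Γ G x₀ y₀ x y)

          copy-injective : ∀ {i j} → copy i ≈ᶜ copy j → i ≡ j
          copy-injective {i} {j} p = from-injective goodPairs {i} {j}
            (embed-injective (proj₂ (Inverse.from goodPairs i)) (proj₂ (Inverse.from goodPairs j)) (proj₁ p))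

          copy-surjective : ∀ E → ∃[ i ] copy i ≈ᶜ E
          copy-surjective E with represented E
          ... | (zw , good , ⊆E , E⊆) = i , sub (Inverse.from goodPairs i) (Inverse.strictlyInverseʳ goodPairs (zw , good))
            where
            i : Fin (count x̂ ŷ)
            i = Inverse.to goodPairs (zw , good)
            sub : ∀ (g : ∃ (Good x̂ ŷ)) → proj₁ g ≡ zw → embed (proj₁ (proj₂ g)) ≈ᶜ E
            sub g refl = (λ v p → ⊆E v p) , (λ v p → E⊆ v p)

        copies-size : HasSize (Copies Γ G x₀ y₀ x y) (count x̂ ŷ)
        copies-size = enumerated (Copies Γ G x₀ y₀ x y) copy
          (λ {i} {j} → copy-injective {i} {j}) copy-surjective

      constant : ∃[ n₁ ] ∃[ n₀ ] (∀ x y → x ≉ y →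
        (x ~ y → HasSize (Copies Γ G x₀ y₀ x y) n₁) ×
        (¬ x ~ y → HasSize (Copies Γ G x₀ y₀ x y) n₀))
      constant = κ adj , κ non , λ x y x≉y →
        (λ x~y → subst (HasSize (Copies Γ G x₀ y₀ x y))
          (count-κ (x≉y ∘ to-injective size) (adj-rel (~-from-to x~y))) (copies-size x y)) ,
        (λ x≁y → subst (HasSize (Copies Γ G x₀ y₀ x y))
          (count-κ (x≉y ∘ to-injective size)
            (non-rel (x≉y ∘ to-injective size) (x≁y ∘ ~-to-from))) (copies-size x y))
        where
        off : ∀ {x y : Fin N} → Dec (x ≡ y) → ℕ
        off         (yes _) = 0
        off {x} {y} (no _)  = count x y
        offCount : Fin N → Fin N → ℕ
        offCount x y = off (x Fin.≟ y)
        offCount-invariant : Invariant offCount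
        offCount-invariant x y x′ y′ p = go (x Fin.≟ y) (x′ Fin.≟ y′)
          where
          go : (d : Dec (x ≡ y)) (d′ : Dec (x′ ≡ y′)) → off d ≡ off d′
          go (yes _)    (yes _)    = refl
          go (no x≢y)   (no x′≢y′) = count-off x y x′ y′ x≢y x′≢y′ p
          go (yes x≡y)  (no x′≢y′) = contradiction (r-eq (trans (sym p)
            (trans (cong (r x) (sym x≡y)) (r-refl x)))) x′≢y′
          go (no x≢y)   (yes x≡y′) = contradiction (r-eq (trans p
            (trans (cong (r x′) (sym x≡y′)) (r-refl x′)))) x≢y
        κ = proj₁ (fromWeight offCount-invariant)
        offCount≡ : ∀ {x y} → x ≢ y → offCount x y ≡ count x y
        offCount≡ {x} {y} x≢y = go (x Fin.≟ y)
          where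
          go : (d : Dec (x ≡ y)) → off d ≡ count x y
          go (yes x≡y) = contradiction x≡y x≢y
          go (no _)    = refl
        count-κ : ∀ {x y i} → x ≢ y → r x y ≡ i → count x y ≡ κ i
        count-κ {x} {y} x≢y p = trans (sym (offCount≡ x≢y))
          (trans (proj₂ (fromWeight offCount-invariant) x y) (cong κ p))

    vertexCondition : (∀ α β γ ζ ε → OffDiagonal (T α β γ ζ ε)) → VertexCondition Γ 4
    vertexCondition T-inv G G? x₀ y₀ x₀≢y₀ = Count.constant T-inv G G? x₀ y₀ x₀≢y₀

  square-distance : ∀ m n → m * m + n * n ≡ 2 * (m * n) + ∣ m - n ∣ * ∣ m - n ∣
  square-distance m n with ≤-total m n
  ... | inj₁ m≤n with o , refl ← m≤n⇒∃[o]m+o≡n m≤n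
        rewrite ∣m-m+n∣≡n m o = lemma m o
    where
    lemma : ∀ m o → m * m + (m + o) * (m + o) ≡ 2 * (m * (m + o)) + o * o
    lemma = solve-∀
  ... | inj₂ n≤m with o , refl ← m≤n⇒∃[o]m+o≡n n≤m
        rewrite ∣-∣-comm (n + o) n | ∣m-m+n∣≡n n o = lemma n o
    where
    lemma : ∀ n o → (n + o) * (n + o) + n * n ≡ 2 * ((n + o) * n) + o * o
    lemma = solve-∀

  module DualDesign {v k lam} (I : Fin v → Fin v → ℕ)
    (I-idem : ∀ p B → I p B * I p B ≡ I p B)
    (block-size : ∀ B → ∑[ p < v ] I p B ≡ k)
    (pair-degree : ∀ {p p′} → p ≢ p′ → ∑[ B < v ] (I p B * I p′ B) ≡ lam)
    (parameters : lam * v + k ≡ k * k + lam) (1<k : 1 < k) where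

    open ≡-Reasoning

    private
      pair-degree+ : ∀ {r p} → ∑[ B < v ] I p B ≡ r → ∀ p′ →
        ∑[ B < v ] (I p B * I p′ B) + 𝟙 (p Fin.≟ p′) * lam ≡ lam + 𝟙 (p Fin.≟ p′) * r
      pair-degree+ {r} {p} h p′ with p Fin.≟ p′
      ... | yes refl = trans (+-comm _ (1 * lam)) (cong₂ _+_ (*-identityˡ lam)
        (trans (∑-cong (I-idem p)) (trans h (sym (*-identityˡ r)))))
      ... | no p≢p′  = cong (_+ 0) (pair-degree p≢p′)

    point-degree : ∀ p → ∑[ B < v ] I p B ≡ k
    point-degree p = cancel k lam r v parameters 1<k degrees
      where
      r = ∑[ B < v ] I p B
      degrees : r * k + lam ≡ v * lam + r
      degrees = begin
        r * k + lam
          ≡⟨ cong₂ _+_ (*-∑ʳ k (I p)) (sym (∑-δ p (λ _ → lam))) ⟩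
        ∑[ B < v ] (I p B * k) + ∑[ p′ < v ] (𝟙 (p Fin.≟ p′) * lam)
          ≡⟨ cong (_+ ∑[ p′ < v ] (𝟙 (p Fin.≟ p′) * lam)) (trans
               (∑-cong λ B → trans (cong (I p B *_) (sym (block-size B))) (*-∑ˡ (I p B) _))
               (∑-comm λ B p′ → I p B * I p′ B)) ⟩
        ∑[ p′ < v ] ∑[ B < v ] (I p B * I p′ B) + ∑[ p′ < v ] (𝟙 (p Fin.≟ p′) * lam)
          ≡⟨ ∑-+ (λ p′ → ∑[ B < v ] (I p B * I p′ B)) _ ⟨
        ∑[ p′ < v ] (∑[ B < v ] (I p B * I p′ B) + 𝟙 (p Fin.≟ p′) * lam)
          ≡⟨ ∑-cong (pair-degree+ {p = p} refl) ⟩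
        ∑[ p′ < v ] (lam + 𝟙 (p Fin.≟ p′) * r)
          ≡⟨ ∑-+ (λ _ → lam) _ ⟩
        ∑[ p′ < v ] lam + ∑[ p′ < v ] (𝟙 (p Fin.≟ p′) * r)
          ≡⟨ cong₂ _+_ (∑-const v lam) (∑-δ p (λ _ → r)) ⟩
        v * lam + r ∎
      cancel : ∀ k lam r v → lam * v + k ≡ k * k + lam → 1 < k →
               r * k + lam ≡ v * lam + r → r ≡ k
      cancel (suc zero)    lam r v _ (s≤s ()) _
      cancel (suc (suc k)) lam r v h _ h′ = *-cancelʳ-≡ r (2 + k) (1 + k)
        (+-cancelʳ-≡ (r + lam + (2 + k)) _ _ (begin
          r * (1 + k) + (r + lam + (2 + k))             ≡⟨ lemma₁ r lam k ⟩
          (r * (2 + k) + lam) + (2 + k)                 ≡⟨ cong (_+ (2 + k)) h′ ⟩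
          (v * lam + r) + (2 + k)                       ≡⟨ lemma₂ v lam r (2 + k) ⟩
          (lam * v + (2 + k)) + r                       ≡⟨ cong (_+ r) h ⟩
          ((2 + k) * (2 + k) + lam) + r                 ≡⟨ lemma₃ r lam k ⟩
          (2 + k) * (1 + k) + (r + lam + (2 + k))       ∎))
        where
        lemma₁ : ∀ r lam k → r * (1 + k) + (r + lam + (2 + k)) ≡ (r * (2 + k) + lam) + (2 + k)
        lemma₁ = solve-∀
        lemma₂ : ∀ v lam r k → (v * lam + r) + k ≡ (lam * v + k) + r
        lemma₂ = solve-∀
        lemma₃ : ∀ r lam k → ((2 + k) * (2 + k) + lam) + r ≡ (2 + k) * (1 + k) + (r + lam + (2 + k))
        lemma₃ = solve-∀

    meet : Fin v → Fin v → ℕ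
    meet B B′ = ∑[ p < v ] (I p B * I p B′)

    meet-self : ∀ B → meet B B ≡ k
    meet-self B = trans (∑-cong λ p → I-idem p B) (block-size B)

    -- The sum of (meet B B′ − lam)² over all blocks B′ equals its term B′ = B.
    meet-≢ : ∀ {B B′} → B ≢ B′ → meet B B′ ≡ lam
    meet-≢ {B} {B′} B≢B′ = ∣m-n∣≡0⇒m≡n (square-zero (trans (sym (deviation B′))
      (cong (_* (dist k * dist k)) (𝟙-no (B Fin.≟ B′) B≢B′))))
      where
      dist : ℕ → ℕ
      dist m = ∣ m - lam ∣
      square-zero : ∀ {n} → n * n ≡ 0 → n ≡ 0
      square-zero {n} p with m*n≡0⇒m≡0∨n≡0 n p
      ... | inj₁ q = q
      ... | inj₂ q = q
      ∑meet : ∑[ C < v ] meet B C ≡ k * k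
      ∑meet = begin
        ∑[ C < v ] meet B C                    ≡⟨ ∑-comm (λ C p → I p B * I p C) ⟩
        ∑[ p < v ] ∑[ C < v ] (I p B * I p C)  ≡⟨ ∑-cong (λ p → *-∑ˡ (I p B) (I p)) ⟨
        ∑[ p < v ] (I p B * ∑[ C < v ] I p C)  ≡⟨ ∑-cong (λ p → cong (I p B *_) (point-degree p)) ⟩
        ∑[ p < v ] (I p B * k)                 ≡⟨ *-∑ʳ k (λ p → I p B) ⟨
        (∑[ p < v ] I p B) * k                 ≡⟨ cong (_* k) (block-size B) ⟩
        k * k                                  ∎
      ∑meet² : ∑[ C < v ] (meet B C * meet B C) + k * lam ≡ k * k * lam + k * k
      ∑meet² = begin
        ∑[ C < v ] (meet B C * meet B C) + k * lam
          ≡⟨ cong₂ _+_ expand (sym (diagonal lam)) ⟩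
        ∑[ p < v ] ∑[ p′ < v ] (I p B * I p′ B * deg p p′) +
        ∑[ p < v ] ∑[ p′ < v ] (I p B * I p′ B * (𝟙 (p Fin.≟ p′) * lam))
          ≡⟨ ∑∑-+ (λ p p′ → I p B * I p′ B * deg p p′) _ ⟨
        ∑[ p < v ] ∑[ p′ < v ] (I p B * I p′ B * deg p p′ + I p B * I p′ B * (𝟙 (p Fin.≟ p′) * lam))
          ≡⟨ ∑-cong (λ p → ∑-cong λ p′ → trans (sym (*-distribˡ-+ (I p B * I p′ B) (deg p p′) _))
               (trans (cong (I p B * I p′ B *_) (pair-degree+ (point-degree p) p′))
                 (*-distribˡ-+ (I p B * I p′ B) lam _))) ⟩
        ∑[ p < v ] ∑[ p′ < v ] (I p B * I p′ B * lam + I p B * I p′ B * (𝟙 (p Fin.≟ p′) * k))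
          ≡⟨ ∑∑-+ (λ p p′ → I p B * I p′ B * lam) _ ⟩
        ∑[ p < v ] ∑[ p′ < v ] (I p B * I p′ B * lam) +
        ∑[ p < v ] ∑[ p′ < v ] (I p B * I p′ B * (𝟙 (p Fin.≟ p′) * k))
          ≡⟨ cong₂ _+_ constant (diagonal k) ⟩
        k * k * lam + k * k ∎
        where
        deg : Fin v → Fin v → ℕ
        deg p p′ = ∑[ C < v ] (I p C * I p′ C)
        ∑∑-+ : ∀ (f h : Fin v → Fin v → ℕ) → ∑[ z < v ] ∑[ w < v ] (f z w + h z w) ≡
               ∑[ z < v ] ∑[ w < v ] f z w + ∑[ z < v ] ∑[ w < v ] h z w
        ∑∑-+ f h = trans (∑-cong λ z → ∑-+ (f z) (h z))
          (∑-+ (λ z → ∑[ w < v ] f z w) (λ z → ∑[ w < v ] h z w))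
        diagonal : ∀ c → ∑[ p < v ] ∑[ p′ < v ] (I p B * I p′ B * (𝟙 (p Fin.≟ p′) * c)) ≡ k * c
        diagonal c = begin
          ∑[ p < v ] ∑[ p′ < v ] (I p B * I p′ B * (𝟙 (p Fin.≟ p′) * c))
            ≡⟨ ∑-cong (λ p → trans
                 (∑-cong λ p′ → lemma (I p B) (I p′ B) (𝟙 (p Fin.≟ p′)) c)
                 (trans (∑-δ p (λ p′ → I p B * I p′ B * c)) (cong (_* c) (I-idem p B)))) ⟩
          ∑[ p < v ] (I p B * c) ≡⟨ *-∑ʳ c (λ p → I p B) ⟨
          (∑[ p < v ] I p B) * c ≡⟨ cong (_* c) (block-size B) ⟩
          k * c                  ∎
          where
          lemma : ∀ a b i c → a * b * (i * c) ≡ i * (a * b * c)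
          lemma = solve-∀
        constant : ∑[ p < v ] ∑[ p′ < v ] (I p B * I p′ B * lam) ≡ k * k * lam
        constant = begin
          ∑[ p < v ] ∑[ p′ < v ] (I p B * I p′ B * lam)
            ≡⟨ ∑-cong (λ p → trans (sym (*-∑ʳ lam (λ p′ → I p B * I p′ B)))
                 (cong (_* lam) (trans (sym (*-∑ˡ (I p B) (λ p′ → I p′ B)))
                   (cong (I p B *_) (block-size B))))) ⟩
          ∑[ p < v ] (I p B * k * lam)
            ≡⟨ trans (cong (_* lam) (*-∑ʳ k (λ p → I p B))) (*-∑ʳ lam (λ p → I p B * k)) ⟨
          (∑[ p < v ] I p B) * k * lam
            ≡⟨ cong (λ n → n * k * lam) (block-size B) ⟩
          k * k * lam ∎
        expand : ∑[ C < v ] (meet B C * meet B C) ≡ ∑[ p < v ] ∑[ p′ < v ] (I p B * I p′ B * deg p p′)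
        expand = begin
          ∑[ C < v ] (meet B C * meet B C)
            ≡⟨ ∑-cong (λ C → trans (*-∑ʳ (meet B C) (λ p → I p B * I p C))
                 (∑-cong λ p → *-∑ˡ (I p B * I p C) (λ p′ → I p′ B * I p′ C))) ⟩
          ∑[ C < v ] ∑[ p < v ] ∑[ p′ < v ] (I p B * I p C * (I p′ B * I p′ C))
            ≡⟨ ∑-comm (λ C p → ∑[ p′ < v ] (I p B * I p C * (I p′ B * I p′ C))) ⟩
          ∑[ p < v ] ∑[ C < v ] ∑[ p′ < v ] (I p B * I p C * (I p′ B * I p′ C))
            ≡⟨ ∑-cong (λ p → ∑-comm (λ C p′ → I p B * I p C * (I p′ B * I p′ C))) ⟩
          ∑[ p < v ] ∑[ p′ < v ] ∑[ C < v ] (I p B * I p C * (I p′ B * I p′ C))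
            ≡⟨ ∑-cong (λ p → ∑-cong λ p′ → trans
                 (∑-cong λ C → lemma (I p B) (I p C) (I p′ B) (I p′ C))
                 (sym (*-∑ˡ (I p B * I p′ B) (λ C → I p C * I p′ C)))) ⟩
          ∑[ p < v ] ∑[ p′ < v ] (I p B * I p′ B * deg p p′) ∎
          where
          lemma : ∀ a b c d → a * b * (c * d) ≡ a * c * (b * d)
          lemma = solve-∀
      ∑dist : ∑[ C < v ] (dist (meet B C) * dist (meet B C)) ≡ dist k * dist k
      ∑dist = +-cancelˡ-≡ (2 * (k * lam)) _ _ (trans
        (+-cancelˡ-≡ (k * k * lam) _ _ (balance k lam v _ _ parameters ∑meet² summed))
        (square-distance k lam))
        where
        summed : ∑[ C < v ] (meet B C * meet B C) + v * (lam * lam) ≡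
                 2 * (k * k * lam) + ∑[ C < v ] (dist (meet B C) * dist (meet B C))
        summed = begin
          ∑[ C < v ] (meet B C * meet B C) + v * (lam * lam)
            ≡⟨ cong (∑[ C < v ] (meet B C * meet B C) +_) (∑-const v (lam * lam)) ⟨
          ∑[ C < v ] (meet B C * meet B C) + ∑[ C < v ] (lam * lam)
            ≡⟨ ∑-+ (λ C → meet B C * meet B C) _ ⟨
          ∑[ C < v ] (meet B C * meet B C + lam * lam)
            ≡⟨ ∑-cong (λ C → square-distance (meet B C) lam) ⟩
          ∑[ C < v ] (2 * (meet B C * lam) + dist (meet B C) * dist (meet B C))
            ≡⟨ ∑-+ (λ C → 2 * (meet B C * lam)) _ ⟩
          ∑[ C < v ] (2 * (meet B C * lam)) + ∑[ C < v ] (dist (meet B C) * dist (meet B C))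
            ≡⟨ cong (_+ ∑[ C < v ] (dist (meet B C) * dist (meet B C))) (trans
                 (sym (*-∑ˡ 2 (λ C → meet B C * lam)))
                 (cong (2 *_) (trans (sym (*-∑ʳ lam (meet B))) (cong (_* lam) ∑meet)))) ⟩
          2 * (k * k * lam) + ∑[ C < v ] (dist (meet B C) * dist (meet B C)) ∎
        balance : ∀ k lam v m d → lam * v + k ≡ k * k + lam → m + k * lam ≡ k * k * lam + k * k →
          m + v * (lam * lam) ≡ 2 * (k * k * lam) + d →
          k * k * lam + (2 * (k * lam) + d) ≡ k * k * lam + (k * k + lam * lam)
        balance k lam v m d h₁ h₂ h₃ = +-cancelʳ-≡ (m + k * k * lam + v * (lam * lam)) _ _ (begin
          k * k * lam + (2 * (k * lam) + d) + (m + k * k * lam + v * (lam * lam))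
            ≡⟨ e₁ k lam v m d ⟩
          (2 * (k * k * lam) + d) + lam * (lam * v + k) + (m + k * lam)
            ≡⟨ cong₂ _+_ (cong₂ _+_ (sym h₃) (cong (lam *_) h₁)) h₂ ⟩
          (m + v * (lam * lam)) + lam * (k * k + lam) + (k * k * lam + k * k)
            ≡⟨ e₂ k lam v m ⟩
          k * k * lam + (k * k + lam * lam) + (m + k * k * lam + v * (lam * lam)) ∎)
          where
          e₁ : ∀ k lam v m d → k * k * lam + (2 * (k * lam) + d) + (m + k * k * lam + v * (lam * lam)) ≡
               (2 * (k * k * lam) + d) + lam * (lam * v + k) + (m + k * lam)
          e₁ = solve-∀
          e₂ : ∀ k lam v m → (m + v * (lam * lam)) + lam * (k * k + lam) + (k * k * lam + k * k) ≡
               k * k * lam + (k * k + lam * lam) + (m + k * k * lam + v * (lam * lam))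
          e₂ = solve-∀
      deviation : ∀ C → 𝟙 (B Fin.≟ C) * (dist k * dist k) ≡ dist (meet B C) * dist (meet B C)
      deviation = ∑-≤-≡⇒≡ below (trans (∑-δ B (λ _ → dist k * dist k)) (sym ∑dist))
        where
        below : ∀ C → 𝟙 (B Fin.≟ C) * (dist k * dist k) ≤ dist (meet B C) * dist (meet B C)
        below C with B Fin.≟ C
        ... | yes refl = ≤-reflexive (trans (*-identityˡ _)
          (cong (λ m → dist m * dist m) (sym (meet-self B))))
        ... | no _     = z≤n

  geometric : ℕ → ℕ → ℕ
  geometric q zero    = 0
  geometric q (suc n) = 1 + q * geometric q n

  geometric-power : ∀ p n → (1 + p) ^ n ≡ 1 + p * geometric (1 + p) n
  geometric-power p zero    = cong suc (sym (*-zeroʳ p))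
  geometric-power p (suc n) = trans (cong ((1 + p) *_) (geometric-power p n))
    (lemma p (geometric (1 + p) n))
    where
    lemma : ∀ p g → (1 + p) * (1 + p * g) ≡ 1 + p * (1 + (1 + p) * g)
    lemma = solve-∀

  quotient-geometric : ∀ p .{{_ : NonZero p}} n → ((1 + p) ^ n ∸ 1) / p ≡ geometric (1 + p) n
  quotient-geometric p n = trans
    (cong (λ i → (i ∸ 1) / p) (trans (geometric-power p n) (cong suc (*-comm p _))))
    (m*n/n≡m (geometric (1 + p) n) p)

  -- The number of vectors in the radical of {y, y′}^⊥, and of its intersection
  -- with U when the line on y and y′ meets U; the argument is 1 if y ⊥ y′ and
  -- 0 otherwise.
  radical radicalInU : ℕ → ℕ → ℕ
  radical q 0          = 1
  radical q (suc _)    = q * q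
  radicalInU q 0       = 1
  radicalInU q (suc _) = q

  -- The pair (A , a) stands for the point on y_A + a, with a ∈ U; R = q^(d-2).
  record PerpCounts (p t q R : ℕ) {n m : ℕ} (perp : Fin n → Fin m → Fin n → Fin m → ℕ) : Set where
    s : ℕ
    s = q * R * R

    outer : Fin n → Fin m → Fin n → Fin m → ℕ
    outer A a A′ a′ = ∑[ B < n ] ∑[ b < m ] (perp A a B b * perp A′ a′ B b *
      ∑[ C < n ] ∑[ c < m ] (perp A a C c * perp A′ a′ C c * perp B b C c))

    field
      perp-01     : ∀ A a B b → perp A a B b ≡ 0 ⊎ perp A a B b ≡ 1
      perp-sym    : ∀ A a B b → perp A a B b ≡ perp B b A a
      perp-degree : ∀ A a B → ∑[ b < m ] perp A a B b ≡ q * R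
      perp-common : ∀ {A a A′ a′} → A ≢ A′ → ∀ B →
        ∑[ b < m ] (perp A a B b * perp A′ a′ B b) ≡ R
      perp-class  : ∀ {A a a′} → a ≢ a′ → Σ (Fin n → ℕ) λ g →
        (∀ B → ∑[ b < m ] (perp A a B b * perp A a′ B b) ≡ g B * (q * R)) ×
        g A ≡ perp A a A a′ × ∑[ B < n ] g B ≡ 1 + q * t
      perp-trans  : ∀ A a b c → perp A a A b * perp A a A c * perp A b A c ≡ perp A a A b * perp A a A c
      outer-≢     : ∀ {A a A′ a′} → A ≢ A′ → p * p * outer A a A′ a′ + 2 * (R * s + p * s * 1) ≡
        q * R * (q * R) * s + p * s * radical q (perp A a A′ a′) + R * R
      outer-≡     : ∀ {A a a′} → a ≢ a′ →
        p * p * outer A a A a′ + 2 * (q * R * s + p * s * radicalInU q (perp A a A a′)) ≡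
        q * R * (q * R) * s + p * s * radical q (perp A a A a′) + q * R * (q * R)

  -- The field has order q = 1 + p, t is the number of points of a (d - 2)-space,
  -- and R = q^(d-2), k, v, Q = q^d, s = q^(2d-3) are polynomials in p and t.
  module Parameters (p t : ℕ) where
    q R k v Q s : ℕ
    q = 1 + p
    R = 1 + p * t
    k = 1 + q * t
    v = 1 + q * k
    Q = q * (q * R)
    s = q * R * R

    edgeCount : ℕ → ℕ
    edgeCount ε = k * k + 2 * (q * R * (k * t + ε * R)) + k * k * s + ε * (p * s)

    private
      k≡′ : ∀ p t → 1 + (1 + p) * t ≡ t + (1 + p * t)
      k≡′ = solve-∀
      parameters′ : ∀ p t → let q = 1 + p ; k = 1 + q * t ; v = 1 + q * k in
                    t * v + k ≡ k * k + t
      parameters′ = solve-∀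
      degree≡′ : ∀ p t → let q = 1 + p ; R = 1 + p * t ; k = 1 + q * t ; v = 1 + q * k
                             Q = q * (q * R) in v + k * Q ≡ k + v * (q * R)
      degree≡′ = solve-∀
      common-in≡′ : ∀ p t → let q = 1 + p ; R = 1 + p * t ; k = 1 + q * t ; v = 1 + q * k
                                Q = q * (q * R) in v + t * Q ≡ k + k * (q * R)
      common-in≡′ = solve-∀
      common-out≡′ : ∀ p t → let q = 1 + p ; R = 1 + p * t ; k = 1 + q * t ; v = 1 + q * k in
                     t + v * R ≡ k + k * (q * R)
      common-out≡′ = solve-∀
      edges-in≡′ : ∀ p t → let q = 1 + p ; R = 1 + p * t ; k = 1 + q * t ; v = 1 + q * k
                               Q = q * (q * R) ; s = q * R * R in
        v * v + 2 * (Q * t * k) + Q * t * (t * (q * R)) ≡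
        k * k + 2 * (q * R * (k * t + 1 * R)) + k * k * s + 1 * (p * s)
      edges-in≡′ = solve-∀
      edges-≢₀ : ∀ p t → let q = 1 + p ; R = 1 + p * t ; k = 1 + q * t ; v = 1 + q * k
                             Q = q * (q * R) ; s = q * R * R in
        p * p * (t * t + 2 * (R * t * k)) + (q * R * (q * R) * s + p * s * 1 + R * R) ≡
        p * p * (k * k + 2 * (q * R * (k * t + 0 * R)) + k * k * s + 0 * (p * s)) + 2 * (R * s + p * s * 1)
      edges-≢₀ = solve-∀
      edges-≢₁ : ∀ p t → let q = 1 + p ; R = 1 + p * t ; k = 1 + q * t ; v = 1 + q * k
                             Q = q * (q * R) ; s = q * R * R in
        p * p * (t * t + 2 * (R * t * k)) + (q * R * (q * R) * s + p * s * (q * q) + R * R) ≡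
        p * p * (k * k + 2 * (q * R * (k * t + 1 * R)) + k * k * s + 1 * (p * s)) + 2 * (R * s + p * s * 1)
      edges-≢₁ = solve-∀
      edges-≡₀ : ∀ p t → let q = 1 + p ; R = 1 + p * t ; k = 1 + q * t ; v = 1 + q * k
                             Q = q * (q * R) ; s = q * R * R in
        p * p * (k * k + 2 * (q * R * (k * t + 0 * R))) +
          (q * R * (q * R) * s + p * s * 1 + q * R * (q * R)) ≡
        p * p * (k * k + 2 * (q * R * (k * t + 0 * R)) + k * k * s + 0 * (p * s)) +
          2 * (q * R * s + p * s * 1)
      edges-≡₀ = solve-∀
      edges-≡₁ : ∀ p t → let q = 1 + p ; R = 1 + p * t ; k = 1 + q * t ; v = 1 + q * k
                             Q = q * (q * R) ; s = q * R * R in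
        p * p * (k * k + 2 * (q * R * (k * t + 1 * R))) +
          (q * R * (q * R) * s + p * s * (q * q) + q * R * (q * R)) ≡
        p * p * (k * k + 2 * (q * R * (k * t + 1 * R)) + k * k * s + 1 * (p * s)) +
          2 * (q * R * s + p * s * q)
      edges-≡₁ = solve-∀

    k≡ : k ≡ t + R
    k≡ = k≡′ p t
    parameters : t * v + k ≡ k * k + t
    parameters = parameters′ p t
    degree≡ : v + k * Q ≡ k + v * (q * R)
    degree≡ = degree≡′ p t
    common-in≡ : v + t * Q ≡ k + k * (q * R)
    common-in≡ = common-in≡′ p t
    common-out≡ : t + v * R ≡ k + k * (q * R)
    common-out≡ = common-out≡′ p t
    edges-in≡ : v * v + 2 * (Q * t * k) + Q * t * (t * (q * R)) ≡ edgeCount 1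
    edges-in≡ = edges-in≡′ p t

    edges-≢≡ : ∀ {ε} → ε ≡ 0 ⊎ ε ≡ 1 →
      p * p * (t * t + 2 * (R * t * k)) + (q * R * (q * R) * s + p * s * radical q ε + R * R) ≡
      p * p * edgeCount ε + 2 * (R * s + p * s * 1)
    edges-≢≡ (inj₁ refl) = edges-≢₀ p t
    edges-≢≡ (inj₂ refl) = edges-≢₁ p t
    edges-≡≡ : ∀ {ε} → ε ≡ 0 ⊎ ε ≡ 1 →
      p * p * (k * k + 2 * (q * R * (k * t + ε * R))) +
        (q * R * (q * R) * s + p * s * radical q ε + q * R * (q * R)) ≡
      p * p * edgeCount ε + 2 * (q * R * s + p * s * radicalInU q ε)
    edges-≡≡ (inj₁ refl) = edges-≡₀ p t
    edges-≡≡ (inj₂ refl) = edges-≡₁ p t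

  module Counts (p t : ℕ) {n m} (n≡v : n ≡ Parameters.v p t) (m≡Q : m ≡ Parameters.Q p t) (0<p : 0 < p)
    (I : Fin n → Fin n → ℕ)
    (I-01 : ∀ x B → I x B ≡ 0 ⊎ I x B ≡ 1)
    (block-size : ∀ B → ∑[ x < n ] I x B ≡ Parameters.k p t)
    (point-degree : ∀ x → ∑[ B < n ] I x B ≡ Parameters.k p t)
    (pair-degree : ∀ {x x′} → x ≢ x′ → ∑[ B < n ] (I x B * I x′ B) ≡ t)
    (meet-≢ : ∀ {B B′} → B ≢ B′ → ∑[ x < n ] (I x B * I x B′) ≡ t)
    (perp : Fin n → Fin m → Fin n → Fin m → ℕ)
    (perpCounts : PerpCounts p t (1 + p) (1 + p * t) perp) where

    open Parameters p t
    open PerpCounts perpCounts hiding (s)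
    open ≡-Reasoning

    X : Set
    X = Fin n ⊎ (Fin n × Fin m)

    ∑ˣ : (X → ℕ) → ℕ
    ∑ˣ f = ∑[ x < n ] f (inj₁ x) + ∑[ B < n ] ∑[ b < m ] f (inj₂ (B , b))

    M : X → X → ℕ
    M (inj₁ _)       (inj₁ _)       = 1
    M (inj₁ x)       (inj₂ (B , _)) = I x B
    M (inj₂ (B , _)) (inj₁ x)       = I x B
    M (inj₂ (A , a)) (inj₂ (B , b)) = perp A a B b

    edges : X → X → ℕ
    edges x y = ∑ˣ λ z → M x z * M y z * ∑ˣ λ w → M x w * M y w * M z w

    private
      01-idem : ∀ {i} → i ≡ 0 ⊎ i ≡ 1 → i * i ≡ i
      01-idem (inj₁ refl) = refl
      01-idem (inj₂ refl) = refl

      ∑-out : ∀ (f : Fin n → ℕ) (g : Fin n → Fin m → ℕ) {c} → (∀ B → ∑[ b < m ] g B b ≡ c) →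
              ∑[ B < n ] ∑[ b < m ] (f B * g B b) ≡ (∑[ B < n ] f B) * c
      ∑-out f g {c} h = trans (∑-cong λ B → trans (sym (*-∑ˡ (f B) (g B))) (cong (f B *_) (h B)))
        (sym (*-∑ʳ c f))

      ∑-out-const : ∀ (f : Fin n → ℕ) → ∑[ B < n ] ∑[ b < m ] f B ≡ (∑[ B < n ] f B) * Q
      ∑-out-const f = trans (∑-cong λ B → trans (∑-const m (f B))
        (trans (*-comm m (f B)) (cong (f B *_) m≡Q))) (sym (*-∑ʳ Q f))

      ∑-one : ∑[ x < n ] 1 ≡ v
      ∑-one = trans (∑-const n 1) (trans (*-identityʳ n) n≡v)

      meet : Fin n → Fin n → ℕ
      meet A B = ∑[ x < n ] (I x A * I x B)

      meet-self : ∀ A → meet A A ≡ k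
      meet-self A = trans (∑-cong λ x → 01-idem (I-01 x A)) (block-size A)

      meet+ : ∀ A B → meet A B ≡ t + 𝟙 (A Fin.≟ B) * R
      meet+ A B with A Fin.≟ B
      ... | yes refl = trans (meet-self A) (trans k≡ (cong (t +_) (sym (*-identityˡ R))))
      ... | no A≢B   = trans (meet-≢ A≢B) (sym (+-identityʳ t))

      ∑-meet : ∀ (f : Fin n → ℕ) A → ∑ n f ≡ k → ∑[ B < n ] (f B * meet A B) ≡ k * t + f A * R
      ∑-meet f A h = begin
        ∑[ B < n ] (f B * meet A B)
          ≡⟨ ∑-cong (λ B → trans (cong (f B *_) (meet+ A B)) (lemma (f B) t (𝟙 (A Fin.≟ B)) R)) ⟩
        ∑[ B < n ] (f B * t + 𝟙 (A Fin.≟ B) * (f B * R))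
          ≡⟨ ∑-+ (λ B → f B * t) _ ⟩
        ∑[ B < n ] (f B * t) + ∑[ B < n ] (𝟙 (A Fin.≟ B) * (f B * R))
          ≡⟨ cong₂ _+_ (trans (sym (*-∑ʳ t f)) (cong (_* t) h)) (∑-δ A (λ B → f B * R)) ⟩
        k * t + f A * R ∎
        where
        lemma : ∀ f t i R → f * (t + i * R) ≡ f * t + i * (f * R)
        lemma = solve-∀

    degree : ∀ x → ∑ˣ (M x) ≡ k + v * (q * R)
    degree (inj₁ x) = trans
      (cong₂ _+_ ∑-one (trans (∑-out-const (I x)) (cong (_* Q) (point-degree x)))) degree≡
    degree (inj₂ (A , a)) = cong₂ _+_ (block-size A)
      (trans (∑-cong λ B → perp-degree A a B) (trans (∑-const n (q * R)) (cong (_* (q * R)) n≡v)))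

    common : ∀ x y → x ≢ y → ∑ˣ (λ z → M x z * M y z) ≡ k + k * (q * R)
    common (inj₁ x) (inj₁ y) x≢y = trans (cong₂ _+_ ∑-one
      (trans (∑-out-const (λ B → I x B * I y B)) (cong (_* Q) (pair-degree (x≢y ∘ cong inj₁)))))
      common-in≡
    common (inj₁ x) (inj₂ (A , a)) _ = cong₂ _+_
      (trans (∑-cong λ z → *-identityˡ (I z A)) (block-size A))
      (trans (∑-out (I x) (perp A a) (perp-degree A a)) (cong (_* (q * R)) (point-degree x)))
    common (inj₂ (A , a)) (inj₁ x) _ = cong₂ _+_
      (trans (∑-cong λ z → *-identityʳ (I z A)) (block-size A))
      (trans (∑-cong λ B → ∑-cong λ b → *-comm (perp A a B b) (I x B))
        (trans (∑-out (I x) (perp A a) (perp-degree A a)) (cong (_* (q * R)) (point-degree x))))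
    common (inj₂ (A , a)) (inj₂ (A′ , a′)) x≢y with A Fin.≟ A′
    ... | no A≢A′ = trans (cong₂ _+_ (meet-≢ A≢A′)
      (trans (∑-cong (perp-common A≢A′)) (trans (∑-const n R) (cong (_* R) n≡v)))) common-out≡
    ... | yes refl with g , g-count , _ , ∑g ← perp-class {A} {a} {a′} (λ a≡a′ → x≢y (cong (λ a → inj₂ (A , a)) a≡a′)) =
      cong₂ _+_ (meet-self A)
        (trans (∑-cong g-count) (trans (sym (*-∑ʳ (q * R) g)) (cong (_* (q * R)) ∑g)))

    private
      module Split (x y : X) where
        a : Fin n → ℕ
        a z = M x (inj₁ z) * M y (inj₁ z)
        b : Fin n → Fin m → ℕ
        b B c = M x (inj₂ (B , c)) * M y (inj₂ (B , c))
        α β γ : ℕ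
        α = ∑[ z < n ] a z
        β = ∑[ B < n ] ((∑[ c < m ] b B c) * (∑[ z < n ] (a z * I z B)))
        γ = ∑[ B < n ] ∑[ c < m ] (b B c * ∑[ C < n ] ∑[ e < m ] (b C e * perp B c C e))

        edges-split : edges x y ≡ α * α + 2 * β + γ
        edges-split = begin
          ∑[ z < n ] (a z * (∑[ w < n ] (a w * 1) + β₁ z)) +
          ∑[ B < n ] ∑[ c < m ] (b B c * (β₂ B + γ′ B c))
            ≡⟨ cong₂ _+_
                 (trans (∑-cong λ z → *-distribˡ-+ (a z) (∑[ w < n ] (a w * 1)) (β₁ z))
                   (∑-+ (λ z → a z * ∑[ w < n ] (a w * 1)) (λ z → a z * β₁ z)))
                 (trans (∑-cong λ B → trans
                     (∑-cong λ c → *-distribˡ-+ (b B c) (β₂ B) (γ′ B c))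
                     (∑-+ (λ c → b B c * β₂ B) (λ c → b B c * γ′ B c)))
                   (∑-+ (λ B → ∑[ c < m ] (b B c * β₂ B)) _)) ⟩
          (∑[ z < n ] (a z * ∑[ w < n ] (a w * 1)) + ∑[ z < n ] (a z * β₁ z)) +
          (∑[ B < n ] ∑[ c < m ] (b B c * β₂ B) + γ)
            ≡⟨ cong₂ (λ i j → i + (j + γ)) (cong₂ _+_ αα first) second ⟩
          (α * α + β) + (β + γ)
            ≡⟨ lemma α β γ ⟩
          α * α + 2 * β + γ ∎
          where
          β₁ : Fin n → ℕ
          β₁ z = ∑[ B < n ] ∑[ c < m ] (b B c * I z B)
          β₂ : Fin n → ℕ
          β₂ B = ∑[ z < n ] (a z * I z B)
          γ′ : Fin n → Fin m → ℕ
          γ′ B c = ∑[ C < n ] ∑[ e < m ] (b C e * perp B c C e)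
          lemma : ∀ α β γ → (α * α + β) + (β + γ) ≡ α * α + 2 * β + γ
          lemma = solve-∀
          αα : ∑[ z < n ] (a z * ∑[ w < n ] (a w * 1)) ≡ α * α
          αα = trans (sym (*-∑ʳ (∑[ w < n ] (a w * 1)) a))
            (cong (α *_) (∑-cong λ w → *-identityʳ (a w)))
          second : ∑[ B < n ] ∑[ c < m ] (b B c * β₂ B) ≡ β
          second = ∑-cong λ B → sym (*-∑ʳ (β₂ B) (b B))
          first : ∑[ z < n ] (a z * β₁ z) ≡ β
          first = begin
            ∑[ z < n ] (a z * β₁ z)
              ≡⟨ ∑-cong (λ z → trans (*-∑ˡ (a z) _) (∑-cong λ B → trans
                   (cong (a z *_) (sym (*-∑ʳ (I z B) (b B))))
                   (shuffle (a z) (∑[ c < m ] b B c) (I z B)))) ⟩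
            ∑[ z < n ] ∑[ B < n ] ((∑[ c < m ] b B c) * (a z * I z B))
              ≡⟨ ∑-comm (λ z B → (∑[ c < m ] b B c) * (a z * I z B)) ⟩
            ∑[ B < n ] ∑[ z < n ] ((∑[ c < m ] b B c) * (a z * I z B))
              ≡⟨ ∑-cong (λ B → *-∑ˡ (∑[ c < m ] b B c) (λ z → a z * I z B)) ⟨
            β ∎
            where
            shuffle : ∀ a b i → a * (b * i) ≡ b * (a * i)
            shuffle = solve-∀

    edges-in-in : ∀ {x y} → x ≢ y → edges (inj₁ x) (inj₁ y) ≡ edgeCount 1
    edges-in-in {x} {y} x≢y = trans edges-split
      (trans (cong₂ _+_ (cong₂ (λ α β → α * α + 2 * β) ∑-one β≡) γ≡) edges-in≡)
      where
      open Split (inj₁ x) (inj₁ y)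
      ii : Fin n → ℕ
      ii B = I x B * I y B
      β≡ : β ≡ Q * t * k
      β≡ = begin
        ∑[ B < n ] ((∑[ c < m ] ii B) * (∑[ z < n ] (1 * I z B)))
          ≡⟨ ∑-cong (λ B → cong₂ _*_ (trans (∑-const m (ii B)) (cong (_* ii B) m≡Q))
               (trans (∑-cong λ z → *-identityˡ (I z B)) (block-size B))) ⟩
        ∑[ B < n ] (Q * ii B * k)   ≡⟨ *-∑ʳ k (λ B → Q * ii B) ⟨
        (∑[ B < n ] (Q * ii B)) * k ≡⟨ cong (_* k) (*-∑ˡ Q ii) ⟨
        Q * (∑[ B < n ] ii B) * k   ≡⟨ cong (λ i → Q * i * k) (pair-degree x≢y) ⟩
        Q * t * k                   ∎
      γ≡ : γ ≡ Q * t * (t * (q * R))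
      γ≡ = begin
        ∑[ B < n ] ∑[ c < m ] (ii B * ∑[ C < n ] ∑[ e < m ] (ii C * perp B c C e))
          ≡⟨ ∑-cong (λ B → ∑-cong λ c → cong (ii B *_)
               (trans (∑-out ii (perp B c) (perp-degree B c))
                 (cong (_* (q * R)) (pair-degree x≢y)))) ⟩
        ∑[ B < n ] ∑[ c < m ] (ii B * (t * (q * R)))
          ≡⟨ ∑-out-const (λ B → ii B * (t * (q * R))) ⟩
        (∑[ B < n ] (ii B * (t * (q * R)))) * Q
          ≡⟨ cong (_* Q) (*-∑ʳ (t * (q * R)) ii) ⟨
        (∑[ B < n ] ii B) * (t * (q * R)) * Q
          ≡⟨ cong (λ i → i * (t * (q * R)) * Q) (pair-degree x≢y) ⟩
        t * (t * (q * R)) * Q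
          ≡⟨ lemma t (t * (q * R)) Q ⟩
        Q * t * (t * (q * R)) ∎
        where
        lemma : ∀ a b c → a * b * c ≡ c * a * b
        lemma = solve-∀

    private
      triangles : Fin n → Fin m → Fin n → Fin n → ℕ
      triangles A a B C = ∑[ b < m ] ∑[ c < m ] (perp A a B b * perp A a C c * perp B b C c)

      triangles-≢ : ∀ {A a B C} → A ≢ B → triangles A a B C ≡ s
      triangles-≢ {A} {a} {B} {C} A≢B = begin
        ∑[ b < m ] ∑[ c < m ] (perp A a B b * perp A a C c * perp B b C c)
          ≡⟨ ∑-cong (λ b → trans
               (∑-cong λ c → *-assoc (perp A a B b) (perp A a C c) (perp B b C c))
               (trans (sym (*-∑ˡ (perp A a B b) (λ c → perp A a C c * perp B b C c)))
                 (cong (perp A a B b *_) (perp-common A≢B C)))) ⟩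
        ∑[ b < m ] (perp A a B b * R) ≡⟨ *-∑ʳ R (perp A a B) ⟨
        (∑[ b < m ] perp A a B b) * R ≡⟨ cong (_* R) (perp-degree A a B) ⟩
        s                             ∎

      triangles-swap : ∀ A a B C → triangles A a B C ≡ triangles A a C B
      triangles-swap A a B C = trans (∑-comm (λ b c → perp A a B b * perp A a C c * perp B b C c))
        (∑-cong λ c → ∑-cong λ b →
          cong₂ _*_ (*-comm (perp A a B b) (perp A a C c)) (perp-sym B b C c))

      triangles-self : ∀ A a → triangles A a A A ≡ s + p * s
      triangles-self A a = begin
        ∑[ b < m ] ∑[ c < m ] (perp A a A b * perp A a A c * perp A b A c)
          ≡⟨ ∑-cong (λ b → trans (∑-cong λ c → perp-trans A a b c)
               (trans (sym (*-∑ˡ (perp A a A b) (perp A a A)))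
                 (cong (perp A a A b *_) (perp-degree A a A)))) ⟩
        ∑[ b < m ] (perp A a A b * (q * R)) ≡⟨ *-∑ʳ (q * R) (perp A a A) ⟨
        (∑[ b < m ] perp A a A b) * (q * R) ≡⟨ cong (_* (q * R)) (perp-degree A a A) ⟩
        q * R * (q * R)                     ≡⟨ lemma p R ⟩
        s + p * s                           ∎
        where
        lemma : ∀ p R → (1 + p) * R * ((1 + p) * R) ≡ (1 + p) * R * R + p * ((1 + p) * R * R)
        lemma = solve-∀

      triangles+ : ∀ A a B C → triangles A a B C ≡ s + 𝟙 (A Fin.≟ B) * (𝟙 (A Fin.≟ C) * (p * s))
      triangles+ A a B C with A Fin.≟ B | A Fin.≟ C
      ... | yes refl | yes refl = trans (triangles-self A a) (cong (s +_) (lemma (p * s)))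
        where
        lemma : ∀ i → i ≡ 1 * (1 * i)
        lemma = solve-∀
      ... | yes refl | no A≢C   = trans (triangles-swap A a A C)
        (trans (triangles-≢ A≢C) (sym (+-identityʳ s)))
      ... | no A≢B   | _        = trans (triangles-≢ A≢B) (sym (+-identityʳ s))

    edges-in-out : ∀ x A a → edges (inj₁ x) (inj₂ (A , a)) ≡ edgeCount (I x A)
    edges-in-out x A a = trans edges-split
      (trans (cong₂ _+_ (cong₂ (λ α β → α * α + 2 * β) α≡ β≡) γ≡)
        (sym (+-assoc (k * k + 2 * (q * R * (k * t + I x A * R))) (k * k * s) _)))
      where
      open Split (inj₁ x) (inj₂ (A , a)) hiding (a)
      α≡ : α ≡ k
      α≡ = trans (∑-cong λ z → *-identityˡ (I z A)) (block-size A)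
      β≡ : β ≡ q * R * (k * t + I x A * R)
      β≡ = begin
        ∑[ B < n ] ((∑[ c < m ] (I x B * perp A a B c)) * (∑[ z < n ] (1 * I z A * I z B)))
          ≡⟨ ∑-cong (λ B → cong₂ _*_
               (trans (sym (*-∑ˡ (I x B) (perp A a B))) (cong (I x B *_) (perp-degree A a B)))
               (∑-cong λ z → cong (_* I z B) (*-identityˡ (I z A)))) ⟩
        ∑[ B < n ] (I x B * (q * R) * meet A B)
          ≡⟨ trans (∑-cong λ B → lemma (I x B) (q * R) (meet A B))
               (sym (*-∑ˡ (q * R) (λ B → I x B * meet A B))) ⟩
        q * R * ∑[ B < n ] (I x B * meet A B)
          ≡⟨ cong (q * R *_) (∑-meet (I x) A (point-degree x)) ⟩
        q * R * (k * t + I x A * R) ∎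
        where
        lemma : ∀ i j l → i * j * l ≡ j * (i * l)
        lemma = solve-∀
      γ≡ : γ ≡ k * k * s + I x A * (p * s)
      γ≡ = begin
        ∑[ B < n ] ∑[ b < m ] (I x B * perp A a B b *
          ∑[ C < n ] ∑[ c < m ] (I x C * perp A a C c * perp B b C c))
          ≡⟨ ∑-cong (λ B → trans
               (∑-cong λ b → trans (*-∑ˡ (I x B * perp A a B b) _)
                 (∑-cong λ C → *-∑ˡ (I x B * perp A a B b) _))
               (∑-comm (λ b C → ∑[ c < m ] (I x B * perp A a B b * (I x C * perp A a C c * perp B b C c))))) ⟩
        ∑[ B < n ] ∑[ C < n ] ∑[ b < m ] ∑[ c < m ]
          (I x B * perp A a B b * (I x C * perp A a C c * perp B b C c))
          ≡⟨ ∑-cong (λ B → ∑-cong λ C → trans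
               (∑-cong λ b → trans
                 (∑-cong λ c → shuffle (I x B) (perp A a B b) (I x C) (perp A a C c) (perp B b C c))
                 (sym (*-∑ˡ (I x B * I x C) _)))
               (trans (sym (*-∑ˡ (I x B * I x C) _))
                 (trans (cong (I x B * I x C *_) (triangles+ A a B C))
                   (distribute (I x B) (I x C) s (𝟙 (A Fin.≟ B)) (𝟙 (A Fin.≟ C)) (p * s))))) ⟩
        ∑[ B < n ] ∑[ C < n ] (I x B * (I x C * s) +
          𝟙 (A Fin.≟ B) * (I x B * (𝟙 (A Fin.≟ C) * (I x C * (p * s)))))
          ≡⟨ ∑-cong (λ B → trans (∑-+ (λ C → I x B * (I x C * s)) _) (cong₂ _+_
               (trans (sym (*-∑ˡ (I x B) (λ C → I x C * s)))
                 (cong (I x B *_) (trans (sym (*-∑ʳ s (I x))) (cong (_* s) (point-degree x)))))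
               (trans (sym (*-∑ˡ (𝟙 (A Fin.≟ B)) _)) (cong (𝟙 (A Fin.≟ B) *_)
                 (trans (sym (*-∑ˡ (I x B) _)) (cong (I x B *_) (∑-δ A (λ C → I x C * (p * s))))))))) ⟩
        ∑[ B < n ] (I x B * (k * s) + 𝟙 (A Fin.≟ B) * (I x B * (I x A * (p * s))))
          ≡⟨ ∑-+ (λ B → I x B * (k * s)) _ ⟩
        ∑[ B < n ] (I x B * (k * s)) + ∑[ B < n ] (𝟙 (A Fin.≟ B) * (I x B * (I x A * (p * s))))
          ≡⟨ cong₂ _+_
               (trans (sym (*-∑ʳ (k * s) (I x))) (trans (cong (_* (k * s)) (point-degree x))
                 (sym (*-assoc k k s))))
               (trans (∑-δ A (λ B → I x B * (I x A * (p * s))))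
                 (trans (sym (*-assoc (I x A) (I x A) (p * s)))
                   (cong (_* (p * s)) (01-idem (I-01 x A))))) ⟩
        k * k * s + I x A * (p * s) ∎
        where
        shuffle : ∀ i b j c d → i * b * (j * c * d) ≡ i * j * (b * c * d)
        shuffle = solve-∀
        distribute : ∀ i j s e f r → i * j * (s + e * (f * r)) ≡
                     i * (j * s) + e * (i * (f * (j * r)))
        distribute = solve-∀

    edges-out-≢ : ∀ {A a A′ a′} → A ≢ A′ →
                  edges (inj₂ (A , a)) (inj₂ (A′ , a′)) ≡ edgeCount (perp A a A′ a′)
    edges-out-≢ {A} {a} {A′} {a′} A≢A′ = *-cancelˡ-≡ _ _ (p * p) {{pp}}
      (+-cancelʳ-≡ (2 * (R * s + p * s * 1)) _ _ (begin
        p * p * edges (inj₂ (A , a)) (inj₂ (A′ , a′)) + 2 * (R * s + p * s * 1)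
          ≡⟨ cong (λ i → p * p * i + 2 * (R * s + p * s * 1)) (trans edges-split
               (cong (_+ γ) (cong₂ (λ α β → α * α + 2 * β) (meet-≢ A≢A′) β≡))) ⟩
        p * p * (t * t + 2 * (R * t * k) + γ) + 2 * (R * s + p * s * 1)
          ≡⟨ lemma (p * p) (t * t + 2 * (R * t * k)) γ (2 * (R * s + p * s * 1)) ⟩
        p * p * (t * t + 2 * (R * t * k)) + (p * p * γ + 2 * (R * s + p * s * 1))
          ≡⟨ cong (p * p * (t * t + 2 * (R * t * k)) +_) (outer-≢ A≢A′) ⟩
        p * p * (t * t + 2 * (R * t * k)) +
          (q * R * (q * R) * s + p * s * radical q (perp A a A′ a′) + R * R)
          ≡⟨ edges-≢≡ (perp-01 A a A′ a′) ⟩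
        p * p * edgeCount (perp A a A′ a′) + 2 * (R * s + p * s * 1) ∎))
      where
      open Split (inj₂ (A , a)) (inj₂ (A′ , a′)) hiding (a)
      pp : NonZero (p * p)
      pp = m*n≢0 p p {{>-nonZero 0<p}} {{>-nonZero 0<p}}
      lemma : ∀ a b c d → a * (b + c) + d ≡ a * b + (a * c + d)
      lemma = solve-∀
      ii : Fin n → ℕ
      ii z = I z A * I z A′
      β≡ : β ≡ R * t * k
      β≡ = begin
        ∑[ B < n ] ((∑[ c < m ] (perp A a B c * perp A′ a′ B c)) * (∑[ z < n ] (ii z * I z B)))
          ≡⟨ ∑-cong (λ B → cong (_* (∑[ z < n ] (ii z * I z B))) (perp-common A≢A′ B)) ⟩
        ∑[ B < n ] (R * ∑[ z < n ] (ii z * I z B))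
          ≡⟨ *-∑ˡ R _ ⟨
        R * ∑[ B < n ] ∑[ z < n ] (ii z * I z B)
          ≡⟨ cong (R *_) (trans (∑-comm (λ B z → ii z * I z B))
               (trans (∑-cong λ z → trans (sym (*-∑ˡ (ii z) (I z))) (cong (ii z *_) (point-degree z)))
                 (trans (sym (*-∑ʳ k ii)) (cong (_* k) (meet-≢ A≢A′))))) ⟩
        R * (t * k)
          ≡⟨ *-assoc R t k ⟨
        R * t * k ∎

    edges-out-≡ : ∀ {A a a′} → a ≢ a′ →
                  edges (inj₂ (A , a)) (inj₂ (A , a′)) ≡ edgeCount (perp A a A a′)
    edges-out-≡ {A} {a} {a′} a≢a′ with g , g-count , gA , ∑g ← perp-class {A} {a} {a′} a≢a′ =
      *-cancelˡ-≡ _ _ (p * p) {{pp}}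
      (+-cancelʳ-≡ (2 * (q * R * s + p * s * radicalInU q ε)) _ _ (begin
        p * p * edges (inj₂ (A , a)) (inj₂ (A , a′)) + 2 * (q * R * s + p * s * radicalInU q ε)
          ≡⟨ cong (λ i → p * p * i + 2 * (q * R * s + p * s * radicalInU q ε)) (trans edges-split
               (cong (_+ γ) (cong₂ (λ α β → α * α + 2 * β) (meet-self A) (β≡ g g-count gA ∑g)))) ⟩
        p * p * (k * k + 2 * (q * R * (k * t + ε * R)) + γ) + 2 * (q * R * s + p * s * radicalInU q ε)
          ≡⟨ lemma (p * p) (k * k + 2 * (q * R * (k * t + ε * R))) γ _ ⟩
        p * p * (k * k + 2 * (q * R * (k * t + ε * R))) +
          (p * p * γ + 2 * (q * R * s + p * s * radicalInU q ε))
          ≡⟨ cong (p * p * (k * k + 2 * (q * R * (k * t + ε * R))) +_) (outer-≡ a≢a′) ⟩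
        p * p * (k * k + 2 * (q * R * (k * t + ε * R))) +
          (q * R * (q * R) * s + p * s * radical q ε + q * R * (q * R))
          ≡⟨ edges-≡≡ (perp-01 A a A a′) ⟩
        p * p * edgeCount ε + 2 * (q * R * s + p * s * radicalInU q ε) ∎))
      where
      open Split (inj₂ (A , a)) (inj₂ (A , a′)) hiding (a)
      ε : ℕ
      ε = perp A a A a′
      pp : NonZero (p * p)
      pp = m*n≢0 p p {{>-nonZero 0<p}} {{>-nonZero 0<p}}
      lemma : ∀ a b c d → a * (b + c) + d ≡ a * b + (a * c + d)
      lemma = solve-∀
      β≡ : ∀ (g : Fin n → ℕ) →
        (∀ B → ∑[ b < m ] (perp A a B b * perp A a′ B b) ≡ g B * (q * R)) →
        g A ≡ ε → ∑[ B < n ] g B ≡ k → β ≡ q * R * (k * t + ε * R)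
      β≡ g g-count gA ∑g = begin
        ∑[ B < n ] ((∑[ c < m ] (perp A a B c * perp A a′ B c)) * (∑[ z < n ] (I z A * I z A * I z B)))
          ≡⟨ ∑-cong (λ B → cong₂ _*_ (g-count B) (∑-cong λ z → cong (_* I z B) (01-idem (I-01 z A)))) ⟩
        ∑[ B < n ] (g B * (q * R) * meet A B)
          ≡⟨ trans (∑-cong λ B → shuffle (g B) (q * R) (meet A B))
               (sym (*-∑ˡ (q * R) (λ B → g B * meet A B))) ⟩
        q * R * ∑[ B < n ] (g B * meet A B)
          ≡⟨ cong (q * R *_) (trans (∑-meet g A ∑g) (cong (λ i → k * t + i * R) gA)) ⟩
        q * R * (k * t + ε * R) ∎
        where
        shuffle : ∀ i j l → i * j * l ≡ j * (i * l)
        shuffle = solve-∀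

    edges-constant : ∀ x y → x ≢ y → edges x y ≡ edgeCount (M x y)
    edges-constant (inj₁ x)       (inj₁ y)       x≢y = edges-in-in (x≢y ∘ cong inj₁)
    edges-constant (inj₁ x)       (inj₂ (A , a)) x≢y = edges-in-out x A a
    edges-constant (inj₂ (A , a)) (inj₁ x)       x≢y = trans
      (cong₂ _+_
        (∑-cong λ z → swap (inj₁ z))
        (∑-cong λ B → ∑-cong λ b → swap (inj₂ (B , b))))
      (edges-in-out x A a)
      where
      swap : ∀ z → M (inj₂ (A , a)) z * M (inj₁ x) z * ∑ˣ (λ w → M (inj₂ (A , a)) w * M (inj₁ x) w * M z w) ≡
                   M (inj₁ x) z * M (inj₂ (A , a)) z * ∑ˣ (λ w → M (inj₁ x) w * M (inj₂ (A , a)) w * M z w)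
      swap z = cong₂ _*_ (*-comm (M (inj₂ (A , a)) z) (M (inj₁ x) z)) (cong₂ _+_
        (∑-cong λ w → cong (_* M z (inj₁ w)) (*-comm (M (inj₂ (A , a)) (inj₁ w)) (M (inj₁ x) (inj₁ w))))
        (∑-cong λ B → ∑-cong λ b → cong (_* M z (inj₂ (B , b)))
          (*-comm (M (inj₂ (A , a)) (inj₂ (B , b))) (M (inj₁ x) (inj₂ (B , b))))))
    edges-constant (inj₂ (A , a)) (inj₂ (A′ , a′)) x≢y with A Fin.≟ A′
    ... | no A≢A′ = edges-out-≢ A≢A′
    ... | yes refl = edges-out-≡ (λ a≡a′ → x≢y (cong (λ a → inj₂ (A , a)) a≡a′))

open import Algebra.Apartness.Bundles using (HeytingField)
open import Algebra.Bundles using (CommutativeMonoid)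
open import Algebra.Module.Bundles using (Module)
import Algebra.Properties.CommutativeMonoid.Sum as MonoidSum
import Algebra.Properties.CommutativeSemigroup as CommutativeSemigroupProperties
import Algebra.Properties.Group as GroupProperties
import Algebra.Properties.Ring as RingProperties
open import Data.Fin.Base as Fin using
  (Fin; zero; suc; finToFun; funToFin; splitAt; join; remQuot; combine)
import Data.Fin.Properties as Fin
open import Data.Nat.Base as ℕ using (ℕ; zero; suc; NonZero)
import Data.Nat.Properties as ℕ
open import Data.Nat.Tactic.RingSolver using (solve-∀)
open import Data.Product.Base using (Σ; ∃-syntax; _×_; _,_; proj₁; proj₂)
open import Data.Sum.Base using (_⊎_; inj₁; inj₂)
open import Data.Unit.Base using (tt)
open import Data.Vec.Functional using (Vector; insertAt; removeAt)
import Data.Vec.Functional.Properties as Vector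
open import Function.Base using (_∘_)
open import Function.Bundles using (Inverse; Bijection)
open import Level using (_⊔_; Lift; lift; lower)
open import Relation.Binary.Bundles using (Setoid)
open import Relation.Binary.PropositionalEquality as ≡
  using (_≡_; _≢_; cong; cong₂; subst; module ≡-Reasoning)
import Relation.Binary.Reasoning.Setoid as ≈-Reasoning
open import Relation.Nullary.Decidable using (Dec; yes; no; map′; _×-dec_; ¬?)
open import Relation.Nullary.Negation using (¬_; contradiction)
open import Relation.Unary using (Pred)
import Relation.Unary as Unary
open import Defs
open Counting

module FieldProperties {c ℓ₁ ℓ₂ q} (F : FiniteField c ℓ₁ ℓ₂ q) where
  open FiniteField F
  open HeytingField heytingField using (tight; _#_; #⇒invertible)
  open RingProperties ring public using (-‿distribˡ-*; -‿distribʳ-*)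
  open GroupProperties +-group public using ()
    renaming (∙-cancelʳ to +-cancelʳ; ∙-cancelˡ to +-cancelˡ; inverseˡ-unique to +-inverseˡ-unique;
              ε⁻¹≈ε to -0≈0; ⁻¹-involutive to -‿involutive)

  infix 4 _≟_
  _≟_ : ∀ x y → Dec (x ≈ y)
  _≟_ = dec order

  reciprocal : ∀ {x} → ¬ x ≈ 0# → ∃[ y ] y * x ≈ 1#
  reciprocal {x} x≉0 with search order {P = λ y → y * x ≈ 1#}
    (λ y≈z p → trans (*-congʳ (sym y≈z)) p) (λ y → y * x ≟ 1#)
  ... | yes p = p
  ... | no ¬p = contradiction
    (proj₁ (tight x 0#) λ x#0 → let y , y*[x-0] , _ = #⇒invertible x#0 in
      ¬p (y , trans (*-congˡ (sym (trans (+-congˡ -0≈0) (+-identityʳ x)))) y*[x-0])) x≉0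

  +-shift : ∀ x b c → x + (b - c) ≈ b → x ≈ c
  +-shift x b c p = +-cancelʳ (b - c) x c (trans p (sym (shift b c)))
    where
    shift : ∀ b c → c + (b - c) ≈ b
    shift b c = trans (+-comm c (b - c)) (trans (+-assoc b (- c) c)
      (trans (+-congˡ (-‿inverseˡ c)) (+-identityʳ b)))

  +-unshift : ∀ x b c → x ≈ c → x + (b - c) ≈ b
  +-unshift x b c x≈c = trans (+-congʳ x≈c) (trans (+-comm c (b - c)) (trans (+-assoc b (- c) c)
      (trans (+-congˡ (-‿inverseˡ c)) (+-identityʳ b))))

  p : ℕ
  p = q ℕ.∸ 1

  instance
    p-nonZero : NonZero p
    p-nonZero = q∸1-nonZero

  q≡1+p : q ≡ suc p
  q≡1+p = ≡.sym (ℕ.m+[n∸m]≡n {1} {q} (1≤ q q∸1-nonZero))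
    where
    1≤ : ∀ n → NonZero (n ℕ.∸ 1) → 1 ℕ.≤ n
    1≤ (suc n) _ = ℕ.s≤s ℕ.z≤n

  q-nonZero : NonZero q
  q-nonZero = subst NonZero (≡.sym q≡1+p) _

  ∑-field-𝟙 : ∀ x → over order (λ a → 𝟙 (x ≟ a)) ≡ 1
  ∑-field-𝟙 x = ≡.trans (over-cong order λ a → ≡.sym (ℕ.*-identityʳ _))
    (over-δ order {λ _ → 1} (λ _ → ≡.refl) x)

module Linear {c ℓ₁ ℓ₂ m ℓm q} (F : FiniteField c ℓ₁ ℓ₂ q)
  (V : Module (FiniteField.commutativeRing F) m ℓm)
  (ω : Geometry.SymplecticForm F V) where

  open FiniteField F
  open FieldProperties F
  open Module V
  open Geometry F V using (Basis; module Basis)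
  open Geometry.SymplecticForm ω
  open GroupProperties +ᴹ-group public using ()
    renaming (∙-cancelʳ to +ᴹ-cancelʳ; inverseˡ-unique to +ᴹ-inverseˡ-unique)

  Respects : (Carrierᴹ → ℕ) → Set _
  Respects h = ∀ {x y} → x ≈ᴹ y → h x ≡ h y

  record Space {w} (W : Pred Carrierᴹ w) (n : ℕ) : Set (c ⊔ m ⊔ ℓm ⊔ w) where
    field
      resp     : ∀ {x y} → x ≈ᴹ y → W x → W y
      0-closed : W 0ᴹ
      +-closed : ∀ {x y} → W x → W y → W (x +ᴹ y)
      *-closed : ∀ a {x} → W x → W (a *ₗ x)
      size     : HasSize (restrict ≈ᴹ-setoid W) n

    count : (Carrierᴹ → ℕ) → ℕ
    count h = over size (h ∘ proj₁)

  a+-a : ∀ a x → a *ₗ x +ᴹ (- a) *ₗ x ≈ᴹ 0ᴹ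
  a+-a a x = ≈ᴹ-trans (≈ᴹ-sym (*ₗ-distribʳ x a (- a)))
    (≈ᴹ-trans (*ₗ-congʳ (-‿inverseʳ a)) (*ₗ-zeroˡ x))

  1+-1 : ∀ x → x +ᴹ (- 1#) *ₗ x ≈ᴹ 0ᴹ
  1+-1 x = ≈ᴹ-trans (+ᴹ-congʳ (≈ᴹ-sym (*ₗ-identityˡ x))) (a+-a 1# x)

  +ᴹ-undo : ∀ x t → (x +ᴹ t) +ᴹ (- 1#) *ₗ t ≈ᴹ x
  +ᴹ-undo x t = ≈ᴹ-trans (+ᴹ-assoc x t _) (≈ᴹ-trans (+ᴹ-congˡ (1+-1 t)) (+ᴹ-identityʳ x))

  +ᴹ-redo : ∀ x t → (x +ᴹ (- 1#) *ₗ t) +ᴹ t ≈ᴹ x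
  +ᴹ-redo x t = ≈ᴹ-trans (+ᴹ-assoc x _ t)
    (≈ᴹ-trans (+ᴹ-congˡ (≈ᴹ-trans (+ᴹ-comm _ t) (1+-1 t))) (+ᴹ-identityʳ x))

  ⟨⟩-combˡ : ∀ x a t y → ⟨ x +ᴹ a *ₗ t , y ⟩ ≈ ⟨ x , y ⟩ + a * ⟨ t , y ⟩
  ⟨⟩-combˡ x a t y = trans (⟨⟩-+ˡ x (a *ₗ t) y) (+-congˡ (⟨⟩-*ˡ a t y))

  ⟨⟩-combʳ : ∀ x a t y → ⟨ y , x +ᴹ a *ₗ t ⟩ ≈ ⟨ y , x ⟩ + a * ⟨ y , t ⟩
  ⟨⟩-combʳ x a t y = trans (⟨⟩-+ʳ y x (a *ₗ t)) (+-congˡ (⟨⟩-*ʳ a y t))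

  ⟨⟩-combˡ-0 : ∀ x a {t y} → ⟨ t , y ⟩ ≈ 0# → ⟨ x +ᴹ a *ₗ t , y ⟩ ≈ ⟨ x , y ⟩
  ⟨⟩-combˡ-0 x a {t} {y} p = trans (⟨⟩-combˡ x a t y)
    (trans (+-congˡ (trans (*-congˡ p) (zeroʳ a))) (+-identityʳ _))

  ⟨⟩-combʳ-0 : ∀ x a {t y} → ⟨ y , t ⟩ ≈ 0# → ⟨ y , x +ᴹ a *ₗ t ⟩ ≈ ⟨ y , x ⟩
  ⟨⟩-combʳ-0 x a {t} {y} p = trans (⟨⟩-combʳ x a t y)
    (trans (+-congˡ (trans (*-congˡ p) (zeroʳ a))) (+-identityʳ _))

  ⟨⟩-congˡ : ∀ {x x′} y → x ≈ᴹ x′ → ⟨ x , y ⟩ ≈ ⟨ x′ , y ⟩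
  ⟨⟩-congˡ y p = ⟨⟩-cong p ≈ᴹ-refl

  𝟙⟨⟩ : Carrierᴹ → Carrier → Carrierᴹ → ℕ
  𝟙⟨⟩ y b w = 𝟙 (⟨ w , y ⟩ ≟ b)

  𝟙⟨⟩-resp : ∀ y b → Respects (𝟙⟨⟩ y b)
  𝟙⟨⟩-resp y b {w} {w′} p = 𝟙-cong (⟨ w , y ⟩ ≟ b) (⟨ w′ , y ⟩ ≟ b)
    (λ h → trans (⟨⟩-congˡ y (≈ᴹ-sym p)) h) (λ h → trans (⟨⟩-congˡ y p) h)

  𝟙⟨⟩-fixed : ∀ y b {t} → ⟨ t , y ⟩ ≈ 0# → ∀ a w → 𝟙⟨⟩ y b (w +ᴹ a *ₗ t) ≡ 𝟙⟨⟩ y b w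
  𝟙⟨⟩-fixed y b {t} p a w = 𝟙-cong (⟨ w +ᴹ a *ₗ t , y ⟩ ≟ b) (⟨ w , y ⟩ ≟ b)
    (λ h → trans (sym (⟨⟩-combˡ-0 w a p)) h) (λ h → trans (⟨⟩-combˡ-0 w a p) h)

  module OnSpace {w} {W : Pred Carrierᴹ w} {n} (S : Space W n) where
    open Space S

    translation : ∀ {t} → W t → Inverse (restrict ≈ᴹ-setoid W) (restrict ≈ᴹ-setoid W)
    translation {t} t∈W = record
      { to        = λ (x , x∈W) → x +ᴹ t , +-closed x∈W t∈W
      ; from      = λ (x , x∈W) → x +ᴹ (- 1#) *ₗ t , +-closed x∈W (*-closed (- 1#) t∈W)
      ; to-cong   = +ᴹ-congʳ
      ; from-cong = +ᴹ-congʳ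
      ; inverse   = (λ {x} {y} p → ≈ᴹ-trans (+ᴹ-congʳ p) (+ᴹ-redo (proj₁ x) t))
                  , (λ {x} {y} p → ≈ᴹ-trans (+ᴹ-congʳ p) (+ᴹ-undo (proj₁ x) t))
      }

    count-translate : ∀ {h t} → Respects h → W t → count h ≡ count (λ w → h (w +ᴹ t))
    count-translate h-resp t∈W = over-inverse size size (translation t∈W) h-resp

    -- Translation by multiples of t permutes the fibres of ⟨_, y⟩.
    fibre : ∀ {h t y} → Respects h → W t → ⟨ t , y ⟩ ≈ 1# →
            (∀ a w → h (w +ᴹ a *ₗ t) ≡ h w) → ∀ b →
            q ℕ.* count (λ w → h w ℕ.* 𝟙⟨⟩ y b w) ≡ count h
    fibre {h} {t} {y} h-resp t∈W ty≈1 h-fixed b = begin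
      q ℕ.* N b                                                  ≡⟨ over-const order (N b) ⟨
      over order (λ _ → N b)                                     ≡⟨ over-cong order same ⟩
      over order N                                               ≡⟨ over-comm order size _ ⟩
      count (λ w → over order (λ a → h w ℕ.* 𝟙 (⟨ w , y ⟩ ≟ a)))
        ≡⟨ over-cong size (λ w → ≡.trans (≡.sym (*-overˡ order (h (proj₁ w)) _))
             (≡.trans (cong (h (proj₁ w) ℕ.*_) (∑-field-𝟙 _)) (ℕ.*-identityʳ _))) ⟩
      count h                                                    ∎
      where
      open ≡-Reasoning
      N : Carrier → ℕ
      N a = count (λ w → h w ℕ.* 𝟙⟨⟩ y a w)
      same : ∀ a → N b ≡ N a
      same a = ≡.sym (≡.trans
        (count-translate (λ {x} {z} p → cong₂ ℕ._*_ (h-resp p) (𝟙⟨⟩-resp y a p))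
          (*-closed (a - b) t∈W))
        (over-cong size λ (w , _) → cong₂ ℕ._*_ (h-fixed (a - b) w)
          (𝟙-cong (⟨ w +ᴹ (a - b) *ₗ t , y ⟩ ≟ a) (⟨ w , y ⟩ ≟ b)
            (λ p → +-shift _ a b (trans (sym (shifted w)) p))
            (λ p → trans (shifted w) (+-unshift _ a b p)))))
        where
        shifted : ∀ w → ⟨ w +ᴹ (a - b) *ₗ t , y ⟩ ≈ ⟨ w , y ⟩ + (a - b)
        shifted w = trans (⟨⟩-combˡ w (a - b) t y)
          (+-congˡ (trans (*-congˡ ty≈1) (*-identityʳ (a - b))))

    Perp : Carrierᴹ → Set _
    Perp y = ∀ w → W w → ⟨ w , y ⟩ ≈ 0#

    private
      findUnit : ∀ {ℓ} (P : Pred Carrierᴹ ℓ) → (∀ {x y} → x ≈ᴹ y → P x → P y) →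
        (∀ a {x} → P x → P (a *ₗ x)) → (∀ x → Dec (P x)) → ∀ y →
        (∃[ t ] W t × P t × ⟨ t , y ⟩ ≈ 1#) ⊎ (∀ w → W w → P w → ⟨ w , y ⟩ ≈ 0#)
      findUnit P P-resp P-* P? y
        with search size {P = λ w → P (proj₁ w) × ¬ ⟨ proj₁ w , y ⟩ ≈ 0#}
          (λ x≈y (px , n) → P-resp x≈y px , λ h → n (trans (⟨⟩-congˡ y x≈y) h))
          (λ w → P? (proj₁ w) ×-dec ¬? (⟨ proj₁ w , y ⟩ ≟ 0#))
      ... | yes ((t , t∈W) , pt , n) with a , a≈ ← reciprocal n =
        inj₁ (a *ₗ t , *-closed a t∈W , P-* a pt , trans (⟨⟩-*ˡ a t y) a≈)
      ... | no ¬found = inj₂ λ w w∈W pw → decide w w∈W pw (⟨ w , y ⟩ ≟ 0#)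
        where
        decide : ∀ w → W w → P w → Dec (⟨ w , y ⟩ ≈ 0#) → ⟨ w , y ⟩ ≈ 0#
        decide w w∈W pw (yes h) = h
        decide w w∈W pw (no ¬h) = contradiction ((w , w∈W) , pw , ¬h) ¬found

      ⟨⟩≈0-resp : ∀ y {x x′} → x ≈ᴹ x′ → ⟨ x , y ⟩ ≈ 0# → ⟨ x′ , y ⟩ ≈ 0#
      ⟨⟩≈0-resp y p h = trans (⟨⟩-congˡ y (≈ᴹ-sym p)) h

      ⟨⟩≈0-* : ∀ y a {x} → ⟨ x , y ⟩ ≈ 0# → ⟨ a *ₗ x , y ⟩ ≈ 0#
      ⟨⟩≈0-* y a {x} h = trans (⟨⟩-*ˡ a x y) (trans (*-congˡ h) (zeroʳ a))

    unit₁ : ∀ y → (∃[ t ] W t × ⟨ t , y ⟩ ≈ 1#) ⊎ Perp y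
    unit₁ y with findUnit (λ _ → 0# ≈ 0#) (λ _ _ → refl) (λ _ _ → refl) (λ _ → yes refl) y
    ... | inj₁ (t , t∈W , _ , ty) = inj₁ (t , t∈W , ty)
    ... | inj₂ h                  = inj₂ λ w w∈W → h w w∈W refl

    perp? : ∀ y → Dec (Perp y)
    perp? y with unit₁ y
    ... | inj₁ (t , t∈W , ty) = no λ h → 0≉1 (trans (sym (h t t∈W)) ty)
    ... | inj₂ h              = yes h

    private
      project : ∀ w {t y} → ⟨ t , y ⟩ ≈ 1# → ⟨ w +ᴹ (- ⟨ w , y ⟩) *ₗ t , y ⟩ ≈ 0#
      project w {t} {y} ty = trans (⟨⟩-combˡ w (- ⟨ w , y ⟩) t y)
        (trans (+-congˡ (trans (*-congˡ ty) (*-identityʳ _))) (-‿inverseʳ _))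

      exchange : ∀ w t y z → ⟨ w , z +ᴹ (- ⟨ t , z ⟩) *ₗ y ⟩ ≈ ⟨ w +ᴹ (- ⟨ w , y ⟩) *ₗ t , z ⟩
      exchange w t y z = trans (⟨⟩-combʳ z _ y w) (trans (+-congˡ (trans
        (sym (-‿distribˡ-* ⟨ t , z ⟩ ⟨ w , y ⟩))
        (trans (-‿cong (*-comm ⟨ t , z ⟩ ⟨ w , y ⟩)) (-‿distribˡ-* ⟨ w , y ⟩ ⟨ t , z ⟩))))
        (sym (⟨⟩-combˡ w _ t z)))

    unit₂ : ∀ {t₁ y₁} → W t₁ → ⟨ t₁ , y₁ ⟩ ≈ 1# → ∀ y₂ →
            (∃[ t ] W t × ⟨ t , y₁ ⟩ ≈ 0# × ⟨ t , y₂ ⟩ ≈ 1#) ⊎ (∃[ a ] Perp (y₂ +ᴹ a *ₗ y₁))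
    unit₂ {t₁} {y₁} t₁∈W t₁y₁ y₂
      with findUnit (λ w → ⟨ w , y₁ ⟩ ≈ 0#) (⟨⟩≈0-resp y₁) (⟨⟩≈0-* y₁) (λ w → ⟨ w , y₁ ⟩ ≟ 0#) y₂
    ... | inj₁ found = inj₁ found
    ... | inj₂ h     = inj₂ (- ⟨ t₁ , y₂ ⟩ , λ w w∈W → trans (exchange w t₁ y₁ y₂)
      (h _ (+-closed w∈W (*-closed _ t₁∈W)) (project w t₁y₁)))

    unit₃ : ∀ {t₁ t₂ y₁ y₂} → W t₁ → W t₂ → ⟨ t₁ , y₁ ⟩ ≈ 1# → ⟨ t₂ , y₁ ⟩ ≈ 0# → ⟨ t₂ , y₂ ⟩ ≈ 1# →
            ∀ y₃ → (∃[ t ] W t × (⟨ t , y₁ ⟩ ≈ 0# × ⟨ t , y₂ ⟩ ≈ 0#) × ⟨ t , y₃ ⟩ ≈ 1#) ⊎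
                   (∃[ a ] ∃[ b ] Perp ((y₃ +ᴹ a *ₗ y₂) +ᴹ b *ₗ y₁))
    unit₃ {t₁} {t₂} {y₁} {y₂} t₁∈W t₂∈W t₁y₁ t₂y₁ t₂y₂ y₃
      with findUnit (λ w → ⟨ w , y₁ ⟩ ≈ 0# × ⟨ w , y₂ ⟩ ≈ 0#)
        (λ p (h , h′) → ⟨⟩≈0-resp y₁ p h , ⟨⟩≈0-resp y₂ p h′)
        (λ a (h , h′) → ⟨⟩≈0-* y₁ a h , ⟨⟩≈0-* y₂ a h′)
        (λ w → (⟨ w , y₁ ⟩ ≟ 0#) ×-dec (⟨ w , y₂ ⟩ ≟ 0#)) y₃
    ... | inj₁ found = inj₁ found
    ... | inj₂ h     = inj₂ (- ⟨ t₂ , y₃ ⟩ , - ⟨ t₁ , z ⟩ , λ w w∈W →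
      let w′    = w +ᴹ (- ⟨ w , y₁ ⟩) *ₗ t₁
          w′∈W  = +-closed w∈W (*-closed _ t₁∈W)
      in trans (exchange w t₁ y₁ z) (trans (exchange w′ t₂ y₂ y₃)
        (h _ (+-closed w′∈W (*-closed _ t₂∈W))
          (trans (⟨⟩-combˡ-0 w′ _ t₂y₁) (project w t₁y₁) , project w′ t₂y₂))))
      where
      z : Carrierᴹ
      z = y₃ +ᴹ (- ⟨ t₂ , y₃ ⟩) *ₗ y₂

    count-const : ∀ b → count (λ _ → b) ≡ n ℕ.* b
    count-const = over-const size

    fibres₁ : ∀ {y} → ¬ Perp y → ∀ b → q ℕ.* count (𝟙⟨⟩ y b) ≡ n
    fibres₁ {y} ¬perp b with unit₁ y
    ... | inj₂ perp = contradiction perp ¬perp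
    ... | inj₁ (t , t∈W , ty) = begin
      q ℕ.* count (𝟙⟨⟩ y b)                  ≡⟨ cong (q ℕ.*_) (over-cong size λ _ → ℕ.*-identityˡ _) ⟨
      q ℕ.* count (λ w → 1 ℕ.* 𝟙⟨⟩ y b w)    ≡⟨ fibre (λ _ → ≡.refl) t∈W ty (λ _ _ → ≡.refl) b ⟩
      count (λ _ → 1)                        ≡⟨ count-const 1 ⟩
      n ℕ.* 1                                ≡⟨ ℕ.*-identityʳ n ⟩
      n                                      ∎
      where open ≡-Reasoning

    fibres₂ : ∀ {y₁ y₂} → ¬ Perp y₁ → (∀ a → ¬ Perp (y₂ +ᴹ a *ₗ y₁)) → ∀ b₁ b₂ →
              q ℕ.* (q ℕ.* count (λ w → 𝟙⟨⟩ y₁ b₁ w ℕ.* 𝟙⟨⟩ y₂ b₂ w)) ≡ n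
    fibres₂ {y₁} {y₂} ¬perp₁ ¬perp₂ b₁ b₂ with unit₁ y₁
    ... | inj₂ perp = contradiction perp ¬perp₁
    ... | inj₁ (t₁ , t₁∈W , t₁y₁) with unit₂ t₁∈W t₁y₁ y₂
    ... | inj₂ (a , perp) = contradiction perp (¬perp₂ a)
    ... | inj₁ (t₂ , t₂∈W , t₂y₁ , t₂y₂) = ≡.trans
      (cong (q ℕ.*_) (fibre (𝟙⟨⟩-resp y₁ b₁) t₂∈W t₂y₂ (𝟙⟨⟩-fixed y₁ b₁ t₂y₁) b₂))
      (fibres₁ ¬perp₁ b₁)

    fibres₃ : ∀ {y₁ y₂ y₃} → ¬ Perp y₁ → (∀ a → ¬ Perp (y₂ +ᴹ a *ₗ y₁)) →
              (∀ a b → ¬ Perp ((y₃ +ᴹ a *ₗ y₂) +ᴹ b *ₗ y₁)) → ∀ b₁ b₂ b₃ →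
              q ℕ.* (q ℕ.* (q ℕ.* count (λ w → 𝟙⟨⟩ y₁ b₁ w ℕ.* 𝟙⟨⟩ y₂ b₂ w ℕ.* 𝟙⟨⟩ y₃ b₃ w))) ≡ n
    fibres₃ {y₁} {y₂} {y₃} ¬perp₁ ¬perp₂ ¬perp₃ b₁ b₂ b₃ with unit₁ y₁
    ... | inj₂ perp = contradiction perp ¬perp₁
    ... | inj₁ (t₁ , t₁∈W , t₁y₁) with unit₂ t₁∈W t₁y₁ y₂
    ... | inj₂ (a , perp) = contradiction perp (¬perp₂ a)
    ... | inj₁ (t₂ , t₂∈W , t₂y₁ , t₂y₂) with unit₃ t₁∈W t₂∈W t₁y₁ t₂y₁ t₂y₂ y₃
    ... | inj₂ (a , b , perp) = contradiction perp (¬perp₃ a b)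
    ... | inj₁ (t₃ , t₃∈W , (t₃y₁ , t₃y₂) , t₃y₃) = ≡.trans
      (cong (λ i → q ℕ.* (q ℕ.* i)) (fibre
        (λ p → cong₂ ℕ._*_ (𝟙⟨⟩-resp y₁ b₁ p) (𝟙⟨⟩-resp y₂ b₂ p)) t₃∈W t₃y₃
        (λ a w → cong₂ ℕ._*_ (𝟙⟨⟩-fixed y₁ b₁ t₃y₁ a w) (𝟙⟨⟩-fixed y₂ b₂ t₃y₂ a w)) b₃))
      (fibres₂ ¬perp₁ ¬perp₂ b₁ b₂)

    fibres-perp : ∀ {y} → Perp y → count (𝟙⟨⟩ y 0#) ≡ n
    fibres-perp {y} perp = ≡.trans (over-cong size λ (w , w∈W) → 𝟙-yes (⟨ w , y ⟩ ≟ 0#) (perp w w∈W))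
      (≡.trans (count-const 1) (ℕ.*-identityʳ n))

    fibres+ : ∀ y → q ℕ.* count (𝟙⟨⟩ y 0#) ≡ n ℕ.+ p ℕ.* (n ℕ.* 𝟙 (perp? y))
    fibres+ y with perp? y
    ... | yes perp = ≡.trans (cong₂ ℕ._*_ q≡1+p (fibres-perp perp))
      (cong (λ i → n ℕ.+ p ℕ.* i) (≡.sym (ℕ.*-identityʳ n)))
    ... | no ¬perp = ≡.trans (fibres₁ ¬perp 0#)
      (≡.sym (≡.trans (cong (λ i → n ℕ.+ p ℕ.* i) (ℕ.*-zeroʳ n))
        (≡.trans (cong (n ℕ.+_) (ℕ.*-zeroʳ p)) (ℕ.+-identityʳ n))))

funToFin-cong : ∀ {m n} {f g : Fin m → Fin n} → (∀ i → f i ≡ g i) → funToFin f ≡ funToFin g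
funToFin-cong {zero}  f≗g = ≡.refl
funToFin-cong {suc m} f≗g = cong₂ Fin.combine (f≗g zero) (funToFin-cong (f≗g ∘ suc))

module LinearSpaces {c ℓ₁ ℓ₂ m ℓm q} (F : FiniteField c ℓ₁ ℓ₂ q)
  (V : Module (FiniteField.commutativeRing F) m ℓm)
  (ω : Geometry.SymplecticForm F V) where

  open FiniteField F hiding (zero)
  open FieldProperties F
  open Module V
  open Geometry F V using (Basis; module Basis)
  open Geometry.SymplecticForm ω
  open Linear F V ω
  open MonoidSum +ᴹ-commutativeMonoid using (sum; sum-remove; sum-cong-≋)
  open Space

  open CommutativeSemigroupProperties
    (CommutativeMonoid.commutativeSemigroup +ᴹ-commutativeMonoid) using (interchange)

  infix 8 _⊙_
  _⊙_ : ∀ {k} → Vector Carrier k → Vector Carrierᴹ k → Carrierᴹ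
  a ⊙ v = sum (λ i → a i *ₗ v i)

  ⊙-+* : ∀ {k} (a : Vector Carrier k) s b (v : Vector Carrierᴹ k) → a ⊙ v +ᴹ s *ₗ (b ⊙ v) ≈ᴹ (λ i → a i + s * b i) ⊙ v
  ⊙-+* {zero}  a s b v = ≈ᴹ-trans (+ᴹ-identityˡ _) (*ₗ-zeroʳ s)
  ⊙-+* {suc k} a s b v = begin
    (a₀v₀ +ᴹ av) +ᴹ s *ₗ (b zero *ₗ v zero +ᴹ bv)
      ≈⟨ +ᴹ-congˡ (≈ᴹ-trans (*ₗ-distribˡ s _ _) (+ᴹ-congʳ (≈ᴹ-sym (*ₗ-assoc s (b zero) (v zero))))) ⟩
    (a₀v₀ +ᴹ av) +ᴹ ((s * b zero) *ₗ v zero +ᴹ s *ₗ bv)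
      ≈⟨ interchange a₀v₀ av _ _ ⟩
    (a₀v₀ +ᴹ (s * b zero) *ₗ v zero) +ᴹ (av +ᴹ s *ₗ bv)
      ≈⟨ +ᴹ-cong (≈ᴹ-sym (*ₗ-distribʳ (v zero) (a zero) (s * b zero))) (⊙-+* (a ∘ suc) s (b ∘ suc) (v ∘ suc)) ⟩
    (a zero + s * b zero) *ₗ v zero +ᴹ (λ i → a (suc i) + s * b (suc i)) ⊙ (v ∘ suc) ∎
    where
    open ≈-Reasoning ≈ᴹ-setoid
    a₀v₀ = a zero *ₗ v zero
    av = (a ∘ suc) ⊙ (v ∘ suc)
    bv = (b ∘ suc) ⊙ (v ∘ suc)

  ⟨⊙⟩ : ∀ {k} (a : Vector Carrier k) v y → (∀ i → ⟨ v i , y ⟩ ≈ 0#) → ⟨ a ⊙ v , y ⟩ ≈ 0#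
  ⟨⊙⟩ {zero}  a v y h = trans (⟨⟩-congˡ y (≈ᴹ-sym (*ₗ-zeroˡ 0ᴹ))) (trans (⟨⟩-*ˡ 0# 0ᴹ y) (zeroˡ _))
  ⟨⊙⟩ {suc k} a v y h = trans (⟨⟩-+ˡ _ _ y) (trans (+-cong
    (trans (⟨⟩-*ˡ (a zero) (v zero) y) (trans (*-congˡ (h zero)) (zeroʳ _)))
    (⟨⊙⟩ (a ∘ suc) (v ∘ suc) y (h ∘ suc))) (+-identityˡ 0#))

  x+-1y≈0⇒x≈y : ∀ x y → x + - 1# * y ≈ 0# → x ≈ y
  x+-1y≈0⇒x≈y x y p = trans (+-inverseˡ-unique x _ p)
    (trans (-‿cong (trans (sym (-‿distribˡ-* 1# y)) (-‿cong (*-identityˡ y)))) (-‿involutive y))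

  module _ {w} {W : Pred Carrierᴹ w} (W-resp : ∀ {x y} → x ≈ᴹ y → W x → W y) (0∈W : W 0ᴹ)
    (W-+ : ∀ {x y} → W x → W y → W (x +ᴹ y)) (W-* : ∀ a {x} → W x → W (a *ₗ x))
    {k} (B : Basis W k) where
    open Basis B

    ⊙-closed : ∀ {k} (a : Vector Carrier k) v → (∀ i → W (v i)) → W (a ⊙ v)
    ⊙-closed {zero}  a v h = 0∈W
    ⊙-closed {suc k} a v h = W-+ (W-* (a zero) (h zero)) (⊙-closed (a ∘ suc) (v ∘ suc) (h ∘ suc))

    private
      coords : Fin (q ℕ.^ k) → Vector Carrier k
      coords j i = Inverse.from order (finToFun j i)

      vector : Fin (q ℕ.^ k) → Σ Carrierᴹ W
      vector j = coords j ⊙ basis , ⊙-closed (coords j) basis basis∈W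

      vector-injective : ∀ {i j} → proj₁ (vector i) ≈ᴹ proj₁ (vector j) → i ≡ j
      vector-injective {i} {j} p = begin
        i                                ≡⟨ Fin.funToFin-finToFin {k} {q} i ⟨
        funToFin (finToFun {q} {k} i)    ≡⟨ funToFin-cong same ⟩
        funToFin (finToFun {q} {k} j)    ≡⟨ Fin.funToFin-finToFin {k} {q} j ⟩
        j                                ∎
        where
        open ≡-Reasoning
        same : ∀ l → finToFun {q} {k} i l ≡ finToFun j l
        same l = from-injective order (x+-1y≈0⇒x≈y _ _ (independent _
          (≈ᴹ-trans (≈ᴹ-sym (⊙-+* (coords i) (- 1#) (coords j) basis))
            (≈ᴹ-trans (+ᴹ-congʳ p) (1+-1 _))) l))

      vector-surjective : ∀ (x : Σ Carrierᴹ W) → ∃[ j ] proj₁ (vector j) ≈ᴹ proj₁ x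
      vector-surjective (x , x∈W) with a , x≈ ← spanning x∈W =
        funToFin (Inverse.to order ∘ a) , ≈ᴹ-trans (sum-cong-≋ λ i → *ₗ-congʳ
          (trans (Inverse.from-cong order (Fin.finToFun-funToFin (Inverse.to order ∘ a) i))
            (Inverse.strictlyInverseʳ order (a i)))) (≈ᴹ-sym x≈)

    basisSpace : Space W (q ℕ.^ k)
    basisSpace = record
      { resp     = W-resp
      ; 0-closed = 0∈W
      ; +-closed = W-+
      ; *-closed = W-*
      ; size     = enumerated (restrict ≈ᴹ-setoid W) vector vector-injective vector-surjective
      }

  module _ {w} {W : Pred Carrierᴹ w} (W-+ : ∀ {x y} → W x → W y → W (x +ᴹ y))
    (W-* : ∀ a {x} → W x → W (a *ₗ x)) {k} (B : Basis W (suc k)) where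
    open Basis B

    -- A basis vector outside the kernel of ⟨_, y⟩ is used to move the others
    -- into the kernel.
    kernelBasis : ∀ {y} → ¬ (∀ w → W w → ⟨ w , y ⟩ ≈ 0#) → Basis (λ x → W x × ⟨ x , y ⟩ ≈ 0#) k
    kernelBasis {y} ¬perp with Fin.any? (λ i → ¬? (⟨ basis i , y ⟩ ≟ 0#))
    ... | no ¬any = contradiction (λ w w∈W → let a , w≈ = spanning w∈W in
            trans (⟨⟩-congˡ y w≈) (⟨⊙⟩ a basis y λ i → decide (⟨ basis i , y ⟩ ≟ 0#) λ n → ¬any (i , n))) ¬perp
      where
      decide : ∀ {a} {A : Set a} → Dec A → ¬ ¬ A → A
      decide (yes x) _ = x
      decide (no ¬x) h = contradiction ¬x h
    ... | yes (i , n) with r , r≈ ← reciprocal n = record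
      { basis       = b′
      ; basis∈W     = λ j → W-+ (basis∈W _) (W-* _ (basis∈W i)) , b′-perp j
      ; spanning    = λ {x} (x∈W , xy) → let a , x≈ = spanning x∈W in
          removeAt a i , span xy a x≈
      ; independent = indep
      }
      where
      rest : Vector Carrierᴹ k
      rest = removeAt basis i
      s : Vector Carrier k
      s j = - (⟨ rest j , y ⟩ * r)
      b′ : Vector Carrierᴹ k
      b′ j = rest j +ᴹ s j *ₗ basis i
      b′-perp : ∀ j → ⟨ b′ j , y ⟩ ≈ 0#
      b′-perp j = trans (⟨⟩-combˡ (rest j) (s j) (basis i) y) (trans
        (+-congˡ (trans (sym (-‿distribˡ-* _ _)) (-‿cong (trans (*-assoc _ r _)
          (trans (*-congˡ r≈) (*-identityʳ _)))))) (-‿inverseʳ _))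
      collect : ∀ {k} (a : Vector Carrier k) (v : Vector Carrierᴹ k) (s : Vector Carrier k) (u : Carrierᴹ) →
                ∃[ σ ] a ⊙ (λ j → v j +ᴹ s j *ₗ u) ≈ᴹ a ⊙ v +ᴹ σ *ₗ u
      collect {zero}  a v s u = 0# , ≈ᴹ-sym (≈ᴹ-trans (+ᴹ-identityˡ _) (*ₗ-zeroˡ u))
      collect {suc k} a v s u with σ , p ← collect (a ∘ suc) (v ∘ suc) (s ∘ suc) u =
        a zero * s zero + σ , (begin
          a zero *ₗ (v zero +ᴹ s zero *ₗ u) +ᴹ (a ∘ suc) ⊙ (λ j → v (suc j) +ᴹ s (suc j) *ₗ u)
            ≈⟨ +ᴹ-cong (≈ᴹ-trans (*ₗ-distribˡ _ _ _) (+ᴹ-congˡ (≈ᴹ-sym (*ₗ-assoc _ _ u)))) p ⟩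
          (a zero *ₗ v zero +ᴹ (a zero * s zero) *ₗ u) +ᴹ ((a ∘ suc) ⊙ (v ∘ suc) +ᴹ σ *ₗ u)
            ≈⟨ interchange _ _ _ _ ⟩
          (a zero *ₗ v zero +ᴹ (a ∘ suc) ⊙ (v ∘ suc)) +ᴹ ((a zero * s zero) *ₗ u +ᴹ σ *ₗ u)
            ≈⟨ +ᴹ-congˡ (≈ᴹ-sym (*ₗ-distribʳ u _ _)) ⟩
          (a zero *ₗ v zero +ᴹ (a ∘ suc) ⊙ (v ∘ suc)) +ᴹ (a zero * s zero + σ) *ₗ u ∎)
        where
        open ≈-Reasoning ≈ᴹ-setoid
      split : ∀ (a : Vector Carrier (suc k)) → a ⊙ basis ≈ᴹ removeAt a i ⊙ rest +ᴹ a i *ₗ basis i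
      split a = ≈ᴹ-trans (sum-remove {i = i} (λ j → a j *ₗ basis j)) (+ᴹ-comm _ _)
      span : ∀ {x} → ⟨ x , y ⟩ ≈ 0# → ∀ a → x ≈ᴹ a ⊙ basis → x ≈ᴹ removeAt a i ⊙ b′
      span {x} xy a x≈ with σ , p ← collect (removeAt a i) rest s (basis i) =
        ≈ᴹ-trans x≈c (≈ᴹ-trans (+ᴹ-congˡ (≈ᴹ-trans (*ₗ-congʳ ρ≈0) (*ₗ-zeroˡ _))) (+ᴹ-identityʳ _))
        where
        ρ : Carrier
        ρ = a i - σ
        σ+ρ : σ + ρ ≈ a i
        σ+ρ = trans (+-comm σ ρ) (trans (+-assoc (a i) (- σ) σ)
          (trans (+-congˡ (-‿inverseˡ σ)) (+-identityʳ (a i))))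
        x≈c : x ≈ᴹ removeAt a i ⊙ b′ +ᴹ ρ *ₗ basis i
        x≈c = ≈ᴹ-trans x≈ (≈ᴹ-trans (split a) (≈ᴹ-sym (≈ᴹ-trans (+ᴹ-congʳ p)
          (≈ᴹ-trans (+ᴹ-assoc _ _ _) (+ᴹ-congˡ (≈ᴹ-trans (≈ᴹ-sym (*ₗ-distribʳ (basis i) σ ρ))
            (*ₗ-congʳ σ+ρ)))))))
        ρ⟨⟩≈0 : ρ * ⟨ basis i , y ⟩ ≈ 0#
        ρ⟨⟩≈0 = trans (sym (trans (⟨⟩-combˡ _ ρ (basis i) y)
          (trans (+-congʳ (⟨⊙⟩ (removeAt a i) b′ y b′-perp)) (+-identityˡ _))))
          (trans (⟨⟩-congˡ y (≈ᴹ-sym x≈c)) xy)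
        ρ≈0 : ρ ≈ 0#
        ρ≈0 = trans (sym (*-identityʳ ρ)) (trans (*-congˡ (trans (sym r≈) (*-comm r _)))
          (trans (sym (*-assoc ρ _ r)) (trans (*-congʳ ρ⟨⟩≈0) (zeroˡ r))))
      indep : ∀ (a : Vector Carrier k) → a ⊙ b′ ≈ᴹ 0ᴹ → ∀ j → a j ≈ 0#
      indep a h j with σ , p ← collect a rest s (basis i) =
        trans (reflexive (≡.sym (Vector.insertAt-punchIn a i σ j)))
          (independent (insertAt a i σ)
            (≈ᴹ-trans (split (insertAt a i σ)) (≈ᴹ-trans
              (+ᴹ-cong
                (sum-cong-≋ λ l → *ₗ-congʳ (reflexive (Vector.insertAt-punchIn a i σ l)))
                (*ₗ-congʳ (reflexive (Vector.insertAt-lookup a i σ))))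
              (≈ᴹ-trans (≈ᴹ-sym p) h))) (Fin.punchIn i j))

module Polar {c ℓ₁ ℓ₂ m ℓm q} (F : FiniteField c ℓ₁ ℓ₂ q)
  (V : Module (FiniteField.commutativeRing F) m ℓm)
  (ω : Geometry.SymplecticForm F V)
  {N} (whole : Linear.Space F V ω Unary.U N) where

  open FiniteField F hiding (zero)
  open FieldProperties F
  open Module V
  open Geometry.SymplecticForm ω
  open Linear F V ω
  open Space
  open OnSpace

  opaque
    vectors : HasSize ≈ᴹ-setoid N
    vectors = enumerated ≈ᴹ-setoid (proj₁ ∘ Inverse.from (size whole))
      (from-injective (size whole))
      (λ x → Inverse.to (size whole) (x , tt) , Inverse.strictlyInverseʳ (size whole) (x , tt))

  countV : (Carrierᴹ → ℕ) → ℕ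
  countV = over vectors

  opaque
    unfolding vectors

    countV-whole : ∀ h → countV h ≡ count whole h
    countV-whole h = ≡.trans (over-∑ vectors h) (≡.sym (over-∑ (size whole) (h ∘ proj₁)))

  infix 4 _≟ᴹ_
  _≟ᴹ_ : ∀ x y → Dec (x ≈ᴹ y)
  _≟ᴹ_ = dec vectors

  perp-whole : ∀ {y} → Perp whole y → y ≈ᴹ 0ᴹ
  perp-whole {y} h = nondegenerate y λ x → ⟨⟩-reflexive (h x tt)

  whole-perp : ∀ {y} → y ≈ᴹ 0ᴹ → Perp whole y
  whole-perp {y} y≈0 w _ = trans (⟨⟩-cong ≈ᴹ-refl (≈ᴹ-trans y≈0 (≈ᴹ-sym (*ₗ-zeroˡ y))))
    (trans (⟨⟩-*ʳ 0# w y) (zeroˡ _))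

  module _ {w} {W : Pred Carrierᴹ w} {n} (S : Space W n) where

    member? : ∀ x → Dec (W x)
    member? = restrict-dec vectors (size S) (resp S)

    countV-member : ∀ {h} → Respects h → countV (λ x → 𝟙 (member? x) ℕ.* h x) ≡ count S h
    countV-member h-resp = over-restrict vectors member? (resp S) (size S) h-resp

    countV-size : countV (λ x → 𝟙 (member? x)) ≡ n
    countV-size = count-restrict vectors member? (resp S) (size S)

    perp-resp : ∀ {x y} → x ≈ᴹ y → Perp S x → Perp S y
    perp-resp p h w w∈W = trans (⟨⟩-cong ≈ᴹ-refl (≈ᴹ-sym p)) (h w w∈W)

    -- Count the orthogonal pairs in W × V in two ways.
    annihilator-size : n ℕ.* countV (λ y → 𝟙 (perp? S y)) ≡ N
    annihilator-size = ℕ.*-cancelˡ-≡ _ N p (ℕ.+-cancelˡ-≡ (N ℕ.* n) _ _ (begin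
      N ℕ.* n ℕ.+ p ℕ.* (n ℕ.* countV (λ y → 𝟙 (perp? S y)))
        ≡⟨ cong₂ ℕ._+_ (over-const vectors n) (≡.trans
             (≡.sym (*-overˡ vectors p (λ y → n ℕ.* 𝟙 (perp? S y))))
             (cong (p ℕ.*_) (≡.sym (*-overˡ vectors n (λ y → 𝟙 (perp? S y)))))) ⟨
      countV (λ _ → n) ℕ.+ countV (λ y → p ℕ.* (n ℕ.* 𝟙 (perp? S y)))
        ≡⟨ over-+ vectors (λ _ → n) _ ⟨
      countV (λ y → n ℕ.+ p ℕ.* (n ℕ.* 𝟙 (perp? S y)))
        ≡⟨ over-cong vectors (fibres+ S) ⟨
      countV (λ y → q ℕ.* count S (𝟙⟨⟩ y 0#))
        ≡⟨ *-overˡ vectors q _ ⟨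
      q ℕ.* countV (λ y → count S (𝟙⟨⟩ y 0#))
        ≡⟨ cong (q ℕ.*_) (over-comm vectors (size S) (λ y w → 𝟙⟨⟩ y 0# (proj₁ w))) ⟩
      q ℕ.* count S (λ w → countV (λ y → 𝟙⟨⟩ y 0# w))
        ≡⟨ *-overˡ (size S) q _ ⟩
      count S (λ w → q ℕ.* countV (λ y → 𝟙⟨⟩ y 0# w))
        ≡⟨ over-cong (size S) (λ (w , _) → cong (q ℕ.*_) (≡.trans
             (over-cong vectors λ y → 𝟙-cong (⟨ w , y ⟩ ≟ 0#) (⟨ y , w ⟩ ≟ 0#) ⟨⟩-reflexive ⟨⟩-reflexive)
             (countV-whole (𝟙⟨⟩ w 0#)))) ⟩
      count S (λ w → q ℕ.* count whole (𝟙⟨⟩ w 0#))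
        ≡⟨ over-cong (size S) (λ (w , _) → fibres+ whole w) ⟩
      count S (λ w → N ℕ.+ p ℕ.* (N ℕ.* 𝟙 (perp? whole w)))
        ≡⟨ over-+ (size S) (λ _ → N) _ ⟩
      count S (λ _ → N) ℕ.+ count S (λ w → p ℕ.* (N ℕ.* 𝟙 (perp? whole w)))
        ≡⟨ cong₂ ℕ._+_ (≡.trans (count-const S N) (ℕ.*-comm n N)) (≡.trans
             (≡.sym (*-overˡ (size S) p (λ (w , _) → N ℕ.* 𝟙 (perp? whole w))))
             (cong (p ℕ.*_) (≡.trans (≡.sym (*-overˡ (size S) N (λ (w , _) → 𝟙 (perp? whole w))))
               (≡.trans (cong (N ℕ.*_) zeros) (ℕ.*-identityʳ N))))) ⟩
      N ℕ.* n ℕ.+ p ℕ.* N ∎))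
      where
      open ≡-Reasoning
      zeros : count S (λ w → 𝟙 (perp? whole w)) ≡ 1
      zeros = ≡.trans (over-single (size S)
        (λ {(x , _)} {(y , _)} x≈y → 𝟙-cong (perp? whole x) (perp? whole y)
          (λ h → whole-perp (≈ᴹ-trans (≈ᴹ-sym x≈y) (perp-whole h)))
          (λ h → whole-perp (≈ᴹ-trans x≈y (perp-whole h))))
        (0ᴹ , 0-closed S)
        (λ (y , _) y≉0 → 𝟙-no (perp? whole y) (y≉0 ∘ perp-whole)))
        (𝟙-yes (perp? whole 0ᴹ) (whole-perp ≈ᴹ-refl))

  module Lagrangian {u} {U : Pred Carrierᴹ u} {n} (S : Space U n) (N≡ : N ≡ n ℕ.* n)
    (isotropic : ∀ x → U x → Perp S x) where

    n-nonZero : NonZero n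
    n-nonZero = ℕ.≢-nonZero λ { ≡.refl → absurd (Inverse.to (size S) (0ᴹ , 0-closed S)) }
      where
      absurd : ¬ Fin 0
      absurd ()

    infix 4 _∈U?
    _∈U? : ∀ x → Dec (U x)
    _∈U? = member? S

    𝟙-member-resp : Respects (λ x → 𝟙 (x ∈U?))
    𝟙-member-resp {x} {y} p = 𝟙-cong (x ∈U?) (y ∈U?) (resp S p) (resp S (≈ᴹ-sym p))

    perp⇒∈U : ∀ {x} → Perp S x → U x
    perp⇒∈U {x} h = 𝟙≡1⇒ (x ∈U?) (≡.trans (same x) (𝟙-yes (perp? S x) h))
      where
      open ≡-Reasoning
      instance _ = n-nonZero
      sizes : countV (λ x → 𝟙 (x ∈U?)) ≡ countV (λ x → 𝟙 (perp? S x))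
      sizes = ≡.trans (countV-size S) (ℕ.*-cancelˡ-≡ n _ n (≡.sym (≡.trans (annihilator-size S) N≡)))
      below : ∀ x → 𝟙 (x ∈U?) ℕ.≤ 𝟙 (perp? S x)
      below x with x ∈U?
      ... | yes x∈U = ℕ.≤-reflexive (≡.sym (𝟙-yes (perp? S x) (isotropic x x∈U)))
      ... | no _    = ℕ.z≤n
      same : ∀ x → 𝟙 (x ∈U?) ≡ 𝟙 (perp? S x)
      same = over-≤-≡⇒≡ vectors 𝟙-member-resp
        (λ {x} {y} p → 𝟙-cong (perp? S x) (perp? S y) (perp-resp S p) (perp-resp S (≈ᴹ-sym p)))
        below sizes

    scale∈U : ∀ {a x} → ¬ a ≈ 0# → U (a *ₗ x) → U x
    scale∈U {a} {x} a≉0 h with b , b*a≈1 ← reciprocal a≉0 =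
      resp S (≈ᴹ-trans (≈ᴹ-sym (*ₗ-assoc b a x)) (≈ᴹ-trans (*ₗ-congʳ b*a≈1) (*ₗ-identityˡ x))) (*-closed S b h)

    ∉U⇒zero : ∀ {a x} → ¬ U x → U (a *ₗ x) → a ≈ 0#
    ∉U⇒zero {a} x∉U h with a ≟ 0#
    ... | yes p = p
    ... | no p  = contradiction (scale∈U p h) x∉U

    cancel∈U : ∀ {x w} → U w → U (x +ᴹ w) → U x
    cancel∈U {x} {w} w∈U h = resp S (+ᴹ-undo x w) (+-closed S h (*-closed S (- 1#) w∈U))

    hyperplane-vector : ∀ {h′} {H : Pred Carrierᴹ h′} {k} (T : Space H k) → q ℕ.* k ≡ n →
      (∀ {x} → H x → U x) → ∃[ y ] ¬ U y × (∀ x → U x → (H x → ⟨ x , y ⟩ ≈ 0#) × (⟨ x , y ⟩ ≈ 0# → H x))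
    hyperplane-vector {H = H} {k} T qk≡n H⊆U with search vectors {P = λ y → Perp T y × ¬ U y}
      (λ p (h , n) → perp-resp T p h , λ y∈U → n (resp S (≈ᴹ-sym p) y∈U))
      (λ y → perp? T y ×-dec ¬? (y ∈U?))
    ... | no ¬found = contradiction (≡.trans (annihilator-size T) (≡.trans N≡
        (cong (n ℕ.*_) (≡.sym qk≡n)))) (ℕ.<⇒≢ (begin-strict
          k ℕ.* countV (λ y → 𝟙 (perp? T y)) ≤⟨ ℕ.*-monoʳ-≤ k (over-mono-≤ vectors below) ⟩
          k ℕ.* countV (λ y → 𝟙 (y ∈U?))     ≡⟨ cong (k ℕ.*_) (countV-size S) ⟩
          k ℕ.* n                             ≡⟨ ℕ.*-comm k n ⟩
          n ℕ.* k                             <⟨ ℕ.*-monoʳ-< n (ℕ.m<m*n k q {{k-nonZero}} 1<q) ⟩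
          n ℕ.* (k ℕ.* q)                     ≡⟨ cong (n ℕ.*_) (ℕ.*-comm k q) ⟩
          n ℕ.* (q ℕ.* k)                     ∎))
      where
      open ℕ.≤-Reasoning
      instance _ = n-nonZero
      1<q : 1 ℕ.< q
      1<q = subst (1 ℕ.<_) (≡.sym q≡1+p) (ℕ.s≤s (ℕ.>-nonZero⁻¹ p))
      k-nonZero : NonZero k
      k-nonZero = ℕ.≢-nonZero λ { ≡.refl → ℕ.≢-nonZero⁻¹ n (≡.trans (≡.sym qk≡n) (ℕ.*-zeroʳ q)) }
      below : ∀ y → 𝟙 (perp? T y) ℕ.≤ 𝟙 (y ∈U?)
      below y with perp? T y
      ... | no _  = ℕ.z≤n
      ... | yes h with y ∈U?
      ... | yes _  = ℕ.≤-refl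
      ... | no y∉U = contradiction (y , h , y∉U) ¬found
    ... | yes (y , H⊥y , y∉U) = y , y∉U , λ x x∈U → (λ x∈H → H⊥y x x∈H) , λ xy →
        𝟙≡1⇒ (member? T x) (≡.trans (same x) (cong₂ ℕ._*_ (𝟙-yes (x ∈U?) x∈U) (𝟙-yes (⟨ x , y ⟩ ≟ 0#) xy)))
      where
      instance _ = q-nonZero
      kernel : countV (λ x → 𝟙 (x ∈U?) ℕ.* 𝟙⟨⟩ y 0# x) ≡ k
      kernel = ≡.trans (countV-member S (𝟙⟨⟩-resp y 0#))
        (ℕ.*-cancelˡ-≡ _ k q (≡.trans (fibres₁ S (y∉U ∘ perp⇒∈U) 0#) (≡.sym qk≡n)))
      below : ∀ x → 𝟙 (member? T x) ℕ.≤ 𝟙 (x ∈U?) ℕ.* 𝟙⟨⟩ y 0# x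
      below x with member? T x
      ... | no _    = ℕ.z≤n
      ... | yes x∈H = ℕ.≤-reflexive (≡.sym
        (cong₂ ℕ._*_ (𝟙-yes (x ∈U?) (H⊆U x∈H)) (𝟙-yes (⟨ x , y ⟩ ≟ 0#) (H⊥y x x∈H))))
      same : ∀ x → 𝟙 (member? T x) ≡ 𝟙 (x ∈U?) ℕ.* 𝟙⟨⟩ y 0# x
      same = over-≤-≡⇒≡ vectors
        (λ {x} {z} p → 𝟙-cong (member? T x) (member? T z) (resp T p) (resp T (≈ᴹ-sym p)))
        (λ p → cong₂ ℕ._*_ (𝟙-member-resp p) (𝟙⟨⟩-resp y 0# p))
        below (≡.trans (countV-size T) (≡.sym kernel))

    same-hyperplane : ∀ {y z} → ¬ U y → (∀ x → U x → ⟨ x , y ⟩ ≈ 0# → ⟨ x , z ⟩ ≈ 0#) →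
                      ∃[ a ] U (z +ᴹ a *ₗ y)
    same-hyperplane {y} {z} y∉U h with unit₁ S y
    ... | inj₂ perp = contradiction (perp⇒∈U perp) y∉U
    ... | inj₁ (t₁ , t₁∈U , t₁y) with unit₂ S t₁∈U t₁y z
    ... | inj₁ (t , t∈U , ty , tz) = contradiction (trans (sym (h t t∈U ty)) tz) 0≉1
    ... | inj₂ (a , perp) = a , perp⇒∈U perp

module OuterVectors {c ℓ₁ ℓ₂ m ℓm q} (F : FiniteField c ℓ₁ ℓ₂ q)
  (V : Module (FiniteField.commutativeRing F) m ℓm)
  (ω : Geometry.SymplecticForm F V)
  {N} (whole : Linear.Space F V ω Unary.U N)
  {ℓᵤ} {U : Pred (Module.Carrierᴹ V) ℓᵤ} {n} (S : Linear.Space F V ω U n) (N≡ : N ≡ n ℕ.* n)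
  (isotropic : ∀ x → U x → Linear.OnSpace.Perp F V ω S x) where

  open FiniteField F hiding (zero)
  open FieldProperties F
  open Module V
  open Geometry.SymplecticForm ω
  open Linear F V ω
  open Space
  open OnSpace
  open Polar F V ω whole
  open Lagrangian S N≡ isotropic
  open CommutativeSemigroupProperties
    (CommutativeMonoid.commutativeSemigroup +ᴹ-commutativeMonoid) using (interchange)

  scale-zero : ∀ {a x} → ¬ a ≈ 0# → a *ₗ x ≈ᴹ 0ᴹ → x ≈ᴹ 0ᴹ
  scale-zero {a} {x} a≉0 h with b , b*a≈1 ← reciprocal a≉0 =
    ≈ᴹ-trans (≈ᴹ-sym (*ₗ-identityˡ x)) (≈ᴹ-trans (*ₗ-congʳ (sym b*a≈1))
      (≈ᴹ-trans (*ₗ-assoc b a x) (≈ᴹ-trans (*ₗ-congˡ h) (*ₗ-zeroʳ b))))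

  Homogeneous : (Carrierᴹ → ℕ) → Set _
  Homogeneous h = ∀ {a} → ¬ a ≈ 0# → ∀ x → h (a *ₗ x) ≡ h x

  ⟨⟩-*ˡ-zero : ∀ {a x y} → ¬ a ≈ 0# → ⟨ a *ₗ x , y ⟩ ≈ 0# → ⟨ x , y ⟩ ≈ 0#
  ⟨⟩-*ˡ-zero {a} {x} {y} a≉0 h with b , b*a≈1 ← reciprocal a≉0 =
    trans (sym (*-identityˡ _)) (trans (*-congʳ (sym b*a≈1)) (trans (*-assoc b a _)
      (trans (*-congˡ (trans (sym (⟨⟩-*ˡ a x y)) h)) (zeroʳ b))))

  𝟙⟨⟩-homogeneous : ∀ y → Homogeneous (𝟙⟨⟩ y 0#)
  𝟙⟨⟩-homogeneous y {a} a≉0 x = 𝟙-cong (⟨ a *ₗ x , y ⟩ ≟ 0#) (⟨ x , y ⟩ ≟ 0#)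
    (⟨⟩-*ˡ-zero a≉0) (λ h → trans (⟨⟩-*ˡ a x y) (trans (*-congˡ h) (zeroʳ a)))

  𝟙⟨⟩-sym : ∀ x y → 𝟙⟨⟩ x 0# y ≡ 𝟙⟨⟩ y 0# x
  𝟙⟨⟩-sym x y = 𝟙-cong (⟨ y , x ⟩ ≟ 0#) (⟨ x , y ⟩ ≟ 0#) ⟨⟩-reflexive ⟨⟩-reflexive

  translates : ∀ {v} → (Fin v → Carrierᴹ) → Fin v → Fin n → Carrierᴹ
  translates y A i = y A +ᴹ proj₁ (Inverse.from (size S) i)

  module Translates {v} (y : Fin v → Carrierᴹ) (y∉U : ∀ A → ¬ U (y A))
    (y-distinct : ∀ {A B} → A ≢ B → ∀ a → ¬ U (y B +ᴹ a *ₗ y A))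
    (cover : ∀ {x} → ¬ U x → ∃[ a ] ∃[ A ] ∃[ i ] ¬ a ≈ 0# × x ≈ᴹ a *ₗ translates y A i) where

    vec : Fin v → Fin n → Carrierᴹ
    vec = translates y

    u : Fin n → Carrierᴹ
    u i = proj₁ (Inverse.from (size S) i)

    u∈U : ∀ i → U (u i)
    u∈U i = proj₂ (Inverse.from (size S) i)

    ∑-u : ∀ h → ∑[ i < n ] h (u i) ≡ count S h
    ∑-u h = ≡.sym (over-∑ (size S) (h ∘ proj₁))

    rearrange : ∀ a b x x′ w w′ → a *ₗ (x +ᴹ w) +ᴹ b *ₗ (x′ +ᴹ w′) ≈ᴹ
                (a *ₗ x +ᴹ b *ₗ x′) +ᴹ (a *ₗ w +ᴹ b *ₗ w′)
    rearrange a b x x′ w w′ = ≈ᴹ-trans (+ᴹ-cong (*ₗ-distribˡ a x w) (*ₗ-distribˡ b x′ w′))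
      (interchange (a *ₗ x) (a *ₗ w) (b *ₗ x′) (b *ₗ w′))

    *-closed₂ : ∀ a b i j → U (a *ₗ u i +ᴹ b *ₗ u j)
    *-closed₂ a b i j = +-closed S (*-closed S a (u∈U i)) (*-closed S b (u∈U j))

    vec∉U : ∀ A i → ¬ U (vec A i)
    vec∉U A i h = y∉U A (cancel∈U (u∈U i) h)

    second-zero : ∀ {A B a b} → A ≢ B → U (a *ₗ y A +ᴹ b *ₗ y B) → b ≈ 0#
    second-zero {A} {B} {a} {b} A≢B h with b ≟ 0#
    ... | yes p = p
    ... | no p with r , r*b ← reciprocal p = contradiction
      (resp S (≈ᴹ-trans (*ₗ-distribˡ r _ _) (≈ᴹ-trans (+ᴹ-comm _ _) (+ᴹ-cong
          (≈ᴹ-trans (≈ᴹ-sym (*ₗ-assoc r b _)) (≈ᴹ-trans (*ₗ-congʳ r*b) (*ₗ-identityˡ _)))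
          (≈ᴹ-sym (*ₗ-assoc r a _)))))
        (*-closed S r h))
      (y-distinct A≢B (r * a))

    ∈U-≢ : ∀ {A B} a b i j → A ≢ B → U (a *ₗ vec A i +ᴹ b *ₗ vec B j) → a ≈ 0# × b ≈ 0#
    ∈U-≢ {A} {B} a b i j A≢B h =
      second-zero (A≢B ∘ ≡.sym) (resp S (+ᴹ-comm _ _) h′) , second-zero A≢B h′
      where
      h′ : U (a *ₗ y A +ᴹ b *ₗ y B)
      h′ = cancel∈U (*-closed₂ a b i j) (resp S (rearrange a b (y A) (y B) (u i) (u j)) h)

    same-class : ∀ {A} a b i j → a *ₗ vec A i +ᴹ b *ₗ vec A j ≈ᴹ
                 (a + b) *ₗ y A +ᴹ (a *ₗ u i +ᴹ b *ₗ u j)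
    same-class {A} a b i j = ≈ᴹ-trans (rearrange a b (y A) (y A) (u i) (u j))
      (+ᴹ-congʳ (≈ᴹ-sym (*ₗ-distribʳ (y A) a b)))

    ∈U-≡ : ∀ {A} a b i j → U (a *ₗ vec A i +ᴹ b *ₗ vec A j) → a + b ≈ 0#
    ∈U-≡ {A} a b i j h = ∉U⇒zero (y∉U A)
      (cancel∈U (*-closed₂ a b i j) (resp S (same-class a b i j) h))

    ∈U-≡′ : ∀ {A} a b i j → a + b ≈ 0# → U (a *ₗ vec A i +ᴹ b *ₗ vec A j)
    ∈U-≡′ {A} a b i j h = resp S
      (≈ᴹ-sym (≈ᴹ-trans (same-class a b i j) (≈ᴹ-trans
        (+ᴹ-congʳ (≈ᴹ-trans (*ₗ-congʳ h) (*ₗ-zeroˡ _))) (+ᴹ-identityˡ _))))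
      (*-closed₂ a b i j)

    difference : Fin n → Fin n → Carrierᴹ
    difference i j = u j +ᴹ (- 1#) *ₗ u i

    difference∈U : ∀ i j → U (difference i j)
    difference∈U i j = +-closed S (u∈U j) (*-closed S (- 1#) (u∈U i))

    difference≉0 : ∀ {i j} → i ≢ j → ¬ difference i j ≈ᴹ 0ᴹ
    difference≉0 {i} {j} i≢j h = i≢j (≡.sym (from-injective (size S)
      (≈ᴹ-trans (≈ᴹ-sym (+ᴹ-redo (u j) (u i))) (≈ᴹ-trans (+ᴹ-congʳ h) (+ᴹ-identityˡ (u i))))))

    vec-difference : ∀ A i j → vec A j ≈ᴹ vec A i +ᴹ difference i j
    vec-difference A i j = ≈ᴹ-sym (≈ᴹ-trans (+ᴹ-assoc (y A) (u i) _)
      (+ᴹ-congˡ (≈ᴹ-trans (+ᴹ-comm _ _) (+ᴹ-redo (u j) (u i)))))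

    0∈U : ∀ {x} → x ≈ᴹ 0ᴹ → U x
    0∈U p = resp S (≈ᴹ-sym p) (0-closed S)

    independent : ∀ {A i B j} a b → (A , i) ≢ (B , j) →
                  a *ₗ vec A i +ᴹ b *ₗ vec B j ≈ᴹ 0ᴹ → a ≈ 0# × b ≈ 0#
    independent {A} {i} {B} {j} a b Ai≢Bj h with A Fin.≟ B
    ... | no A≢B = ∈U-≢ a b i j A≢B (0∈U h)
    ... | yes ≡.refl = trans (sym (trans (+-congˡ b≈0) (+-identityʳ a))) a+b≈0 , b≈0
      where
      a+b≈0 : a + b ≈ 0#
      a+b≈0 = ∈U-≡ a b i j (0∈U h)
      bδ≈0 : b *ₗ difference i j ≈ᴹ 0ᴹ
      bδ≈0 = ≈ᴹ-trans (≈ᴹ-sym (+ᴹ-identityˡ _)) (≈ᴹ-trans (+ᴹ-congʳ (≈ᴹ-sym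
        (≈ᴹ-trans (*ₗ-congʳ a+b≈0) (*ₗ-zeroˡ (vec A i))))) (≈ᴹ-trans (+ᴹ-congʳ (*ₗ-distribʳ _ a b))
        (≈ᴹ-trans (+ᴹ-assoc _ _ _) (≈ᴹ-trans (+ᴹ-congˡ (≈ᴹ-trans (≈ᴹ-sym (*ₗ-distribˡ b _ _))
          (*ₗ-congˡ (≈ᴹ-sym (vec-difference A i j))))) h))))
      b≈0 : b ≈ 0#
      b≈0 with b ≟ 0#
      ... | yes p = p
      ... | no p  = contradiction (scale-zero p bδ≈0) (difference≉0 (λ i≡j → Ai≢Bj (cong (A ,_) i≡j)))

    a-b≈0⇒a≈b : ∀ {a b} → a - b ≈ 0# → a ≈ b
    a-b≈0⇒a≈b {a} {b} h = trans (+-inverseˡ-unique a (- b) h) (-‿involutive b)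

    *ₗ-difference : ∀ {a b x} → a *ₗ x ≈ᴹ b *ₗ x → (a - b) *ₗ x ≈ᴹ 0ᴹ
    *ₗ-difference {a} {b} {x} h = ≈ᴹ-trans (*ₗ-distribʳ x a (- b)) (≈ᴹ-trans (+ᴹ-congʳ h) (a+-a b x))

    scalar-unique : ∀ {a b A B i j} → ¬ a ≈ 0# → a *ₗ vec A i ≈ᴹ b *ₗ vec B j →
                    a ≈ b × (A , i) ≡ (B , j)
    scalar-unique {a} {b} {A} {B} {i} {j} a≉0 h with A Fin.≟ B | i Fin.≟ j
    ... | yes ≡.refl | yes ≡.refl =
      a-b≈0⇒a≈b (∉U⇒zero (vec∉U A i) (0∈U (*ₗ-difference h))) , ≡.refl
    ... | no A≢B | _ = contradiction (proj₁ (independent {A} {i} {B} {j} a (- b) (A≢B ∘ cong proj₁)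
      (≈ᴹ-trans (+ᴹ-congʳ h) (a+-a b _)))) a≉0
    ... | yes _ | no i≢j = contradiction (proj₁ (independent {A} {i} {B} {j} a (- b) (i≢j ∘ cong proj₂)
      (≈ᴹ-trans (+ᴹ-congʳ h) (a+-a b _)))) a≉0

    nonzeros : over order (λ a → 𝟙 (¬? (a ≟ 0#))) ≡ p
    nonzeros = ℕ.+-cancelʳ-≡ 1 _ _ (begin
      over order (λ a → 𝟙 (¬? (a ≟ 0#))) ℕ.+ 1
        ≡⟨ cong (over order (λ a → 𝟙 (¬? (a ≟ 0#))) ℕ.+_) (≡.trans
             (over-cong order λ a → 𝟙-cong (a ≟ 0#) (0# ≟ a) sym sym) (∑-field-𝟙 0#)) ⟨
      over order (λ a → 𝟙 (¬? (a ≟ 0#))) ℕ.+ over order (λ a → 𝟙 (a ≟ 0#))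
        ≡⟨ over-+ order _ _ ⟨
      over order (λ a → 𝟙 (¬? (a ≟ 0#)) ℕ.+ 𝟙 (a ≟ 0#))
        ≡⟨ over-cong order (λ a → complement (a ≟ 0#)) ⟩
      over order (λ _ → 1) ≡⟨ over-const order 1 ⟩
      q ℕ.* 1              ≡⟨ ℕ.*-identityʳ q ⟩
      q                    ≡⟨ ≡.trans q≡1+p (ℕ.+-comm 1 p) ⟩
      p ℕ.+ 1              ∎)
      where
      open ≡-Reasoning
      complement : ∀ {a} {A : Set a} (d : Dec A) → 𝟙 (¬? d) ℕ.+ 𝟙 d ≡ 1
      complement (yes _) = ≡.refl
      complement (no _)  = ≡.refl

    ∑ᴼ : (Carrierᴹ → ℕ) → ℕ
    ∑ᴼ h = ∑[ A < v ] ∑[ i < n ] h (vec A i)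

    multiples : Carrierᴹ → ℕ
    multiples x = over order (λ a → 𝟙 (¬? (a ≟ 0#)) ℕ.* ∑ᴼ (λ z → 𝟙 (x ≟ᴹ a *ₗ z)))

    multiples-∈U : ∀ {x} → U x → multiples x ≡ 0
    multiples-∈U {x} x∈U = over-zero order term
      where
      term : ∀ a → 𝟙 (¬? (a ≟ 0#)) ℕ.* ∑ᴼ (λ z → 𝟙 (x ≟ᴹ a *ₗ z)) ≡ 0
      term a with a ≟ 0#
      ... | yes _  = ≡.refl
      ... | no a≉0 = ≡.trans (ℕ.*-identityˡ _) (∑-zero λ A → ∑-zero λ i →
        𝟙-no (x ≟ᴹ a *ₗ vec A i) λ h → vec∉U A i (scale∈U a≉0 (resp S h x∈U)))

    multiples-∉U : ∀ {x} → ¬ U x → multiples x ≡ 1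
    multiples-∉U {x} x∉U with a , A , i , a≉0 , x≈ ← cover x∉U = begin
      multiples x
        ≡⟨ over-single order f-resp a (λ b b≉a → term b λ h → b≉a (sym h)) ⟩
      𝟙 (¬? (a ≟ 0#)) ℕ.* ∑ᴼ (λ z → 𝟙 (x ≟ᴹ a *ₗ z))
        ≡⟨ cong₂ ℕ._*_ (𝟙-yes (¬? (a ≟ 0#)) a≉0) single ⟩
      1 ∎
      where
      open ≡-Reasoning
      f-resp : ∀ {b b′} → b ≈ b′ → 𝟙 (¬? (b ≟ 0#)) ℕ.* ∑ᴼ (λ z → 𝟙 (x ≟ᴹ b *ₗ z)) ≡
                                    𝟙 (¬? (b′ ≟ 0#)) ℕ.* ∑ᴼ (λ z → 𝟙 (x ≟ᴹ b′ *ₗ z))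
      f-resp {b} {b′} p = cong₂ ℕ._*_
        (𝟙-cong (¬? (b ≟ 0#)) (¬? (b′ ≟ 0#)) (λ n h → n (trans p h)) (λ n h → n (trans (sym p) h)))
        (∑-cong λ B → ∑-cong λ j → 𝟙-cong (x ≟ᴹ b *ₗ vec B j) (x ≟ᴹ b′ *ₗ vec B j)
          (λ h → ≈ᴹ-trans h (*ₗ-congʳ p)) (λ h → ≈ᴹ-trans h (*ₗ-congʳ (sym p))))
      unique : ∀ {b B j} → x ≈ᴹ b *ₗ vec B j → a ≈ b × (A , i) ≡ (B , j)
      unique h = scalar-unique a≉0 (≈ᴹ-trans (≈ᴹ-sym x≈) h)
      term : ∀ b → ¬ a ≈ b → 𝟙 (¬? (b ≟ 0#)) ℕ.* ∑ᴼ (λ z → 𝟙 (x ≟ᴹ b *ₗ z)) ≡ 0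
      term b a≉b = ≡.trans (cong (𝟙 (¬? (b ≟ 0#)) ℕ.*_) (∑-zero λ B → ∑-zero λ j →
        𝟙-no (x ≟ᴹ b *ₗ vec B j) λ h → a≉b (proj₁ (unique h)))) (ℕ.*-zeroʳ (𝟙 (¬? (b ≟ 0#))))
      single : ∑ᴼ (λ z → 𝟙 (x ≟ᴹ a *ₗ z)) ≡ 1
      single = ≡.trans
        (∑-single A λ B B≢A → ∑-zero λ j → 𝟙-no (x ≟ᴹ a *ₗ vec B j) λ h →
          B≢A (≡.sym (cong proj₁ (proj₂ (unique h)))))
        (≡.trans (∑-single i λ j j≢i → 𝟙-no (x ≟ᴹ a *ₗ vec A j) λ h →
            j≢i (≡.sym (cong proj₂ (proj₂ (unique h)))))
          (𝟙-yes (x ≟ᴹ a *ₗ vec A i) x≈))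

    countV-δ : ∀ {h} → Respects h → ∀ x → countV (λ z → h z ℕ.* 𝟙 (z ≟ᴹ x)) ≡ h x
    countV-δ {h} h-resp x = ≡.trans
      (over-cong vectors λ z → ≡.trans (ℕ.*-comm (h z) _)
        (cong (ℕ._* h z) (𝟙-cong (z ≟ᴹ x) (x ≟ᴹ z) ≈ᴹ-sym ≈ᴹ-sym)))
      (over-δ vectors h-resp x)

    countV-split : ∀ {h} → Respects h → Homogeneous h → countV h ≡ count S h ℕ.+ p ℕ.* ∑ᴼ h
    countV-split {h} h-resp h-hom = begin
      countV h
        ≡⟨ over-cong vectors pointwise ⟩
      countV (λ x → 𝟙 (x ∈U?) ℕ.* h x ℕ.+ h x ℕ.* multiples x)
        ≡⟨ over-+ vectors (λ x → 𝟙 (x ∈U?) ℕ.* h x) _ ⟩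
      countV (λ x → 𝟙 (x ∈U?) ℕ.* h x) ℕ.+ countV (λ x → h x ℕ.* multiples x)
        ≡⟨ cong₂ ℕ._+_ (countV-member S h-resp) outside ⟩
      count S h ℕ.+ p ℕ.* ∑ᴼ h ∎
      where
      open ≡-Reasoning
      pointwise : ∀ x → h x ≡ 𝟙 (x ∈U?) ℕ.* h x ℕ.+ h x ℕ.* multiples x
      pointwise x with x ∈U?
      ... | yes x∈U = ≡.sym (≡.trans (cong₂ ℕ._+_ (ℕ.*-identityˡ (h x))
        (≡.trans (cong (h x ℕ.*_) (multiples-∈U x∈U)) (ℕ.*-zeroʳ (h x)))) (ℕ.+-identityʳ (h x)))
      ... | no x∉U  = ≡.sym (≡.trans (cong (h x ℕ.*_) (multiples-∉U x∉U)) (ℕ.*-identityʳ (h x)))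
      ∑ᴼ-comm : ∀ (f : Carrierᴹ → Carrierᴹ → ℕ) → countV (λ x → ∑ᴼ (f x)) ≡ ∑ᴼ (λ z → countV (λ x → f x z))
      ∑ᴼ-comm f = ≡.trans (over-∑-comm vectors (λ A x → ∑[ i < n ] f x (vec A i)))
        (∑-cong λ A → over-∑-comm vectors (λ i x → f x (vec A i)))
      *-∑ᴼ : ∀ c f → c ℕ.* ∑ᴼ f ≡ ∑ᴼ (λ z → c ℕ.* f z)
      *-∑ᴼ c f = ≡.trans (*-∑ˡ c (λ A → ∑[ i < n ] f (vec A i))) (∑-cong λ A → *-∑ˡ c (λ i → f (vec A i)))
      term : ∀ a → countV (λ x → h x ℕ.* (𝟙 (¬? (a ≟ 0#)) ℕ.* ∑ᴼ (λ z → 𝟙 (x ≟ᴹ a *ₗ z)))) ≡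
                   𝟙 (¬? (a ≟ 0#)) ℕ.* ∑ᴼ h
      term a with a ≟ 0#
      ... | yes _  = over-zero vectors (λ x → ℕ.*-zeroʳ (h x))
      ... | no a≉0 = begin
        countV (λ x → h x ℕ.* (1 ℕ.* ∑ᴼ (λ z → 𝟙 (x ≟ᴹ a *ₗ z))))
          ≡⟨ over-cong vectors (λ x → ≡.trans (cong (h x ℕ.*_) (ℕ.*-identityˡ _)) (*-∑ᴼ (h x) (λ z → 𝟙 (x ≟ᴹ a *ₗ z)))) ⟩
        countV (λ x → ∑ᴼ (λ z → h x ℕ.* 𝟙 (x ≟ᴹ a *ₗ z)))
          ≡⟨ ∑ᴼ-comm (λ x z → h x ℕ.* 𝟙 (x ≟ᴹ a *ₗ z)) ⟩
        ∑ᴼ (λ z → countV (λ x → h x ℕ.* 𝟙 (x ≟ᴹ a *ₗ z)))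
          ≡⟨ ∑-cong (λ A → ∑-cong λ i → ≡.trans (countV-δ h-resp (a *ₗ vec A i)) (h-hom a≉0 (vec A i))) ⟩
        ∑ᴼ h
          ≡⟨ ℕ.*-identityˡ _ ⟨
        1 ℕ.* ∑ᴼ h ∎
      outside : countV (λ x → h x ℕ.* multiples x) ≡ p ℕ.* ∑ᴼ h
      outside = begin
        countV (λ x → h x ℕ.* multiples x)
          ≡⟨ over-cong vectors (λ x → *-overˡ order (h x) _) ⟩
        countV (λ x → over order (λ a → h x ℕ.* (𝟙 (¬? (a ≟ 0#)) ℕ.* ∑ᴼ (λ z → 𝟙 (x ≟ᴹ a *ₗ z)))))
          ≡⟨ over-comm vectors order (λ x a → h x ℕ.* (𝟙 (¬? (a ≟ 0#)) ℕ.* ∑ᴼ (λ z → 𝟙 (x ≟ᴹ a *ₗ z)))) ⟩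
        over order (λ a → countV (λ x → h x ℕ.* (𝟙 (¬? (a ≟ 0#)) ℕ.* ∑ᴼ (λ z → 𝟙 (x ≟ᴹ a *ₗ z)))))
          ≡⟨ over-cong order term ⟩
        over order (λ a → 𝟙 (¬? (a ≟ 0#)) ℕ.* ∑ᴼ h)
          ≡⟨ *-overʳ order (∑ᴼ h) (λ a → 𝟙 (¬? (a ≟ 0#))) ⟨
        over order (λ a → 𝟙 (¬? (a ≟ 0#))) ℕ.* ∑ᴼ h
          ≡⟨ cong (ℕ._* ∑ᴼ h) nonzeros ⟩
        p ℕ.* ∑ᴼ h ∎

    perp : Fin v → Fin n → Fin v → Fin n → ℕ
    perp A i B j = 𝟙⟨⟩ (vec A i) 0# (vec B j)

    perp-01 : ∀ A i B j → perp A i B j ≡ 0 ⊎ perp A i B j ≡ 1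
    perp-01 A i B j with ⟨ vec B j , vec A i ⟩ ≟ 0#
    ... | yes _ = inj₂ ≡.refl
    ... | no _  = inj₁ ≡.refl

    ≈0-shift : ∀ {a b c} → a + b ≈ c → b ≈ - a → c ≈ 0#
    ≈0-shift {a} p q = trans (sym p) (trans (+-congˡ q) (-‿inverseʳ a))

    𝟙⟨⟩-shift : ∀ x z w → 𝟙⟨⟩ x 0# (z +ᴹ w) ≡ 𝟙⟨⟩ x (- ⟨ z , x ⟩) w
    𝟙⟨⟩-shift x z w = 𝟙-cong (⟨ z +ᴹ w , x ⟩ ≟ 0#) (⟨ w , x ⟩ ≟ - ⟨ z , x ⟩)
      (λ h → +-inverseˡ-unique ⟨ w , x ⟩ ⟨ z , x ⟩ (trans (+-comm _ _) (trans (sym (⟨⟩-+ˡ z w x)) h)))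
      (λ h → ≈0-shift (sym (⟨⟩-+ˡ z w x)) h)

    ∉U⇒¬perp : ∀ {x} → ¬ U x → ¬ Perp S x
    ∉U⇒¬perp x∉U h = x∉U (perp⇒∈U h)

    ¬perp-vec : ∀ A i → ¬ Perp S (vec A i)
    ¬perp-vec A i = ∉U⇒¬perp (vec∉U A i)

    ¬perp-vec₂ : ∀ {A B} i j → A ≢ B → ∀ a → ¬ Perp S (vec B j +ᴹ a *ₗ vec A i)
    ¬perp-vec₂ {A} {B} i j A≢B a h = 0≉1 (sym (proj₂ (∈U-≢ a 1# i j A≢B
      (resp S (≈ᴹ-trans (+ᴹ-comm _ _) (+ᴹ-congˡ (≈ᴹ-sym (*ₗ-identityˡ _)))) (perp⇒∈U h)))))

    difference-perp : ∀ {w} → U w → ∀ i j → ⟨ w , difference i j ⟩ ≈ 0#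
    difference-perp w∈U i j = isotropic _ (difference∈U i j) _ w∈U

    ⟨vec⟩-difference : ∀ A i j z → ⟨ z , vec A j ⟩ ≈ ⟨ z , vec A i ⟩ + ⟨ z , difference i j ⟩
    ⟨vec⟩-difference A i j z = trans (⟨⟩-cong ≈ᴹ-refl (vec-difference A i j))
      (⟨⟩-+ʳ z (vec A i) (difference i j))

    vec-⟨difference⟩ : ∀ B l i j → ⟨ vec B l , difference i j ⟩ ≈ ⟨ y B , difference i j ⟩
    vec-⟨difference⟩ B l i j = trans (⟨⟩-+ˡ (y B) (u l) _)
      (trans (+-congˡ (difference-perp (u∈U l) i j)) (+-identityʳ _))

    ⟨⟩-same-class : ∀ A i j → ⟨ vec A i , vec A j ⟩ ≈ ⟨ y A , difference i j ⟩
    ⟨⟩-same-class A i j = trans (⟨vec⟩-difference A i j (vec A i))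
      (trans (+-congʳ (alternating (vec A i))) (trans (+-identityˡ _) (vec-⟨difference⟩ A i i j)))

    ⟨⟩-difference : ∀ x i j → ⟨ x , difference i j ⟩ ≈ ⟨ x , u j ⟩ - ⟨ x , u i ⟩
    ⟨⟩-difference x i j = trans (⟨⟩-combʳ (u j) (- 1#) (u i) x)
      (+-congˡ (trans (sym (-‿distribˡ-* 1# _)) (-‿cong (*-identityˡ _))))

    same-class⇒ : ∀ {A i j} → ⟨ vec A j , vec A i ⟩ ≈ 0# → ⟨ y A , u j ⟩ ≈ ⟨ y A , u i ⟩
    same-class⇒ {A} {i} {j} h = a-b≈0⇒a≈b (trans (sym (⟨⟩-difference (y A) i j))
      (trans (sym (⟨⟩-same-class A i j)) (⟨⟩-reflexive h)))

    same-class⇐ : ∀ {A i j} → ⟨ y A , u j ⟩ ≈ ⟨ y A , u i ⟩ → ⟨ vec A j , vec A i ⟩ ≈ 0#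
    same-class⇐ {A} {i} {j} h = ⟨⟩-reflexive (trans (⟨⟩-same-class A i j)
      (trans (⟨⟩-difference (y A) i j) (trans (+-congʳ h) (-‿inverseʳ _))))

    perp-trans : ∀ A i j l → perp A i A j ℕ.* perp A i A l ℕ.* perp A j A l ≡ perp A i A j ℕ.* perp A i A l
    perp-trans A i j l with ⟨ vec A j , vec A i ⟩ ≟ 0# | ⟨ vec A l , vec A i ⟩ ≟ 0#
    ... | no _  | _     = ≡.refl
    ... | yes _ | no _  = ≡.refl
    ... | yes h | yes g = ≡.trans (ℕ.*-identityˡ _) (𝟙-yes (⟨ vec A l , vec A j ⟩ ≟ 0#)
      (same-class⇐ (trans (same-class⇒ g) (sym (same-class⇒ h)))))

    module _ {R t : ℕ} (n≡ : n ≡ q ℕ.* (q ℕ.* R)) (R≡ : R ≡ 1 ℕ.+ p ℕ.* t) where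
      private
        s : ℕ
        s = q ℕ.* R ℕ.* R

        instance _ = q-nonZero

        *q-cancel : ∀ {i j} → q ℕ.* i ≡ q ℕ.* j → i ≡ j
        *q-cancel {i} {j} = ℕ.*-cancelˡ-≡ i j q

        perp-degree : ∀ A i B → ∑[ j < n ] perp A i B j ≡ q ℕ.* R
        perp-degree A i B = ≡.trans (∑-cong λ j → 𝟙⟨⟩-shift (vec A i) (y B) (u j))
          (≡.trans (∑-u (𝟙⟨⟩ (vec A i) b)) (*q-cancel (≡.trans (fibres₁ S (¬perp-vec A i) b) n≡)))
          where b = - ⟨ y B , vec A i ⟩

        U-pairs : ∀ {A A′} i i′ → A ≢ A′ → ∀ a b →
                  count S (λ w → 𝟙⟨⟩ (vec A i) a w ℕ.* 𝟙⟨⟩ (vec A′ i′) b w) ≡ R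
        U-pairs {A} {A′} i i′ A≢A′ a b = *q-cancel (*q-cancel (≡.trans
          (fibres₂ S (¬perp-vec A i) (¬perp-vec₂ i i′ A≢A′) a b) n≡))

        perp-common : ∀ {A i A′ i′} → A ≢ A′ → ∀ B → ∑[ j < n ] (perp A i B j ℕ.* perp A′ i′ B j) ≡ R
        perp-common {A} {i} {A′} {i′} A≢A′ B = ≡.trans
          (∑-cong λ j → cong₂ ℕ._*_ (𝟙⟨⟩-shift (vec A i) (y B) (u j)) (𝟙⟨⟩-shift (vec A′ i′) (y B) (u j)))
          (≡.trans (∑-u (λ w → 𝟙⟨⟩ (vec A i) _ w ℕ.* 𝟙⟨⟩ (vec A′ i′) _ w)) (U-pairs i i′ A≢A′ _ _))

        countV-pairs : ∀ {A i A′ i′} → (A , i) ≢ (A′ , i′) →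
          countV (λ w → 𝟙⟨⟩ (vec A i) 0# w ℕ.* 𝟙⟨⟩ (vec A′ i′) 0# w) ≡ q ℕ.* s
        countV-pairs {A} {i} {A′} {i′} x≢x′ = ≡.trans (countV-whole _) (*q-cancel (*q-cancel (≡.trans
          (fibres₂ whole
            (λ h → vec∉U A i (0∈U (perp-whole h)))
            (λ a h → 0≉1 (sym (proj₂ (independent a 1# x≢x′
              (≈ᴹ-trans (+ᴹ-comm _ _) (≈ᴹ-trans (+ᴹ-congʳ (*ₗ-identityˡ _)) (perp-whole h)))))))
            0# 0#)
          (≡.trans N≡ (≡.trans (cong₂ ℕ._*_ n≡ n≡) (lemma q R))))))
          where
          lemma : ∀ q R → q ℕ.* (q ℕ.* R) ℕ.* (q ℕ.* (q ℕ.* R)) ≡ q ℕ.* (q ℕ.* (q ℕ.* (q ℕ.* R ℕ.* R)))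
          lemma = solve-∀

        perp-class : ∀ {A i i′} → i ≢ i′ → Σ (Fin v → ℕ) λ g →
          (∀ B → ∑[ j < n ] (perp A i B j ℕ.* perp A i′ B j) ≡ g B ℕ.* (q ℕ.* R)) ×
          g A ≡ perp A i A i′ × ∑[ B < v ] g B ≡ 1 ℕ.+ q ℕ.* t
        perp-class {A} {i} {i′} i≢i′ = g , g-count , g-self , ∑g
          where
          d : Carrierᴹ
          d = difference i i′
          g : Fin v → ℕ
          g B = 𝟙⟨⟩ d 0# (y B)
          g-count : ∀ B → ∑[ j < n ] (perp A i B j ℕ.* perp A i′ B j) ≡ g B ℕ.* (q ℕ.* R)
          g-count B = ≡.trans (∑-cong term) (≡.trans (≡.sym (*-∑ˡ (g B) (perp A i B)))
            (cong (g B ℕ.*_) (perp-degree A i B)))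
            where
            term : ∀ j → perp A i B j ℕ.* perp A i′ B j ≡ g B ℕ.* perp A i B j
            term j with ⟨ vec B j , vec A i ⟩ ≟ 0#
            ... | no _  = ≡.sym (ℕ.*-zeroʳ (g B))
            ... | yes h = ≡.trans (ℕ.*-identityˡ _) (≡.trans
              (𝟙-cong (⟨ vec B j , vec A i′ ⟩ ≟ 0#) (⟨ y B , d ⟩ ≟ 0#)
                (λ k → trans (sym same) k) (trans same))
              (≡.sym (ℕ.*-identityʳ (g B))))
              where
              same : ⟨ vec B j , vec A i′ ⟩ ≈ ⟨ y B , d ⟩
              same = trans (⟨vec⟩-difference A i i′ (vec B j)) (trans (+-congʳ h)
                (trans (+-identityˡ _) (vec-⟨difference⟩ B j i i′)))
          g-self : g A ≡ perp A i A i′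
          g-self = 𝟙-cong (⟨ y A , d ⟩ ≟ 0#) (⟨ vec A i′ , vec A i ⟩ ≟ 0#)
            (λ h → ⟨⟩-reflexive (trans (⟨⟩-same-class A i i′) h))
            (λ h → trans (sym (⟨⟩-same-class A i i′)) (⟨⟩-reflexive h))
          ∑g : ∑[ B < v ] g B ≡ 1 ℕ.+ q ℕ.* t
          ∑g = solve-g (*q-cancel (begin
            q ℕ.* (1 ℕ.+ p ℕ.* ∑[ B < v ] g B)       ≡⟨ ℕ.*-cancelˡ-≡ _ _ n scaled ⟩
            n                                        ≡⟨ n≡ ⟩
            q ℕ.* (q ℕ.* R)                          ∎))
            where
            open ≡-Reasoning
            instance _ = n-nonZero
            U-part : count S (𝟙⟨⟩ d 0#) ≡ n
            U-part = fibres-perp S (isotropic d (difference∈U i i′))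
            O-part : ∑ᴼ (𝟙⟨⟩ d 0#) ≡ n ℕ.* ∑[ B < v ] g B
            O-part = ≡.trans (∑-cong λ B → ≡.trans
              (∑-cong λ j → 𝟙-cong (⟨ vec B j , d ⟩ ≟ 0#) (⟨ y B , d ⟩ ≟ 0#)
                (λ h → trans (sym (vec-⟨difference⟩ B j i i′)) h) (trans (vec-⟨difference⟩ B j i i′)))
              (∑-const n (g B))) (≡.sym (*-∑ˡ n g))
            scaled : n ℕ.* (q ℕ.* (1 ℕ.+ p ℕ.* ∑[ B < v ] g B)) ≡ n ℕ.* n
            scaled = begin
              n ℕ.* (q ℕ.* (1 ℕ.+ p ℕ.* ∑[ B < v ] g B))
                ≡⟨ lemma n q p (∑[ B < v ] g B) ⟩
              q ℕ.* (n ℕ.+ p ℕ.* (n ℕ.* ∑[ B < v ] g B))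
                ≡⟨ cong (q ℕ.*_) (cong₂ (λ i j → i ℕ.+ p ℕ.* j) U-part O-part) ⟨
              q ℕ.* (count S (𝟙⟨⟩ d 0#) ℕ.+ p ℕ.* ∑ᴼ (𝟙⟨⟩ d 0#))
                ≡⟨ cong (q ℕ.*_) (countV-split (𝟙⟨⟩-resp d 0#) (𝟙⟨⟩-homogeneous d)) ⟨
              q ℕ.* countV (𝟙⟨⟩ d 0#)
                ≡⟨ cong (q ℕ.*_) (countV-whole (𝟙⟨⟩ d 0#)) ⟩
              q ℕ.* count whole (𝟙⟨⟩ d 0#)
                ≡⟨ fibres₁ whole (difference≉0 i≢i′ ∘ perp-whole) 0# ⟩
              N ≡⟨ N≡ ⟩
              n ℕ.* n ∎
              where
              lemma : ∀ n q p g → n ℕ.* (q ℕ.* (1 ℕ.+ p ℕ.* g)) ≡ q ℕ.* (n ℕ.+ p ℕ.* (n ℕ.* g))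
              lemma = solve-∀
            solve-g : 1 ℕ.+ p ℕ.* ∑[ B < v ] g B ≡ q ℕ.* R → ∑[ B < v ] g B ≡ 1 ℕ.+ q ℕ.* t
            solve-g h = ℕ.*-cancelˡ-≡ _ _ p (ℕ.suc-injective (≡.trans h
              (≡.trans (cong (q ℕ.*_) R≡) (≡.trans (cong (ℕ._* (1 ℕ.+ p ℕ.* t)) q≡1+p)
                (≡.trans (lemma p t) (cong (λ q → 1 ℕ.+ p ℕ.* (1 ℕ.+ q ℕ.* t)) (≡.sym q≡1+p)))))))
              where
              lemma : ∀ p t → (1 ℕ.+ p) ℕ.* (1 ℕ.+ p ℕ.* t) ≡ 1 ℕ.+ p ℕ.* (1 ℕ.+ (1 ℕ.+ p) ℕ.* t)
              lemma = solve-∀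

        module Pair {A : Fin v} {i : Fin n} {A′ : Fin v} {i′ : Fin n} (x≢x′ : (A , i) ≢ (A′ , i′)) where
          open ≡-Reasoning

          x x′ : Carrierᴹ
          x  = vec A i
          x′ = vec A′ i′

          comb : Carrier → Carrier → Carrierᴹ
          comb a b = a *ₗ x +ᴹ b *ₗ x′

          comb-cong : ∀ {a a′ b b′} → a ≈ a′ → b ≈ b′ → comb a b ≈ᴹ comb a′ b′
          comb-cong p r = +ᴹ-cong (*ₗ-congʳ p) (*ₗ-congʳ r)

          comb-injective : ∀ {a b a′ b′} → comb a b ≈ᴹ comb a′ b′ → a ≈ a′ × b ≈ b′
          comb-injective {a} {b} {a′} {b′} h = a-b≈0⇒a≈b (proj₁ zeros) , a-b≈0⇒a≈b (proj₂ zeros)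
            where
            zeros : a - a′ ≈ 0# × b - b′ ≈ 0#
            zeros = independent (a - a′) (b - b′) x≢x′ (≈ᴹ-trans
              (+ᴹ-cong (*ₗ-distribʳ x a (- a′)) (*ₗ-distribʳ x′ b (- b′)))
              (≈ᴹ-trans (interchange _ _ _ _) (≈ᴹ-trans (+ᴹ-congʳ h)
                (≈ᴹ-trans (interchange _ _ _ _) (≈ᴹ-trans (+ᴹ-cong (a+-a a′ x) (a+-a b′ x′))
                  (+ᴹ-identityˡ 0ᴹ))))))

          W : Carrierᴹ → ℕ
          W z = 𝟙⟨⟩ x 0# z ℕ.* 𝟙⟨⟩ x′ 0# z

          W-resp : Respects W
          W-resp r = cong₂ ℕ._*_ (𝟙⟨⟩-resp x 0# r) (𝟙⟨⟩-resp x′ 0# r)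

          W-homogeneous : Homogeneous W
          W-homogeneous a≉0 z = cong₂ ℕ._*_ (𝟙⟨⟩-homogeneous x a≉0 z) (𝟙⟨⟩-homogeneous x′ a≉0 z)

          W² : Carrierᴹ → Carrierᴹ → ℕ
          W² z w = W w ℕ.* 𝟙⟨⟩ z 0# w

          aV aU aO : Carrierᴹ → ℕ
          aV z = countV (W² z)
          aU z = count S (W² z)
          aO z = ∑ᴼ (W² z)

          outer : ℕ
          outer = ∑ᴼ (λ z → W z ℕ.* aO z)

          W²-respʳ : ∀ z → Respects (W² z)
          W²-respʳ z r = cong₂ ℕ._*_ (W-resp r) (𝟙⟨⟩-resp z 0# r)

          𝟙⟨⟩-congˡ : ∀ {z z′} → z ≈ᴹ z′ → ∀ w → 𝟙⟨⟩ z 0# w ≡ 𝟙⟨⟩ z′ 0# w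
          𝟙⟨⟩-congˡ {z} {z′} r w = ≡.trans (𝟙⟨⟩-sym z w) (≡.trans (𝟙⟨⟩-resp w 0# r) (𝟙⟨⟩-sym w z′))

          aV-resp : Respects aV
          aV-resp r = over-cong vectors λ w → cong (W w ℕ.*_) (𝟙⟨⟩-congˡ r w)

          aV-homogeneous : Homogeneous aV
          aV-homogeneous {a} a≉0 z = over-cong vectors λ w → cong (W w ℕ.*_)
            (≡.trans (𝟙⟨⟩-sym (a *ₗ z) w) (≡.trans (𝟙⟨⟩-homogeneous w a≉0 z) (𝟙⟨⟩-sym w z)))

          aV-split : ∀ z → aV z ≡ aU z ℕ.+ p ℕ.* aO z
          aV-split z = countV-split (W²-respʳ z) λ a≉0 w →
            cong₂ ℕ._*_ (W-homogeneous a≉0 w) (𝟙⟨⟩-homogeneous z a≉0 w)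

          VV UV UU UO : ℕ
          VV = countV (λ z → W z ℕ.* aV z)
          UV = count S (λ z → W z ℕ.* aV z)
          UU = count S (λ z → W z ℕ.* aU z)
          UO = count S (λ z → W z ℕ.* aO z)

          UV-split : UV ≡ UU ℕ.+ p ℕ.* UO
          UV-split = begin
            UV
              ≡⟨ over-cong (size S) (λ (z , _) → ≡.trans (cong (W z ℕ.*_) (aV-split z))
                   (distribute (W z) (aU z) p (aO z))) ⟩
            count S (λ z → W z ℕ.* aU z ℕ.+ p ℕ.* (W z ℕ.* aO z))
              ≡⟨ over-+ (size S) (λ (z , _) → W z ℕ.* aU z) _ ⟩
            UU ℕ.+ count S (λ z → p ℕ.* (W z ℕ.* aO z))
              ≡⟨ cong (UU ℕ.+_) (*-overˡ (size S) p _) ⟨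
            UU ℕ.+ p ℕ.* UO ∎
            where
            distribute : ∀ w a p o → w ℕ.* (a ℕ.+ p ℕ.* o) ≡ w ℕ.* a ℕ.+ p ℕ.* (w ℕ.* o)
            distribute = solve-∀

          ∑ᴼ-+ : ∀ f h → ∑ᴼ (λ z → f z ℕ.+ h z) ≡ ∑ᴼ f ℕ.+ ∑ᴼ h
          ∑ᴼ-+ f h = ≡.trans (∑-cong λ B → ∑-+ (λ j → f (vec B j)) (λ j → h (vec B j)))
            (∑-+ (λ B → ∑[ j < n ] f (vec B j)) _)

          *-∑ᴼ : ∀ c f → c ℕ.* ∑ᴼ f ≡ ∑ᴼ (λ z → c ℕ.* f z)
          *-∑ᴼ c f = ≡.trans (*-∑ˡ c (λ B → ∑[ j < n ] f (vec B j)))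
            (∑-cong λ B → *-∑ˡ c (λ j → f (vec B j)))

          OU-UO : ∑ᴼ (λ z → W z ℕ.* aU z) ≡ UO
          OU-UO = begin
            ∑ᴼ (λ z → W z ℕ.* aU z)
              ≡⟨ ∑-cong (λ B → ∑-cong λ j → *-overˡ (size S) (W (vec B j)) _) ⟩
            ∑ᴼ (λ z → count S (λ w → W z ℕ.* W² z w))
              ≡⟨ ∑-cong (λ B → over-∑-comm (size S) (λ j (w , _) → W (vec B j) ℕ.* W² (vec B j) w)) ⟨
            ∑[ B < v ] count S (λ w → ∑[ j < n ] (W (vec B j) ℕ.* W² (vec B j) w))
              ≡⟨ over-∑-comm (size S) (λ B (w , _) → ∑[ j < n ] (W (vec B j) ℕ.* W² (vec B j) w)) ⟨
            count S (λ w → ∑ᴼ (λ z → W z ℕ.* W² z w))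
              ≡⟨ over-cong (size S) (λ (w , _) → ≡.trans
                   (∑-cong λ B → ∑-cong λ j → swap w (vec B j)) (≡.sym (*-∑ᴼ (W w) (W² w)))) ⟩
            UO ∎
            where
            lemma : ∀ a b i → a ℕ.* (b ℕ.* i) ≡ b ℕ.* (a ℕ.* i)
            lemma = solve-∀
            swap : ∀ w z → W z ℕ.* W² z w ≡ W w ℕ.* W² w z
            swap w z = ≡.trans (lemma (W z) (W w) (𝟙⟨⟩ z 0# w))
              (cong (λ i → W w ℕ.* (W z ℕ.* i)) (𝟙⟨⟩-sym z w))

          VV-split : VV ≡ UV ℕ.+ p ℕ.* (UO ℕ.+ p ℕ.* outer)
          VV-split = begin
            VV
              ≡⟨ countV-split (λ r → cong₂ ℕ._*_ (W-resp r) (aV-resp r))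
                   (λ a≉0 z → cong₂ ℕ._*_ (W-homogeneous a≉0 z) (aV-homogeneous a≉0 z)) ⟩
            UV ℕ.+ p ℕ.* ∑ᴼ (λ z → W z ℕ.* aV z)
              ≡⟨ cong (λ k → UV ℕ.+ p ℕ.* k) (≡.trans
                   (∑-cong λ B → ∑-cong λ j → ≡.trans (cong (W (vec B j) ℕ.*_) (aV-split (vec B j)))
                     (distribute (W (vec B j)) (aU (vec B j)) p (aO (vec B j))))
                   (≡.trans (∑ᴼ-+ (λ z → W z ℕ.* aU z) (λ z → p ℕ.* (W z ℕ.* aO z)))
                     (cong₂ ℕ._+_ OU-UO (≡.sym (*-∑ᴼ p (λ z → W z ℕ.* aO z)))))) ⟩
            UV ℕ.+ p ℕ.* (UO ℕ.+ p ℕ.* outer) ∎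
            where
            distribute : ∀ w a p o → w ℕ.* (a ℕ.+ p ℕ.* o) ≡ w ℕ.* a ℕ.+ p ℕ.* (w ℕ.* o)
            distribute = solve-∀

          inclusion-exclusion : p ℕ.* p ℕ.* outer ℕ.+ 2 ℕ.* UV ≡ VV ℕ.+ UU
          inclusion-exclusion = eliminate p UV UU UO outer VV UV-split VV-split
            where
            eliminate : ∀ p UV UU UO o VV → UV ≡ UU ℕ.+ p ℕ.* UO → VV ≡ UV ℕ.+ p ℕ.* (UO ℕ.+ p ℕ.* o) →
                      p ℕ.* p ℕ.* o ℕ.+ 2 ℕ.* UV ≡ VV ℕ.+ UU
            eliminate p _ UU UO o _ ≡.refl ≡.refl = lemma p UU UO o
              where
              lemma : ∀ p UU UO o → p ℕ.* p ℕ.* o ℕ.+ 2 ℕ.* (UU ℕ.+ p ℕ.* UO) ≡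
                      (UU ℕ.+ p ℕ.* UO) ℕ.+ p ℕ.* (UO ℕ.+ p ℕ.* o) ℕ.+ UU
              lemma = solve-∀

          ∑² : (Carrier → Carrier → ℕ) → ℕ
          ∑² f = over order (λ a → over order (f a))

          ∑²-cong : ∀ {f h} → (∀ a b → f a b ≡ h a b) → ∑² f ≡ ∑² h
          ∑²-cong f≗h = over-cong order λ a → over-cong order (f≗h a)

          Resp² : (Carrier → Carrier → ℕ) → Set _
          Resp² f = ∀ {a a′ b b′} → a ≈ a′ → b ≈ b′ → f a b ≡ f a′ b′

          ∑²-single : ∀ {f} → Resp² f → ∀ a b → (∀ a′ b′ → ¬ (a′ ≈ a × b′ ≈ b) → f a′ b′ ≡ 0) →
                      ∑² f ≡ f a b
          ∑²-single {f} f-resp a b h = ≡.trans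
            (over-single order (λ r → over-cong order λ b′ → f-resp r refl) a
              λ a′ a′≉a → over-zero order λ b′ → h a′ b′ (a′≉a ∘ proj₁))
            (over-single order (f-resp refl) b λ b′ b′≉b → h a b′ (b′≉b ∘ proj₂))

          σ : Carrierᴹ → ℕ
          σ z = ∑² (λ a b → 𝟙 (z ≟ᴹ comb a b))

          countV-σ : ∀ {h} → Respects h → countV (λ z → h z ℕ.* σ z) ≡ ∑² (λ a b → h (comb a b))
          countV-σ {h} h-resp = begin
            countV (λ z → h z ℕ.* σ z)
              ≡⟨ over-cong vectors (λ z → ≡.trans (*-overˡ order (h z) _)
                   (over-cong order λ a → *-overˡ order (h z) _)) ⟩
            countV (λ z → ∑² (λ a b → h z ℕ.* 𝟙 (z ≟ᴹ comb a b)))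
              ≡⟨ over-comm vectors order _ ⟩
            over order (λ a → countV (λ z → over order (λ b → h z ℕ.* 𝟙 (z ≟ᴹ comb a b))))
              ≡⟨ over-cong order (λ a → ≡.trans (over-comm vectors order _)
                   (over-cong order λ b → countV-δ h-resp (comb a b))) ⟩
            ∑² (λ a b → h (comb a b)) ∎

          span? : ∀ z → Dec (∃[ a ] ∃[ b ] z ≈ᴹ comb a b)
          span? z = search order
            (λ r (b , k) → b , ≈ᴹ-trans k (comb-cong r refl))
            (λ a → search order (λ r k → ≈ᴹ-trans k (comb-cong refl r)) (λ b → z ≟ᴹ comb a b))

          aV≡ : ∀ z → aV z ≡ s ℕ.+ p ℕ.* s ℕ.* σ z
          aV≡ z with span? z
          ... | yes (a , b , z≈) = begin
            aV z                    ≡⟨ over-cong vectors absorb ⟩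
            countV W                ≡⟨ countV-pairs x≢x′ ⟩
            q ℕ.* s                 ≡⟨ cong (ℕ._* s) q≡1+p ⟩
            s ℕ.+ p ℕ.* s           ≡⟨ cong (s ℕ.+_) (ℕ.*-identityʳ (p ℕ.* s)) ⟨
            s ℕ.+ p ℕ.* s ℕ.* 1     ≡⟨ cong (λ k → s ℕ.+ p ℕ.* s ℕ.* k) σ≡1 ⟨
            s ℕ.+ p ℕ.* s ℕ.* σ z   ∎
            where
            absorb : ∀ w → W² z w ≡ W w
            absorb w with ⟨ w , x ⟩ ≟ 0# | ⟨ w , x′ ⟩ ≟ 0#
            ... | no _   | _       = ≡.refl
            ... | yes _  | no _    = ≡.refl
            ... | yes wx | yes wx′ = ≡.trans (ℕ.*-identityˡ _) (𝟙-yes (⟨ w , z ⟩ ≟ 0#)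
              (trans (⟨⟩-cong ≈ᴹ-refl z≈) (trans (⟨⟩-combʳ-0 (a *ₗ x) b wx′)
                (trans (⟨⟩-*ʳ a w x) (trans (*-congˡ wx) (zeroʳ a))))))
            σ≡1 : σ z ≡ 1
            σ≡1 = ≡.trans (∑²-single
              (λ {a} {a′} {b} {b′} r r′ → 𝟙-cong (z ≟ᴹ comb a b) (z ≟ᴹ comb a′ b′)
                (λ k → ≈ᴹ-trans k (comb-cong r r′)) (λ k → ≈ᴹ-trans k (comb-cong (sym r) (sym r′))))
              a b λ a′ b′ n → 𝟙-no (z ≟ᴹ comb a′ b′) λ k →
                n (comb-injective (≈ᴹ-trans (≈ᴹ-sym k) z≈)))
              (𝟙-yes (z ≟ᴹ comb a b) z≈)
          ... | no ¬span = begin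
            aV z                    ≡⟨ countV-whole (W² z) ⟩
            count whole (W² z)
              ≡⟨ *q-cancel (*q-cancel (*q-cancel (≡.trans (fibres₃ whole
                   (λ h → vec∉U A i (0∈U (perp-whole h)))
                   (λ a h → 0≉1 (sym (proj₂ (independent a 1# x≢x′
                     (≈ᴹ-trans (+ᴹ-comm _ _) (≈ᴹ-trans (+ᴹ-congʳ (*ₗ-identityˡ _)) (perp-whole h)))))))
                   (λ a b h → ¬span (- b , - a , outside a b (perp-whole h))) 0# 0# 0#)
                   (≡.trans N≡ (≡.trans (cong₂ ℕ._*_ n≡ n≡) (lemma q R)))))) ⟩
            s                       ≡⟨ ℕ.+-identityʳ s ⟨
            s ℕ.+ 0                 ≡⟨ cong (s ℕ.+_) (ℕ.*-zeroʳ (p ℕ.* s)) ⟨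
            s ℕ.+ p ℕ.* s ℕ.* 0     ≡⟨ cong (λ k → s ℕ.+ p ℕ.* s ℕ.* k) (over-zero order λ a →
                   over-zero order λ b → 𝟙-no (z ≟ᴹ comb a b) λ k → ¬span (a , b , k)) ⟨
            s ℕ.+ p ℕ.* s ℕ.* σ z   ∎
            where
            lemma : ∀ q R → q ℕ.* (q ℕ.* R) ℕ.* (q ℕ.* (q ℕ.* R)) ≡
                    q ℕ.* (q ℕ.* (q ℕ.* (q ℕ.* R ℕ.* R)))
            lemma = solve-∀
            outside : ∀ a b → (z +ᴹ a *ₗ x′) +ᴹ b *ₗ x ≈ᴹ 0ᴹ → z ≈ᴹ comb (- b) (- a)
            outside a b h = ≈ᴹ-sym (≈ᴹ-trans (+ᴹ-congʳ (≈ᴹ-sym (+ᴹ-identityˡ _)))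
              (≈ᴹ-trans (+ᴹ-congʳ (+ᴹ-congʳ (≈ᴹ-sym h))) (≈ᴹ-trans (+ᴹ-congʳ
                (≈ᴹ-trans (+ᴹ-assoc _ _ _) (≈ᴹ-trans (+ᴹ-congˡ (a+-a b x)) (+ᴹ-identityʳ _))))
                (≈ᴹ-trans (+ᴹ-assoc _ _ _) (≈ᴹ-trans (+ᴹ-congˡ (a+-a a x′)) (+ᴹ-identityʳ z))))))

          count-aV : ∀ {a ℓ k} {T : Setoid a ℓ} (e : HasSize T k) (f : Setoid.Carrier T → Carrierᴹ) →
            over e (λ z → W (f z) ℕ.* aV (f z)) ≡
            over e (W ∘ f) ℕ.* s ℕ.+ p ℕ.* s ℕ.* over e (λ z → W (f z) ℕ.* σ (f z))
          count-aV e f = ≡.trans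
            (over-cong e λ z → ≡.trans (cong (W (f z) ℕ.*_) (aV≡ (f z)))
              (distribute (W (f z)) s (p ℕ.* s) (σ (f z))))
            (≡.trans (over-+ e (λ z → W (f z) ℕ.* s) _)
              (cong₂ ℕ._+_ (≡.sym (*-overʳ e s (W ∘ f))) (≡.sym (*-overˡ e (p ℕ.* s) _))))
            where
            distribute : ∀ w s r o → w ℕ.* (s ℕ.+ r ℕ.* o) ≡ w ℕ.* s ℕ.+ r ℕ.* (w ℕ.* o)
            distribute = solve-∀

          ⟨comb,x⟩ : ∀ a b → ⟨ comb a b , x ⟩ ≈ b * ⟨ x′ , x ⟩
          ⟨comb,x⟩ a b = trans (⟨⟩-combˡ (a *ₗ x) b x′ x) (trans (+-congʳ
            (trans (⟨⟩-*ˡ a x x) (trans (*-congˡ (alternating x)) (zeroʳ a)))) (+-identityˡ _))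

          ⟨comb,x′⟩ : ∀ a b → ⟨ comb a b , x′ ⟩ ≈ a * ⟨ x , x′ ⟩
          ⟨comb,x′⟩ a b = trans (⟨⟩-combˡ-0 (a *ₗ x) b (alternating x′)) (⟨⟩-*ˡ a x x′)

          ≈0-factor : ∀ {a b} → ¬ b ≈ 0# → a * b ≈ 0# → a ≈ 0#
          ≈0-factor {a} {b} b≉0 h with r , r*b ← reciprocal b≉0 =
            trans (sym (*-identityʳ a)) (trans (*-congˡ (trans (sym r*b) (*-comm r b)))
              (trans (sym (*-assoc a b r)) (trans (*-congʳ h) (zeroˡ r))))

          W-comb-perp : ⟨ x′ , x ⟩ ≈ 0# → ∀ a b → W (comb a b) ≡ 1
          W-comb-perp h a b = cong₂ ℕ._*_
            (𝟙-yes (⟨ comb a b , x ⟩ ≟ 0#) (trans (⟨comb,x⟩ a b) (trans (*-congˡ h) (zeroʳ b))))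
            (𝟙-yes (⟨ comb a b , x′ ⟩ ≟ 0#)
              (trans (⟨comb,x′⟩ a b) (trans (*-congˡ (⟨⟩-reflexive h)) (zeroʳ a))))

          W-comb-¬perp : ¬ ⟨ x′ , x ⟩ ≈ 0# → ∀ a b → ¬ (a ≈ 0# × b ≈ 0#) → W (comb a b) ≡ 0
          W-comb-¬perp n a b ab≉0 with ⟨ comb a b , x ⟩ ≟ 0# | ⟨ comb a b , x′ ⟩ ≟ 0#
          ... | no _  | _     = ≡.refl
          ... | yes _ | no _  = ≡.refl
          ... | yes h | yes k = contradiction
            ( ≈0-factor (n ∘ ⟨⟩-reflexive) (trans (sym (⟨comb,x′⟩ a b)) k)
            , ≈0-factor n (trans (sym (⟨comb,x⟩ a b)) h)) ab≉0

          W-comb-0 : W (comb 0# 0#) ≡ 1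
          W-comb-0 = cong₂ ℕ._*_
            (𝟙-yes (⟨ comb 0# 0# , x ⟩ ≟ 0#) (trans (⟨comb,x⟩ 0# 0#) (zeroˡ _)))
            (𝟙-yes (⟨ comb 0# 0# , x′ ⟩ ≟ 0#) (trans (⟨comb,x′⟩ 0# 0#) (zeroˡ _)))

          W-comb-resp : Resp² (λ a b → W (comb a b))
          W-comb-resp r r′ = W-resp (comb-cong r r′)

          radical≡ : countV (λ z → W z ℕ.* σ z) ≡ radical q (perp A i A′ i′)
          radical≡ = ≡.trans (countV-σ W-resp) span-count
            where
            span-count : ∑² (λ a b → W (comb a b)) ≡ radical q (perp A i A′ i′)
            span-count with ⟨ x′ , x ⟩ ≟ 0#
            ... | yes h = ≡.trans (∑²-cong (W-comb-perp h)) (≡.trans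
              (over-cong order λ _ → ≡.trans (over-const order 1) (ℕ.*-identityʳ q)) (over-const order q))
            ... | no n = ≡.trans (∑²-single W-comb-resp 0# 0# (W-comb-¬perp n)) W-comb-0

          VV≡ : VV ≡ q ℕ.* R ℕ.* (q ℕ.* R) ℕ.* s ℕ.+ p ℕ.* s ℕ.* radical q (perp A i A′ i′)
          VV≡ = ≡.trans (count-aV vectors (λ z → z)) (cong₂ (λ i j → i ℕ.* s ℕ.+ p ℕ.* s ℕ.* j)
            (≡.trans (countV-pairs x≢x′) (lemma q R)) radical≡)
            where
            lemma : ∀ q R → q ℕ.* (q ℕ.* R ℕ.* R) ≡ q ℕ.* R ℕ.* (q ℕ.* R)
            lemma = solve-∀

          UU≡ : UU ≡ count S W ℕ.* count S W
          UU≡ = ≡.trans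
            (over-cong (size S) λ (z , z∈U) → cong (W z ℕ.*_) (over-cong (size S) λ (w , w∈U) →
              ≡.trans (cong (W w ℕ.*_) (𝟙-yes (⟨ w , z ⟩ ≟ 0#) (isotropic z z∈U w w∈U)))
                (ℕ.*-identityʳ (W w))))
            (≡.sym (*-overʳ (size S) (count S W) (λ (z , _) → W z)))

          inU : Carrier → Carrier → ℕ
          inU a b = 𝟙 (comb a b ∈U?) ℕ.* W (comb a b)

          inU-resp : Resp² inU
          inU-resp r r′ = cong₂ ℕ._*_ (𝟙-member-resp (comb-cong r r′)) (W-comb-resp r r′)

          inU-0 : inU 0# 0# ≡ 1
          inU-0 = cong₂ ℕ._*_ (𝟙-yes (comb 0# 0# ∈U?) (0∈U (≈ᴹ-trans
            (+ᴹ-cong (*ₗ-zeroˡ x) (*ₗ-zeroˡ x′)) (+ᴹ-identityˡ 0ᴹ)))) W-comb-0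

          σ-resp : Respects σ
          σ-resp {z} {z′} r = ∑²-cong λ a b → 𝟙-cong (z ≟ᴹ comb a b) (z′ ≟ᴹ comb a b)
            (≈ᴹ-trans (≈ᴹ-sym r)) (≈ᴹ-trans r)

          count-σ : count S (λ z → W z ℕ.* σ z) ≡ ∑² inU
          count-σ = ≡.trans (≡.sym (countV-member S λ r → cong₂ ℕ._*_ (W-resp r) (σ-resp r)))
            (≡.trans (over-cong vectors λ z → ≡.sym (ℕ.*-assoc (𝟙 (z ∈U?)) (W z) (σ z)))
              (countV-σ λ r → cong₂ ℕ._*_ (𝟙-member-resp r) (W-resp r)))

          outer≡ : ∀ {w r} → count S W ≡ w → ∑² inU ≡ r →
            p ℕ.* p ℕ.* outer ℕ.+ 2 ℕ.* (w ℕ.* s ℕ.+ p ℕ.* s ℕ.* r) ≡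
            q ℕ.* R ℕ.* (q ℕ.* R) ℕ.* s ℕ.+ p ℕ.* s ℕ.* radical q (perp A i A′ i′) ℕ.+ w ℕ.* w
          outer≡ {w} {r} w≡ r≡ = begin
            p ℕ.* p ℕ.* outer ℕ.+ 2 ℕ.* (w ℕ.* s ℕ.+ p ℕ.* s ℕ.* r)
              ≡⟨ cong (λ k → p ℕ.* p ℕ.* outer ℕ.+ 2 ℕ.* k) (≡.trans
                   (count-aV (size S) proj₁)
                   (cong₂ (λ i j → i ℕ.* s ℕ.+ p ℕ.* s ℕ.* j) w≡ (≡.trans count-σ r≡))) ⟨
            p ℕ.* p ℕ.* outer ℕ.+ 2 ℕ.* UV
              ≡⟨ inclusion-exclusion ⟩
            VV ℕ.+ UU
              ≡⟨ cong₂ ℕ._+_ VV≡ (≡.trans UU≡ (cong₂ ℕ._*_ w≡ w≡)) ⟩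
            q ℕ.* R ℕ.* (q ℕ.* R) ℕ.* s ℕ.+ p ℕ.* s ℕ.* radical q (perp A i A′ i′) ℕ.+ w ℕ.* w ∎

        outer-≢ : ∀ {A i A′ i′} (A≢A′ : A ≢ A′) →
          p ℕ.* p ℕ.* Pair.outer {A} {i} {A′} {i′} (A≢A′ ∘ cong proj₁) ℕ.+
            2 ℕ.* (R ℕ.* s ℕ.+ p ℕ.* s ℕ.* 1) ≡
          q ℕ.* R ℕ.* (q ℕ.* R) ℕ.* s ℕ.+ p ℕ.* s ℕ.* radical q (perp A i A′ i′) ℕ.+ R ℕ.* R
        outer-≢ {A} {i} {A′} {i′} A≢A′ = outer≡ (U-pairs i i′ A≢A′ 0# 0#)
          (≡.trans (∑²-single inU-resp 0# 0# λ a b n → cong (ℕ._* W (comb a b))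
            (𝟙-no (comb a b ∈U?) λ h → n (∈U-≢ a b i i′ A≢A′ h))) inU-0)
          where open Pair {A} {i} {A′} {i′} (A≢A′ ∘ cong proj₁)

        outer-≡ : ∀ {A i i′} (i≢i′ : i ≢ i′) →
          p ℕ.* p ℕ.* Pair.outer {A} {i} {A} {i′} (i≢i′ ∘ cong proj₂) ℕ.+
            2 ℕ.* (q ℕ.* R ℕ.* s ℕ.+ p ℕ.* s ℕ.* radicalInU q (perp A i A i′)) ≡
          q ℕ.* R ℕ.* (q ℕ.* R) ℕ.* s ℕ.+ p ℕ.* s ℕ.* radical q (perp A i A i′) ℕ.+
            q ℕ.* R ℕ.* (q ℕ.* R)
        outer-≡ {A} {i} {i′} i≢i′ = outer≡ W-count span-count
          where
          open Pair {A} {i} {A} {i′} (i≢i′ ∘ cong proj₂)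
          W-count : count S W ≡ q ℕ.* R
          W-count = ≡.trans
            (over-cong (size S) λ (w , w∈U) → ≡.trans
              (cong (𝟙⟨⟩ x 0# w ℕ.*_) (𝟙-cong (⟨ w , x′ ⟩ ≟ 0#) (⟨ w , x ⟩ ≟ 0#)
                (trans (sym (same w∈U))) (trans (same w∈U))))
              (𝟙-idem (⟨ w , x ⟩ ≟ 0#)))
            (*q-cancel (≡.trans (fibres₁ S (¬perp-vec A i) 0#) n≡))
            where
            same : ∀ {w} → U w → ⟨ w , x′ ⟩ ≈ ⟨ w , x ⟩
            same {w} w∈U = trans (⟨vec⟩-difference A i i′ w)
              (trans (+-congˡ (difference-perp w∈U i i′)) (+-identityʳ _))
          span-count : ∑² inU ≡ radicalInU q (perp A i A i′)
          span-count with ⟨ x′ , x ⟩ ≟ 0#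
          ... | yes h = ≡.trans (over-cong order λ a → ≡.trans
              (over-cong order λ b → ≡.trans (cong (𝟙 (comb a b ∈U?) ℕ.*_) (W-comb-perp h a b))
                (≡.trans (ℕ.*-identityʳ _) (𝟙-cong (comb a b ∈U?) (- a ≟ b)
                  (λ k → sym (+-inverseˡ-unique b a (trans (+-comm b a) (∈U-≡ a b i i′ k))))
                  (λ k → ∈U-≡′ a b i i′ (trans (+-congˡ (sym k)) (-‿inverseʳ a))))))
              (∑-field-𝟙 (- a)))
            (≡.trans (over-const order 1) (ℕ.*-identityʳ q))
          ... | no n = ≡.trans (∑²-single inU-resp 0# 0# λ a b k →
            ≡.trans (cong (𝟙 (comb a b ∈U?) ℕ.*_) (W-comb-¬perp n a b k)) (ℕ.*-zeroʳ (𝟙 (comb a b ∈U?)))) inU-0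

      perpCounts : PerpCounts p t q R perp
      perpCounts = record
        { perp-01     = perp-01
        ; perp-sym    = λ A i B j → 𝟙⟨⟩-sym (vec A i) (vec B j)
        ; perp-degree = perp-degree
        ; perp-common = perp-common
        ; perp-class  = perp-class
        ; perp-trans  = perp-trans
        ; outer-≢     = outer-≢
        ; outer-≡     = outer-≡
        }

module SubspaceSizes {c ℓ₁ ℓ₂ m ℓm q} (F : FiniteField c ℓ₁ ℓ₂ q)
  (V : Module (FiniteField.commutativeRing F) m ℓm)
  (ω : Geometry.SymplecticForm F V) where
  open FiniteField F hiding (zero)
  open FieldProperties F
  open Module V
  open Geometry F V hiding (SymplecticForm)
  open Geometry.SymplecticForm ω
  open Linear F V ω
  open LinearSpaces F V ω

  subspaceSpace : ∀ {k} (W : Subspace k) → Space ⟦ W ⟧ (q ℕ.^ k)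
  subspaceSpace W = basisSpace (Subspace.resp W) (Subspace.0-closed W)
    (Subspace.+-closed W) (Subspace.*-closed W) (Subspace.dimension W)

  wholeSpace : ∀ {k} → Basis Unary.U k → Space Unary.U (q ℕ.^ k)
  wholeSpace = basisSpace _ tt _ _

  representative : Point → Carrierᴹ
  representative x = Basis.basis (Subspace.dimension x) zero

  representative∈ : ∀ x → ⟦ x ⟧ (representative x)
  representative∈ x = Basis.basis∈W (Subspace.dimension x) zero

  point-spanned : ∀ x {z} → ⟦ x ⟧ z → ∃[ a ] z ≈ᴹ a *ₗ representative x
  point-spanned x z∈x with a , z≈ ← Basis.spanning (Subspace.dimension x) z∈x =
    a zero , ≈ᴹ-trans z≈ (+ᴹ-identityʳ _)

  point : ∀ {w} → ¬ w ≈ᴹ 0ᴹ → Point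
  point {w} w≉0 = record
    { ⟦_⟧       = λ z → Lift subspaceLevel (∃[ a ] z ≈ᴹ a *ₗ w)
    ; resp      = λ r (lift (a , h)) → lift (a , ≈ᴹ-trans (≈ᴹ-sym r) h)
    ; 0-closed  = lift (0# , ≈ᴹ-sym (*ₗ-zeroˡ w))
    ; +-closed  = λ (lift (a , h)) (lift (b , k)) →
        lift (a + b , ≈ᴹ-trans (+ᴹ-cong h k) (≈ᴹ-sym (*ₗ-distribʳ w a b)))
    ; *-closed  = λ b (lift (a , h)) → lift (b * a , ≈ᴹ-trans (*ₗ-congˡ h) (≈ᴹ-sym (*ₗ-assoc b a w)))
    ; dimension = record
      { basis       = λ _ → w
      ; basis∈W     = λ _ → lift (1# , ≈ᴹ-sym (*ₗ-identityˡ w))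
      ; spanning    = λ (lift (a , h)) → (λ _ → a) , ≈ᴹ-trans h (≈ᴹ-sym (+ᴹ-identityʳ _))
      ; independent = λ a h → λ { zero → zero-coefficient (≈ᴹ-trans (≈ᴹ-sym (+ᴹ-identityʳ _)) h) }
      }
    }
    where
    zero-coefficient : ∀ {a} → a *ₗ w ≈ᴹ 0ᴹ → a ≈ 0#
    zero-coefficient {a} h with a ≟ 0#
    ... | yes r = r
    ... | no r with b , b*a≈1 ← reciprocal r = contradiction
      (≈ᴹ-trans (≈ᴹ-sym (*ₗ-identityˡ w)) (≈ᴹ-trans (*ₗ-congʳ (sym b*a≈1))
        (≈ᴹ-trans (*ₗ-assoc b a w) (≈ᴹ-trans (*ₗ-congˡ h) (*ₗ-zeroʳ b))))) w≉0

module Configuration {c ℓ₁ ℓ₂ m ℓm} {q e : ℕ} (1≤e : 1 ℕ.≤ e) (F : FiniteField c ℓ₁ ℓ₂ q)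
  (V : Module (FiniteField.commutativeRing F) m ℓm)
  (basisV : Geometry.Basis F V Unary.U (2 ℕ.* (2 ℕ.+ e)))
  (ω : Geometry.SymplecticForm F V)
  (U : Geometry.Subspace F V (2 ℕ.+ e))
  (U-isotropic : Geometry.SymplecticForm.TotallyIsotropic ω U)
  {ℓb ℓe} (𝐃 : SymmetricDesign (Geometry.PointsIn F V U) (FiniteField.θ F (2 ℕ.+ e))
    (FiniteField.θ F (1 ℕ.+ e)) (FiniteField.θ F e) ℓb ℓe)
  (φ : Bijection (Geometry.Hyperplanes F V U) (SymmetricDesign.Blocks 𝐃)) where

  open FiniteField F hiding (zero)
  open FieldProperties F
  open Module V
  open Geometry F V hiding (SymplecticForm)
  open Geometry.SymplecticForm ω
  open Linear F V ω
  open LinearSpaces F V ω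
  open SubspaceSizes F V ω
  open SymmetricDesign 𝐃
  open Space
  open OnSpace

  private
    d v n t : ℕ
    d = 2 ℕ.+ e
    v = θ d
    n = q ℕ.^ d
    t = geometric (1 ℕ.+ p) e

    θ≡ : ∀ i → θ i ≡ geometric (1 ℕ.+ p) i
    θ≡ i = ≡.trans (cong (λ q → (q ℕ.^ i ℕ.∸ 1) ℕ./ p) q≡1+p) (quotient-geometric p i)

    N≡ : q ℕ.^ (2 ℕ.* d) ≡ n ℕ.* n
    N≡ = ≡.trans (cong (λ i → q ℕ.^ (d ℕ.+ i)) (ℕ.+-identityʳ d)) (ℕ.^-distribˡ-+-* q d d)

    R≡ : q ℕ.^ e ≡ 1 ℕ.+ p ℕ.* t
    R≡ = ≡.trans (cong (ℕ._^ e) q≡1+p) (geometric-power p e)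

    opaque
      whole : Space Unary.U (q ℕ.^ (2 ℕ.* d))
      whole = wholeSpace basisV

      S : Space ⟦ U ⟧ n
      S = subspaceSpace U

    isotropic : ∀ x → ⟦ U ⟧ x → Perp S x
    isotropic x x∈U w w∈U = ⟨⟩-reflexive (U-isotropic x x∈U w w∈U)

  open Polar F V ω whole
  open Lagrangian S N≡ isotropic
  open OuterVectors F V ω whole S N≡ isotropic

  private
    module Blocks = Setoid Blocks
    module 𝓗 = Setoid (Hyperplanes U)
    module φ = Bijection φ

    Hyperplane : Set _
    Hyperplane = 𝓗.Carrier

    opaque
      hyperplaneAt : Fin v → Hyperplane
      hyperplaneAt A = proj₁ (φ.strictlySurjective (Inverse.from blocks-size A))

      φ-hyperplaneAt : ∀ A → φ.to (hyperplaneAt A) Blocks.≈ Inverse.from blocks-size A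
      φ-hyperplaneAt A = proj₂ (φ.strictlySurjective (Inverse.from blocks-size A))

    hyperplaneAt-injective : ∀ {A B} → hyperplaneAt A 𝓗.≈ hyperplaneAt B → A ≡ B
    hyperplaneAt-injective {A} {B} h = from-injective blocks-size {A} {B}
      (Blocks.trans {Inverse.from blocks-size A} {φ.to (hyperplaneAt A)} {Inverse.from blocks-size B}
        (Blocks.sym {φ.to (hyperplaneAt A)} {Inverse.from blocks-size A} (φ-hyperplaneAt A))
        (Blocks.trans {φ.to (hyperplaneAt A)} {φ.to (hyperplaneAt B)} {Inverse.from blocks-size B}
          (φ.cong {hyperplaneAt A} {hyperplaneAt B} h) (φ-hyperplaneAt B)))

    opaque
      hyperplaneAt-vector : ∀ A → let H = ⟦ proj₁ (hyperplaneAt A) ⟧ in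
        ∃[ y ] ¬ ⟦ U ⟧ y × (∀ x → ⟦ U ⟧ x → (H x → ⟨ x , y ⟩ ≈ 0#) × (⟨ x , y ⟩ ≈ 0# → H x))
      hyperplaneAt-vector A = hyperplane-vector (subspaceSpace (proj₁ (hyperplaneAt A))) ≡.refl
        (λ {x} → proj₂ (hyperplaneAt A) x)

    y : Fin v → Carrierᴹ
    y A = proj₁ (hyperplaneAt-vector A)

    y∉U : ∀ A → ¬ ⟦ U ⟧ (y A)
    y∉U A = proj₁ (proj₂ (hyperplaneAt-vector A))

    H⇒⊥y : ∀ A {x} → ⟦ proj₁ (hyperplaneAt A) ⟧ x → ⟨ x , y A ⟩ ≈ 0#
    H⇒⊥y A {x} h = proj₁ (proj₂ (proj₂ (hyperplaneAt-vector A)) x (proj₂ (hyperplaneAt A) x h)) h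

    ⊥y⇒H : ∀ A {x} → ⟦ U ⟧ x → ⟨ x , y A ⟩ ≈ 0# → ⟦ proj₁ (hyperplaneAt A) ⟧ x
    ⊥y⇒H A {x} x∈U h = proj₂ (proj₂ (proj₂ (hyperplaneAt-vector A)) x x∈U) h

    y-distinct : ∀ {A B} → A ≢ B → ∀ a → ¬ ⟦ U ⟧ (y B +ᴹ a *ₗ y A)
    y-distinct {A} {B} A≢B a h = A≢B (hyperplaneAt-injective {A} {B}
      ( (λ x x∈A → let x∈U = proj₂ (hyperplaneAt A) x x∈A in
          ⊥y⇒H B x∈U (trans (sym (⟨⟩-combʳ-0 (y B) a (H⇒⊥y A x∈A))) (⊥sum x∈U)))
      , (λ x x∈B → let x∈U = proj₂ (hyperplaneAt B) x x∈B in
          ⊥y⇒H A x∈U (decide x∈U (H⇒⊥y B x∈B)))))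
      where
      ⊥sum : ∀ {x} → ⟦ U ⟧ x → ⟨ x , y B +ᴹ a *ₗ y A ⟩ ≈ 0#
      ⊥sum x∈U = isotropic _ h _ x∈U
      decide : ∀ {x} → ⟦ U ⟧ x → ⟨ x , y B ⟩ ≈ 0# → ⟨ x , y A ⟩ ≈ 0#
      decide {x} x∈U xyB with a ≟ 0#
      ... | yes r = contradiction (Subspace.resp U
        (≈ᴹ-trans (+ᴹ-congˡ (≈ᴹ-trans (*ₗ-congʳ r) (*ₗ-zeroˡ (y A)))) (+ᴹ-identityʳ (y B))) h) (y∉U B)
      ... | no r with b , b*a≈1 ← reciprocal r = trans (sym (*-identityˡ _)) (trans (*-congʳ (sym b*a≈1))
        (trans (*-assoc b a _) (trans (*-congˡ (trans (sym (+-identityˡ _)) (trans (+-congʳ (sym xyB))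
          (trans (sym (⟨⟩-combʳ (y B) a (y A) x)) (⊥sum x∈U))))) (zeroʳ b))))

    polarHyperplane : ∀ {z} → ¬ ⟦ U ⟧ z → Hyperplane
    polarHyperplane {z} z∉U = record
      { ⟦_⟧       = λ x → ⟦ U ⟧ x × ⟨ x , z ⟩ ≈ 0#
      ; resp      = λ r (x∈U , xz) → Subspace.resp U r x∈U , trans (⟨⟩-congˡ z (≈ᴹ-sym r)) xz
      ; 0-closed  = Subspace.0-closed U , isotropic-zero
      ; +-closed  = λ (x∈U , xz) (w∈U , wz) → Subspace.+-closed U x∈U w∈U ,
          trans (⟨⟩-+ˡ _ _ z) (trans (+-cong xz wz) (+-identityˡ 0#))
      ; *-closed  = λ a (x∈U , xz) → Subspace.*-closed U a x∈U ,
          trans (⟨⟩-*ˡ a _ z) (trans (*-congˡ xz) (zeroʳ a))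
      ; dimension = kernelBasis (Subspace.+-closed U) (Subspace.*-closed U) (Subspace.dimension U)
          (z∉U ∘ perp⇒∈U)
      } , λ x → proj₁
      where
      isotropic-zero : ⟨ 0ᴹ , z ⟩ ≈ 0#
      isotropic-zero = trans (⟨⟩-congˡ z (≈ᴹ-sym (*ₗ-zeroˡ 0ᴹ))) (trans (⟨⟩-*ˡ 0# 0ᴹ z) (zeroˡ _))

    opaque
      class : ∀ {z} → ¬ ⟦ U ⟧ z → Fin v
      class z∉U = Inverse.to blocks-size (φ.to (polarHyperplane z∉U))

      class-hyperplane : ∀ {z} (z∉U : ¬ ⟦ U ⟧ z) → hyperplaneAt (class z∉U) 𝓗.≈ polarHyperplane z∉U
      class-hyperplane z∉U = φ.injective {hyperplaneAt (class z∉U)} {polarHyperplane z∉U}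
        (Blocks.trans {φ.to (hyperplaneAt (class z∉U))} {Inverse.from blocks-size (class z∉U)}
          {φ.to (polarHyperplane z∉U)} (φ-hyperplaneAt (class z∉U))
          (Inverse.strictlyInverseʳ blocks-size (φ.to (polarHyperplane z∉U))))

    cover : ∀ {z} → ¬ ⟦ U ⟧ z → ∃[ a ] ∃[ A ] ∃[ i ] ¬ a ≈ 0# × z ≈ᴹ a *ₗ translates y A i
    cover {z} z∉U = spanned (same-hyperplane {yA} {z} (y∉U (class z∉U))
      λ x x∈U h → proj₂ (proj₁ (class-hyperplane z∉U) x (⊥y⇒H (class z∉U) x∈U h)))
      where
      yA : Carrierᴹ
      yA = y (class z∉U)
      module _ {a b : Carrier} (z+ay : ⟦ U ⟧ (z +ᴹ a *ₗ yA)) (b*-a : b * - a ≈ 1#) where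
        w : Carrierᴹ
        w = z +ᴹ a *ₗ yA
        i : Fin n
        i = Inverse.to (size S) (b *ₗ w , *-closed S b z+ay)
        decomposition : (- a) *ₗ (yA +ᴹ proj₁ (Inverse.from (size S) i)) ≈ᴹ z
        decomposition = begin
          (- a) *ₗ (yA +ᴹ proj₁ (Inverse.from (size S) i))
            ≈⟨ *ₗ-congˡ (+ᴹ-congˡ (Inverse.strictlyInverseʳ (size S) (b *ₗ w , *-closed S b z+ay))) ⟩
          (- a) *ₗ (yA +ᴹ b *ₗ w)
            ≈⟨ *ₗ-distribˡ (- a) yA (b *ₗ w) ⟩
          (- a) *ₗ yA +ᴹ (- a) *ₗ (b *ₗ w)
            ≈⟨ +ᴹ-congˡ (≈ᴹ-trans (≈ᴹ-sym (*ₗ-assoc (- a) b w))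
                 (≈ᴹ-trans (*ₗ-congʳ (trans (*-comm (- a) b) b*-a)) (*ₗ-identityˡ w))) ⟩
          (- a) *ₗ yA +ᴹ (z +ᴹ a *ₗ yA)
            ≈⟨ +ᴹ-comm _ _ ⟩
          (z +ᴹ a *ₗ yA) +ᴹ (- a) *ₗ yA
            ≈⟨ +ᴹ-assoc z _ _ ⟩
          z +ᴹ (a *ₗ yA +ᴹ (- a) *ₗ yA)
            ≈⟨ +ᴹ-congˡ (a+-a a yA) ⟩
          z +ᴹ 0ᴹ
            ≈⟨ +ᴹ-identityʳ z ⟩
          z ∎
          where open ≈-Reasoning ≈ᴹ-setoid
      spanned : ∃[ a ] ⟦ U ⟧ (z +ᴹ a *ₗ yA) →
                ∃[ a ] ∃[ A ] ∃[ i ] ¬ a ≈ 0# × z ≈ᴹ a *ₗ translates y A i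
      spanned (a , z+ay) = - a , class z∉U , i z+ay (proj₂ r) , -a≉0 , ≈ᴹ-sym (decomposition z+ay (proj₂ r))
        where
        -a≉0 : ¬ - a ≈ 0#
        -a≉0 h = z∉U (Subspace.resp U (≈ᴹ-trans (+ᴹ-congˡ (≈ᴹ-trans
          (*ₗ-congʳ (trans (sym (-‿involutive a)) (trans (-‿cong h) -0≈0))) (*ₗ-zeroˡ yA))) (+ᴹ-identityʳ z)) z+ay)
        r : ∃[ b ] b * - a ≈ 1#
        r = reciprocal -a≉0

  open Translates y y∉U y-distinct cover
    using (vec; vec∉U; perp; perpCounts; scalar-unique; ∑-u)

  private
    ⟨vec⟩-onU : ∀ {z} → ⟦ U ⟧ z → ∀ A i → ⟨ z , vec A i ⟩ ≈ ⟨ z , y A ⟩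
    ⟨vec⟩-onU {z} z∈U A i = trans (⟨⟩-+ʳ z (y A) _) (trans (+-congˡ
      (isotropic _ (proj₂ (Inverse.from (size S) i)) z z∈U)) (+-identityʳ _))

    vec≉0 : ∀ A i → ¬ vec A i ≈ᴹ 0ᴹ
    vec≉0 A i h = vec∉U A i (Subspace.resp U (≈ᴹ-sym h) (Subspace.0-closed U))

    X : Set
    X = Fin v ⊎ (Fin v × Fin n)

    module Points = Setoid Points
    module PointsU = Setoid (PointsIn U)

    pointAt : X → Point
    pointAt (inj₁ x)       = proj₁ (Inverse.from points-size x)
    pointAt (inj₂ (A , i)) = point (vec≉0 A i)

    inside : ∀ x → ⟦ pointAt (inj₁ x) ⟧ Unary.⊆′ ⟦ U ⟧
    inside x = proj₂ (Inverse.from points-size x)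

    vec∈point : ∀ A i → ⟦ point (vec≉0 A i) ⟧ (vec A i)
    vec∈point A i = lift (1# , ≈ᴹ-sym (*ₗ-identityˡ _))

    outside : ∀ A i → ¬ ⟦ point (vec≉0 A i) ⟧ Unary.⊆′ ⟦ U ⟧
    outside A i h = vec∉U A i (h (vec A i) (vec∈point A i))

    pointAt-injective : ∀ a b → pointAt a Points.≈ pointAt b → a ≡ b
    pointAt-injective (inj₁ x) (inj₁ x′) h = cong inj₁ (from-injective points-size h)
    pointAt-injective (inj₁ x) (inj₂ (A , i)) (_ , h) =
      contradiction (λ z z∈ → inside x z (h z z∈)) (outside A i)
    pointAt-injective (inj₂ (A , i)) (inj₁ x) (h , _) =
      contradiction (λ z z∈ → inside x z (h z z∈)) (outside A i)
    pointAt-injective (inj₂ (A , i)) (inj₂ (B , j)) (h , _) =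
      cong inj₂ (unique (lower (h (vec A i) (vec∈point A i))))
      where
      unique : ∃[ a ] vec A i ≈ᴹ a *ₗ vec B j → (A , i) ≡ (B , j)
      unique (a , r) = proj₂ (scalar-unique {1#} {a} {A} {B} {i} {j} (λ h → 0≉1 (sym h))
        (≈ᴹ-trans (*ₗ-identityˡ _) r))

    ⊆U : ∀ x → ⟦ U ⟧ (representative x) → ⟦ x ⟧ Unary.⊆′ ⟦ U ⟧
    ⊆U x h z z∈x = Subspace.resp U (≈ᴹ-sym (proj₂ (point-spanned x z∈x)))
      (Subspace.*-closed U (proj₁ (point-spanned x z∈x)) h)

    pointAt-surjective : ∀ x → ∃[ a ] pointAt a Points.≈ x
    pointAt-surjective x = go (representative x ∈U?)
      where
      go : Dec (⟦ U ⟧ (representative x)) → ∃[ a ] pointAt a Points.≈ x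
      go (yes h) = inj₁ (Inverse.to points-size (x , ⊆U x h)) ,
        Inverse.strictlyInverseʳ points-size (x , ⊆U x h)
      go (no h) = multiple (cover h)
        where
        multiple : ∃[ a ] ∃[ A ] ∃[ i ] ¬ a ≈ 0# × representative x ≈ᴹ a *ₗ vec A i →
                   ∃[ a ] pointAt a Points.≈ x
        multiple (a , A , i , a≉0 , r) = inj₂ (A , i)
          , (λ z (lift (b , z≈)) → Subspace.resp x (≈ᴹ-sym z≈) (Subspace.*-closed x b vec∈x))
          , (λ z z∈x → lift (proj₁ (point-spanned x z∈x) * a , ≈ᴹ-trans (proj₂ (point-spanned x z∈x))
              (≈ᴹ-trans (*ₗ-congˡ r) (≈ᴹ-sym (*ₗ-assoc _ a (vec A i))))))
          where
          inv : ∃[ b ] b * a ≈ 1#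
          inv = reciprocal a≉0
          vec∈x : ⟦ x ⟧ (vec A i)
          vec∈x = Subspace.resp x
            (≈ᴹ-trans (*ₗ-congˡ r) (≈ᴹ-trans (≈ᴹ-sym (*ₗ-assoc (proj₁ inv) a (vec A i)))
              (≈ᴹ-trans (*ₗ-congʳ (proj₂ inv)) (*ₗ-identityˡ _))))
            (Subspace.*-closed x (proj₁ inv) (representative∈ x))

    N : ℕ
    N = v ℕ.+ v ℕ.* n

    tag : Fin v ⊎ Fin (v ℕ.* n) → X
    tag (inj₁ x) = inj₁ x
    tag (inj₂ k) = inj₂ (remQuot n k)

    untag : X → Fin v ⊎ Fin (v ℕ.* n)
    untag (inj₁ x)       = inj₁ x
    untag (inj₂ (A , i)) = inj₂ (combine A i)

    tag-untag : ∀ a → tag (untag a) ≡ a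
    tag-untag (inj₁ x)       = ≡.refl
    tag-untag (inj₂ (A , i)) = cong inj₂ (Fin.remQuot-combine A i)

    untag-tag : ∀ a → untag (tag a) ≡ a
    untag-tag (inj₁ x) = ≡.refl
    untag-tag (inj₂ k) = cong inj₂ (Fin.combine-remQuot {v} n k)

    opaque
      decode : Fin N → X
      decode k = tag (splitAt v k)

      encode : X → Fin N
      encode a = join v (v ℕ.* n) (untag a)

      decode-encode : ∀ a → decode (encode a) ≡ a
      decode-encode a = ≡.trans (cong tag (Fin.splitAt-join v (v ℕ.* n) (untag a))) (tag-untag a)

      decode-injective : ∀ {k l} → decode k ≡ decode l → k ≡ l
      decode-injective {k} {l} h = begin
        k                                     ≡⟨ Fin.join-splitAt v (v ℕ.* n) k ⟨
        join v (v ℕ.* n) (splitAt v k)        ≡⟨ cong (join v (v ℕ.* n)) splits ⟩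
        join v (v ℕ.* n) (splitAt v l)        ≡⟨ Fin.join-splitAt v (v ℕ.* n) l ⟩
        l                                     ∎
        where
        open ≡-Reasoning
        splits : splitAt v k ≡ splitAt v l
        splits = ≡.trans (≡.sym (untag-tag (splitAt v k)))
          (≡.trans (cong untag h) (untag-tag (splitAt v l)))

      ∑-decode : ∀ (f : X → ℕ) → ∑[ k < N ] f (decode k) ≡
                 ∑[ x < v ] f (inj₁ x) ℕ.+ ∑[ A < v ] ∑[ i < n ] f (inj₂ (A , i))
      ∑-decode f = ≡.trans (∑-++ v (λ k → f (decode k))) (cong₂ ℕ._+_
        (∑-cong λ x → cong (λ a → f (tag a)) (Fin.splitAt-↑ˡ v x (v ℕ.* n)))
        (≡.trans (∑-cong λ k → cong (λ a → f (tag a)) (Fin.splitAt-↑ʳ v (v ℕ.* n) k))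
          (≡.trans (∑-combine v (λ k → f (inj₂ (remQuot n k))))
            (∑-cong λ A → ∑-cong λ i → cong (λ a → f (inj₂ a)) (Fin.remQuot-combine A i)))))

    Points-size : HasSize Points N
    Points-size = enumerated Points (pointAt ∘ decode)
      (λ {k} {l} h → decode-injective (pointAt-injective (decode k) (decode l) h))
      (λ x → encode (proj₁ (pointAt-surjective x)) ,
        subst (λ a → pointAt a Points.≈ x) (≡.sym (decode-encode (proj₁ (pointAt-surjective x))))
          (proj₂ (pointAt-surjective x)))

    k : ℕ
    k = Parameters.k p t

    v≡ : v ≡ Parameters.v p t
    v≡ = θ≡ d

    n≡ : n ≡ Parameters.Q p t
    n≡ = cong₂ (λ q R → q ℕ.* (q ℕ.* R)) q≡1+p R≡

    opaque
      ∈block? : ∀ B x → Dec (block B x)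
      ∈block? B = restrict-dec points-size (block-size B) (λ {x} {x′} → block-resp B {x} {x′})

    I : Fin v → Fin v → ℕ
    I x B = 𝟙 (∈block? (Inverse.from blocks-size B) (Inverse.from points-size x))

    I-01 : ∀ x B → I x B ≡ 0 ⊎ I x B ≡ 1
    I-01 x B = go (∈block? (Inverse.from blocks-size B) (Inverse.from points-size x))
      where
      go : ∀ {a} {A : Set a} (d : Dec A) → 𝟙 d ≡ 0 ⊎ 𝟙 d ≡ 1
      go (yes _) = inj₂ ≡.refl
      go (no _)  = inj₁ ≡.refl

    I-block-size : ∀ B → ∑[ x < v ] I x B ≡ k
    I-block-size B = ≡.trans (≡.sym (over-∑ points-size (λ x → 𝟙 (∈block? b x))))
      (≡.trans (count-restrict points-size (∈block? b) (λ {x} {x′} → block-resp b {x} {x′}) (block-size b))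
        (θ≡ (1 ℕ.+ e)))
      where
      b : Block
      b = Inverse.from blocks-size B

    I-pair-degree : ∀ {x x′} → x ≢ x′ → ∑[ B < v ] (I x B ℕ.* I x′ B) ≡ t
    I-pair-degree {x} {x′} x≢x′ = ≡.trans
      (∑-cong λ B → ≡.sym (𝟙-× (∈block? (Inverse.from blocks-size B) X₁) (∈block? (Inverse.from blocks-size B) X₂)))
      (≡.trans (≡.sym (over-∑ blocks-size (λ b → 𝟙 (∈block? b X₁ ×-dec ∈block? b X₂))))
        (≡.trans (count-restrict blocks-size (λ b → ∈block? b X₁ ×-dec ∈block? b X₂)
            (λ (h , _) (r , r′) → h X₁ r , h X₂ r′)
            (blocksThrough-size X₁ X₂ λ h → x≢x′ (from-injective points-size h)))
          (θ≡ e)))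
      where
      X₁ X₂ : PointsU.Carrier
      X₁ = Inverse.from points-size x
      X₂ = Inverse.from points-size x′

    parameters : t ℕ.* v ℕ.+ k ≡ k ℕ.* k ℕ.+ t
    parameters = ≡.trans (cong (λ v → t ℕ.* v ℕ.+ k) v≡) (Parameters.parameters p t)

    1<k : 1 ℕ.< k
    1<k = ℕ.s≤s (ℕ.≤-trans (0<t 1≤e) (ℕ.m≤m+n t _))
      where
      0<t : ∀ {e} → 1 ℕ.≤ e → 1 ℕ.≤ geometric (1 ℕ.+ p) e
      0<t (ℕ.s≤s _) = ℕ.s≤s ℕ.z≤n

    I-idem : ∀ x B → I x B ℕ.* I x B ≡ I x B
    I-idem x B = 𝟙-idem (∈block? (Inverse.from blocks-size B) (Inverse.from points-size x))

    open DualDesign I I-idem I-block-size I-pair-degree parameters 1<k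

    opaque
      perpCounts′ : PerpCounts p t (1 ℕ.+ p) (1 ℕ.+ p ℕ.* t) perp
      perpCounts′ = ≡.subst₂ (λ q R → PerpCounts p t q R perp) q≡1+p R≡
        (perpCounts {q ℕ.^ e} {t} ≡.refl R≡)

    open Counts p t v≡ n≡ (ℕ.>-nonZero⁻¹ p) I I-01 I-block-size point-degree I-pair-degree meet-≢
      perp perpCounts′ hiding (X)

    Γᵩ : Graph Points _
    Γᵩ = Γ ω U 𝐃 φ

    open Graph Γᵩ using (_~_)

    M-01 : ∀ a b → M a b ≡ 0 ⊎ M a b ≡ 1
    M-01 (inj₁ _)       (inj₁ _)       = inj₂ ≡.refl
    M-01 (inj₁ x)       (inj₂ (B , _)) = I-01 x B
    M-01 (inj₂ (B , _)) (inj₁ x)       = I-01 x B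
    M-01 (inj₂ (A , i)) (inj₂ (B , j)) = PerpCounts.perp-01 perpCounts′ A i B j

    M-refl : ∀ a → M a a ≡ 1
    M-refl (inj₁ _)       = ≡.refl
    M-refl (inj₂ (A , i)) = 𝟙-yes (⟨ vec A i , vec A i ⟩ ≟ 0#) (alternating (vec A i))

    ⊥point⇒ : ∀ {A i z} → (⟦ point (vec≉0 A i) ⟧ ⊥) z → ⟨ z , vec A i ⟩ ≈ 0#
    ⊥point⇒ {A} {i} h = h (vec A i) (vec∈point A i)

    ⊥point⇐ : ∀ {A i z} → ⟨ z , vec A i ⟩ ≈ 0# → (⟦ point (vec≉0 A i) ⟧ ⊥) z
    ⊥point⇐ {A} {i} {z} h w (lift (a , w≈)) = trans (⟨⟩-cong ≈ᴹ-refl w≈)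
      (trans (⟨⟩-*ʳ a z (vec A i)) (trans (*-congˡ h) (zeroʳ a)))

    hyperplaneAt-⊥ : ∀ A i → ⟦ proj₁ (hyperplaneAt A) ⟧ Unary.≐′ (⟦ point (vec≉0 A i) ⟧ ⊥ Unary.∩ ⟦ U ⟧)
    hyperplaneAt-⊥ A i =
        (λ z z∈H → let z∈U = proj₂ (hyperplaneAt A) z z∈H in
          ⊥point⇐ (trans (⟨vec⟩-onU z∈U A i) (H⇒⊥y A z∈H)) , z∈U)
      , (λ z (z⊥ , z∈U) → ⊥y⇒H A z∈U (trans (sym (⟨vec⟩-onU z∈U A i)) (⊥point⇒ z⊥)))

    blockAt : Fin v → Block
    blockAt = Inverse.from blocks-size

    U-point : Fin v → PointsU.Carrier
    U-point = Inverse.from points-size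

    adjacent⇒I : ∀ {x A i} → Adjacent ω U 𝐃 φ (pointAt (inj₁ x)) (pointAt (inj₂ (A , i))) → I x A ≡ 1
    adjacent⇒I {x} {A} {i} (both-in _ _ h)      = contradiction h (outside A i)
    adjacent⇒I {x} {A} {i} (both-out _ h _ _)   = contradiction (inside x) h
    adjacent⇒I {x} {A} {i} (out-in h _ _)       = contradiction (inside x) h
    adjacent⇒I {x} {A} {i} (in-out _ _ (mk x⊆U H H≐ x∈)) =
      𝟙-yes (∈block? (blockAt A) (U-point x)) (proj₁ (φ-hyperplaneAt A) (U-point x)
        (proj₁ (φ.cong {H} {hyperplaneAt A} H≈) (U-point x)
          (block-resp (φ.to H) {pointAt (inj₁ x) , x⊆U} {U-point x} (PointsU.refl {U-point x}) x∈)))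
      where
      H≈ : H 𝓗.≈ hyperplaneAt A
      H≈ = (λ z h → proj₂ (hyperplaneAt-⊥ A i) z (proj₁ H≐ z h))
         , (λ z h → proj₂ H≐ z (proj₁ (hyperplaneAt-⊥ A i) z h))

    I⇒adjacent : ∀ {x A i} → I x A ≡ 1 → Adjacent ω U 𝐃 φ (pointAt (inj₁ x)) (pointAt (inj₂ (A , i)))
    I⇒adjacent {x} {A} {i} h = in-out (inside x) (outside A i)
      (mk (inside x) (hyperplaneAt A) (hyperplaneAt-⊥ A i)
        (proj₂ (φ-hyperplaneAt A) (U-point x) (𝟙≡1⇒ (∈block? (blockAt A) (U-point x)) h)))

    adjacent⇒perp : ∀ {A i B j} → Adjacent ω U 𝐃 φ (pointAt (inj₂ (A , i))) (pointAt (inj₂ (B , j))) →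
                      perp A i B j ≡ 1
    adjacent⇒perp {A} {i} {B} {j} (both-in _ h _)  = contradiction h (outside A i)
    adjacent⇒perp {A} {i} {B} {j} (in-out h _ _)   = contradiction h (outside A i)
    adjacent⇒perp {A} {i} {B} {j} (out-in _ h _)   = contradiction h (outside B j)
    adjacent⇒perp {A} {i} {B} {j} (both-out _ _ _ h) = 𝟙-yes (⟨ vec B j , vec A i ⟩ ≟ 0#)
      (⟨⟩-reflexive (⊥point⇒ (h (vec A i) (vec∈point A i))))

    perp⇒adjacent : ∀ {A i B j} → (A , i) ≢ (B , j) → perp A i B j ≡ 1 →
                      Adjacent ω U 𝐃 φ (pointAt (inj₂ (A , i))) (pointAt (inj₂ (B , j)))
    perp⇒adjacent {A} {i} {B} {j} Ai≢Bj h = both-out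
      (λ r → Ai≢Bj (inj₂-injective (pointAt-injective (inj₂ (A , i)) (inj₂ (B , j)) r)))
      (outside A i) (outside B j)
      λ z (lift (a , z≈)) → ⊥point⇐ (trans (⟨⟩-congˡ (vec B j) z≈) (trans (⟨⟩-*ˡ a _ _)
        (trans (*-congˡ (⟨⟩-reflexive (𝟙≡1⇒ (⟨ vec B j , vec A i ⟩ ≟ 0#) h))) (zeroʳ a))))
      where
      inj₂-injective : ∀ {a b : Fin v × Fin n} → _≡_ {A = X} (inj₂ a) (inj₂ b) → a ≡ b
      inj₂-injective ≡.refl = ≡.refl

    adjacent⇒M : ∀ a b → pointAt a ~ pointAt b → M a b ≡ 1
    adjacent⇒M (inj₁ _)       (inj₁ _)       _ = ≡.refl
    adjacent⇒M (inj₁ x)       (inj₂ (A , i)) h = adjacent⇒I {x} {A} {i} h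
    adjacent⇒M (inj₂ (A , i)) (inj₁ x)       h = adjacent⇒I {x} {A} {i}
      (Graph.~-sym Γᵩ {pointAt (inj₂ (A , i))} {pointAt (inj₁ x)} h)
    adjacent⇒M (inj₂ (A , i)) (inj₂ (B , j)) h = adjacent⇒perp {A} {i} {B} {j} h

    M⇒adjacent : ∀ a b → a ≢ b → M a b ≡ 1 → pointAt a ~ pointAt b
    M⇒adjacent (inj₁ x)       (inj₁ x′)      a≢b _ = both-in
      (λ r → a≢b (pointAt-injective (inj₁ x) (inj₁ x′) r)) (inside x) (inside x′)
    M⇒adjacent (inj₁ x)       (inj₂ (A , i)) _   h = I⇒adjacent {x} {A} {i} h
    M⇒adjacent (inj₂ (A , i)) (inj₁ x)       _   h =
      Graph.~-sym Γᵩ {pointAt (inj₁ x)} {pointAt (inj₂ (A , i))} (I⇒adjacent {x} {A} {i} h)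
    M⇒adjacent (inj₂ (A , i)) (inj₂ (B , j)) a≢b h =
      perp⇒adjacent {A} {i} {B} {j} (λ r → a≢b (cong inj₂ r)) h

    opaque
      adjacent? : ∀ i j → Dec (pointAt (decode i) ~ pointAt (decode j))
      adjacent? i j = map′
        (λ (i≢j , h) → M⇒adjacent (decode i) (decode j) (i≢j ∘ decode-injective) h)
        (λ h → (λ i≡j → Graph.~-irrefl Γᵩ {pointAt (decode i)} {pointAt (decode j)}
            (subst (λ l → pointAt (decode i) Points.≈ pointAt (decode l)) i≡j
              (Points.refl {pointAt (decode i)})) h)
          , adjacent⇒M (decode i) (decode j) h)
        (¬? (i Fin.≟ j) ×-dec (M (decode i) (decode j) ℕ.≟ 1))

    open FourVertices Γᵩ Points-size adjacent?

    M̂ : Fin N → Fin N → ℕ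
    M̂ i j = M (decode i) (decode j)

    closed-r : ∀ i j → closed (r i j) ≡ M̂ i j
    closed-r i j = go (i Fin.≟ j) (adjacent? i j)
      where
      go : (d : Dec (i ≡ j)) (e : Dec (pointAt (decode i) ~ pointAt (decode j))) →
           closed (relation d e) ≡ M̂ i j
      go (yes i≡j) _       = ≡.sym (≡.trans (cong (M̂ i) (≡.sym i≡j)) (M-refl (decode i)))
      go (no _)    (yes h) = ≡.sym (adjacent⇒M (decode i) (decode j) h)
      go (no i≢j)  (no ¬h) = zero-or (M-01 (decode i) (decode j))
        where
        zero-or : M̂ i j ≡ 0 ⊎ M̂ i j ≡ 1 → 0 ≡ M̂ i j
        zero-or (inj₁ h) = ≡.sym h
        zero-or (inj₂ h) = contradiction (M⇒adjacent (decode i) (decode j) (i≢j ∘ decode-injective) h) ¬h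

    degree≡′ : ∀ i → ∑[ j < N ] closed (r i j) ≡ _
    degree≡′ i = ≡.trans (∑-cong (closed-r i)) (≡.trans (∑-decode (M (decode i))) (degree (decode i)))

    common≡′ : ∀ i j → i ≢ j → Scheme.S r r-refl r-eq r-sym closed closed i j ≡ _
    common≡′ i j i≢j = ≡.trans (∑-cong λ l → cong₂ ℕ._*_ (closed-r i l) (closed-r j l))
      (≡.trans (∑-decode (λ z → M (decode i) z ℕ.* M (decode j) z))
        (common (decode i) (decode j) (i≢j ∘ decode-injective)))

    edges≡ : ∀ i j → T closed closed closed closed closed i j ≡ edges (decode i) (decode j)
    edges≡ i j = ≡.trans
      (∑-cong λ z → cong₂ ℕ._*_ (cong₂ ℕ._*_ (closed-r i z) (closed-r j z)) (≡.trans
        (∑-cong λ w → cong₂ ℕ._*_ (cong₂ ℕ._*_ (closed-r i w) (closed-r j w)) (closed-r z w))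
        (∑-decode (λ w → M (decode i) w ℕ.* M (decode j) w ℕ.* M (decode z) w))))
      (∑-decode (λ z → M (decode i) z ℕ.* M (decode j) z ℕ.*
        ∑ˣ (λ w → M (decode i) w ℕ.* M (decode j) w ℕ.* M z w)))

    edges-offDiagonal : OffDiagonal (T closed closed closed closed closed)
    edges-offDiagonal i j i′ j′ i≢j i′≢j′ h = begin
      T closed closed closed closed closed i j
        ≡⟨ value i j i≢j ⟩
      Parameters.edgeCount p t (closed (r i j))
        ≡⟨ cong (λ l → Parameters.edgeCount p t (closed l)) h ⟩
      Parameters.edgeCount p t (closed (r i′ j′))
        ≡⟨ value i′ j′ i′≢j′ ⟨
      T closed closed closed closed closed i′ j′ ∎
      where
      open ≡-Reasoning
      value : ∀ i j → i ≢ j → T closed closed closed closed closed i j ≡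
              Parameters.edgeCount p t (closed (r i j))
      value i j i≢j = ≡.trans (edges≡ i j) (≡.trans
        (edges-constant (decode i) (decode j) (i≢j ∘ decode-injective))
        (cong (Parameters.edgeCount p t) (≡.sym (closed-r i j))))

  fourVertexCondition : VertexCondition (Γ ω U 𝐃 φ) 4
  fourVertexCondition = vertexCondition
    (Regular.T-invariant _ _ degree≡′ common≡′ edges-offDiagonal)

open import Data.Nat.Base using (_≤_; _∸_; _*_; z≤n; s≤s)
open import Relation.Unary using () renaming (U to Whole)

proposition7p8 :
    ∀ {c ℓ₁ ℓ₂ m ℓm b e} {q d : ℕ} → 3 ≤ d →
    (F : FiniteField c ℓ₁ ℓ₂ q) →
    (V : Module (FiniteField.commutativeRing F) m ℓm) →
    let open FiniteField F using (θ)
        open Geometry F V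
    in
    Basis Whole (2 * d) →
    (ω : SymplecticForm) →
    (U : Subspace d) → SymplecticForm.TotallyIsotropic ω U →
    (𝐃 : SymmetricDesign (PointsIn U) (θ d) (θ (d ∸ 1)) (θ (d ∸ 2)) b e) →
    (φ : Bijection (Hyperplanes U) (SymmetricDesign.Blocks 𝐃)) →
    VertexCondition (Γ ω U 𝐃 φ) 4
proposition7p8 (s≤s (s≤s (s≤s _))) F V basis ω U isotropic 𝐃 φ =
  Configuration.fourVertexCondition (s≤s z≤n) F V basis ω U isotropic 𝐃 φ
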